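{- Let $n\ge2$, $b\ge2$, $c>0$, and $r=\lceil\log_b(cn)\rceil$. Let $P^r_0$ denote the distribution on $\{0,\dots,n-1\}$ of the base-$b$ carries chain after $r$ steps started from $0$, and let $\pi(j)=A(n,j)/n!$ be its stationary distribution. Then $$\|P^r_0-\pi\|_{TV}\le\tfrac12\sqrt{e^{1/(2c^2)}-1}.$$
   Context: $A(n,j)$ is the number of permutations $\sigma\in S_n$ with exactly $j$ descents (a descent at $i$, $1\le i\le n-1$, means $\sigma(i+1)<\sigma(i)$). The base-$b$ carries chain for adding $n$ numbers is the Markov chain on $\{0,\dots,n-1\}$ given by $\kappa_0=0$, $\kappa_{t+1}=\lfloor(\kappa_t+X_{t+1,1}+\dots+X_{t+1,n})/b\rfloor$ with $X_{t,k}$ i.i.d. uniform on $\{0,\dots,b-1\}$. Total variation distance: $\|P-Q\|_{TV}=\frac12\sum_x|P(x)-Q(x)|$. -}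

module Defs where

open import Data.Bool.Base using (if_then_else_)
open import Data.Fin.Base as Fin using (Fin; toℕ)
import Data.Fin.Properties as Fin
open import Data.Integer.Base as ℤ using (ℤ)
import Data.Integer.Properties as ℤ
open import Data.List.Base as List using (List; []; _∷_; allFin; cartesianProductWith; filter; length)
open import Data.Nat.Base as ℕ using (ℕ; zero; suc; _!)
import Data.Nat.Properties as ℕ
import Data.Nat.Solver as ℕ-Solver
open import Data.Product using (_×_; _,_; ∃-syntax; proj₁; proj₂)
open import Data.Rational.Base
import Data.Rational.Properties as ℚ
open import Data.Rational.Solver using (module +-*-Solver)
import Data.Rational.Unnormalised.Base as ℚᵘ
import Data.Rational.Unnormalised.Properties as ℚᵘ
open import Data.Sum.Base as Sum using (_⊎_; inj₁; inj₂)
open import Data.Vec.Base as Vec using (Vec; []; _∷_)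
open import Data.Vec.Relation.Unary.AllPairs using (allPairs?)
open import Function.Base using (_∘_; case_of_)
open import Relation.Binary.PropositionalEquality
open import Relation.Nullary
open import Relation.Unary using (Decidable)

open import Algebra.Definitions.RawSemiring +-*-rawSemiring using (_^_)
open import Algebra.Properties.CommutativeMonoid.Sum ℚ.+-0-commutativeMonoid using (sum)

open +-*-Solver using (solve; _:=_; _:+_; _:*_; _:-_; :-_; con)
private module ℕS = ℕ-Solver.+-*-Solver

ι : ℕ → ℚ
ι n = ℤ.+ n / 1

to-/ : ∀ i n → toℚᵘ (i / suc n) ℚᵘ.≃ ℚᵘ.mkℚᵘ i n
to-/ i n = ℚ.toℚᵘ-fromℚᵘ (ℚᵘ.mkℚᵘ i n)

recip : (k : ℕ) → .{{ℕ.NonZero k}} → ℚ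
recip k = ℤ.+ 1 / k

from-+ : ∀ p q → fromℚᵘ (p ℚᵘ.+ q) ≡ fromℚᵘ p + fromℚᵘ q
from-+ p q = ℚ.toℚᵘ-injective (ℚᵘ.≃-trans (ℚ.toℚᵘ-fromℚᵘ _)
  (ℚᵘ.≃-trans (ℚᵘ.+-cong (ℚᵘ.≃-sym (ℚ.toℚᵘ-fromℚᵘ p)) (ℚᵘ.≃-sym (ℚ.toℚᵘ-fromℚᵘ q)))
    (ℚᵘ.≃-sym (ℚ.toℚᵘ-homo-+ (fromℚᵘ p) (fromℚᵘ q)))))

from-* : ∀ p q → fromℚᵘ (p ℚᵘ.* q) ≡ fromℚᵘ p * fromℚᵘ q
from-* p q = ℚ.toℚᵘ-injective (ℚᵘ.≃-trans (ℚ.toℚᵘ-fromℚᵘ _)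
  (ℚᵘ.≃-trans (ℚᵘ.*-cong (ℚᵘ.≃-sym (ℚ.toℚᵘ-fromℚᵘ p)) (ℚᵘ.≃-sym (ℚ.toℚᵘ-fromℚᵘ q)))
    (ℚᵘ.≃-sym (ℚ.toℚᵘ-homo-* (fromℚᵘ p) (fromℚᵘ q)))))

ι-+ : ∀ m n → ι (m ℕ.+ n) ≡ ι m + ι n
ι-+ m n = trans (ℚ.fromℚᵘ-cong {ℚᵘ.mkℚᵘ (ℤ.+ (m ℕ.+ n)) 0} {ℚᵘ.mkℚᵘ (ℤ.+ m) 0 ℚᵘ.+ ℚᵘ.mkℚᵘ (ℤ.+ n) 0}
   (ℚᵘ.*≡* (cong (ℤ._* ℤ.1ℤ) (sym (cong₂ ℤ._+_ (ℤ.*-identityʳ (ℤ.+ m)) (ℤ.*-identityʳ (ℤ.+ n)))))))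
   (from-+ (ℚᵘ.mkℚᵘ (ℤ.+ m) 0) (ℚᵘ.mkℚᵘ (ℤ.+ n) 0))

ι-* : ∀ m n → ι (m ℕ.* n) ≡ ι m * ι n
ι-* m n = trans (ℚ.fromℚᵘ-cong {ℚᵘ.mkℚᵘ (ℤ.+ (m ℕ.* n)) 0} {ℚᵘ.mkℚᵘ (ℤ.+ m) 0 ℚᵘ.* ℚᵘ.mkℚᵘ (ℤ.+ n) 0}
   (ℚᵘ.*≡* (cong (ℤ._* ℤ.1ℤ) (ℤ.pos-* m n))))
   (from-* (ℚᵘ.mkℚᵘ (ℤ.+ m) 0) (ℚᵘ.mkℚᵘ (ℤ.+ n) 0))

ι-^ : ∀ m n → ι (m ℕ.^ n) ≡ ι m ^ n
ι-^ m zero = refl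
ι-^ m (suc n) = trans (ι-* m (m ℕ.^ n)) (cong (ι m *_) (ι-^ m n))

ι-mono : ∀ {m n} → m ℕ.≤ n → ι m ≤ ι n
ι-mono {m} {n} m≤n = ℚ.toℚᵘ-cancel-≤ (ℚᵘ.≤-respˡ-≃ (ℚᵘ.≃-sym (to-/ (ℤ.+ m) 0)) (ℚᵘ.≤-respʳ-≃ (ℚᵘ.≃-sym (to-/ (ℤ.+ n) 0))
  (ℚᵘ.*≤* (ℤ.*-monoʳ-≤-nonNeg ℤ.1ℤ (ℤ.+≤+ m≤n)))))

ι-cancel : ∀ {m n} → ι m ≤ ι n → m ℕ.≤ n
ι-cancel {m} {n} le = case m ℕ.≤? n of λ where
    (yes p) → p
    (no ¬p) → contradiction (ℚ.<-≤-trans (lt n) (ℚ.≤-trans (ι-mono (ℕ.≰⇒> ¬p)) le)) (ℚ.<-irrefl refl)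
  where
  lt : ∀ n → ι n < ι (suc n)
  lt n = subst₂ _<_ (ℚ.+-identityˡ (ι n)) (sym (ι-+ 1 n)) (ℚ.+-monoˡ-< (ι n) (ℚ.positive⁻¹ 1ℚ))

/-ι : ∀ l k → .{{_ : ℕ.NonZero k}} → ℤ.+ l / k ≡ ι l * recip k
/-ι l (suc k) = trans (ℚ.fromℚᵘ-cong {ℚᵘ.mkℚᵘ (ℤ.+ l) k} {ℚᵘ.mkℚᵘ (ℤ.+ l) 0 ℚᵘ.* ℚᵘ.mkℚᵘ (ℤ.+ 1) k}
   (ℚᵘ.*≡* (cong₂ ℤ._*_ (sym (ℤ.*-identityʳ (ℤ.+ l))) (cong (ℤ.+_ ∘ suc) (ℕ.+-identityʳ k)))))
   (from-* (ℚᵘ.mkℚᵘ (ℤ.+ l) 0) (ℚᵘ.mkℚᵘ (ℤ.+ 1) k))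

ι-recip : ∀ k → .{{_ : ℕ.NonZero k}} → ι k * recip k ≡ 1ℚ
ι-recip k@(suc k-1) = trans (sym (/-ι k k)) (ℚ.fromℚᵘ-cong {ℚᵘ.mkℚᵘ (ℤ.+ k) k-1} {ℚᵘ.1ℚᵘ} (ℚᵘ.*≡* (ℤ.*-comm (ℤ.+ k) ℤ.1ℤ)))

recip>0 : ∀ k → .{{_ : ℕ.NonZero k}} → 0ℚ < recip k
recip>0 (suc k) = ℚ.positive⁻¹ _ {{ℚ.normalize-pos 1 (suc k)}}

0≤-* : ∀ {p q} → 0ℚ ≤ p → 0ℚ ≤ q → 0ℚ ≤ p * q
0≤-* {p} {q} 0≤p 0≤q = ℚ.nonNegative⁻¹ _ {{ℚ.nonNeg*nonNeg⇒nonNeg p {{nonNegative 0≤p}} q {{nonNegative 0≤q}}}}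

0<-* : ∀ {p q} → 0ℚ < p → 0ℚ < q → 0ℚ < p * q
0<-* {p} {q} 0<p 0<q = ℚ.positive⁻¹ _ {{ℚ.pos*pos⇒pos p {{positive 0<p}} q {{positive 0<q}}}}

*-monoˡ : ∀ {r p q} → 0ℚ ≤ r → p ≤ q → r * p ≤ r * q
*-monoˡ {r} 0≤r = ℚ.*-monoˡ-≤-nonNeg r {{nonNegative 0≤r}}

*-mono : ∀ {p q r s} → 0ℚ ≤ p → 0ℚ ≤ s → p ≤ q → r ≤ s → p * r ≤ q * s
*-mono {p} {q} {r} {s} 0≤p 0≤s p≤q r≤s =
  ℚ.≤-trans (*-monoˡ 0≤p r≤s) (ℚ.*-monoʳ-≤-nonNeg s {{nonNegative 0≤s}} p≤q)

linear : ∀ {p q r s} → r ≤ s → q - p ≡ s - r → p ≤ q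
linear {p} {q} {r} {s} r≤s eq = begin
  p            ≡⟨ solve 2 (λ p r → p := p :- r :+ r) refl p r ⟩
  p - r + r    ≤⟨ ℚ.+-monoʳ-≤ (p - r) r≤s ⟩
  p - r + s    ≡⟨ solve 3 (λ p r s → p :- r :+ s := p :+ (s :- r)) refl p r s ⟩
  p + (s - r)  ≡⟨ cong (p +_) eq ⟨
  p + (q - p)  ≡⟨ solve 2 (λ p q → p :+ (q :- p) := q) refl p q ⟩
  q            ∎
  where open ℚ.≤-Reasoning

p≤∣p∣ : ∀ p → p ≤ ∣ p ∣
p≤∣p∣ p = case ℚ.≤-total 0ℚ p of λ where
  (inj₁ 0≤p) → ℚ.≤-reflexive (sym (ℚ.0≤p⇒∣p∣≡p 0≤p))
  (inj₂ p≤0) → ℚ.≤-trans p≤0 (ℚ.0≤∣p∣ p)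

∣∣≤ : ∀ {p q} → p ≤ q → - p ≤ q → ∣ p ∣ ≤ q
∣∣≤ {p} {q} p≤q -p≤q = case ℚ.∣p∣≡p∨∣p∣≡-p p of λ where
  (inj₁ eq) → subst (_≤ q) (sym eq) p≤q
  (inj₂ eq) → subst (_≤ q) (sym eq) -p≤q

half+half : ∀ ε → ε * ½ + ε * ½ ≡ ε
half+half = solve 1 (λ ε → ε :* con ½ :+ ε :* con ½ := ε) refl

0<half : ∀ {ε} → 0ℚ < ε → 0ℚ < ε * ½
0<half 0<ε = 0<-* 0<ε (ℚ.positive⁻¹ ½)

-- inv 0 = 0.
inv : ℚ → ℚ
inv p with p ℚ.≟ 0ℚ
... | yes _  = 0ℚ
... | no p≢0 = (1/ p) {{≢-nonZero p≢0}}

*-inv : ∀ {p} → 0ℚ < p → p * inv p ≡ 1ℚ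
*-inv {p} 0<p with p ℚ.≟ 0ℚ
... | yes p≡0 = contradiction (sym p≡0) (ℚ.<⇒≢ 0<p)
... | no p≢0  = ℚ.*-inverseʳ p {{≢-nonZero p≢0}}

inv>0 : ∀ {p} → 0ℚ < p → 0ℚ < inv p
inv>0 {p} 0<p = ℚ.≰⇒> λ le → ℚ.<-irrefl refl
  (ℚ.<-≤-trans (ℚ.positive⁻¹ 1ℚ) (subst₂ _≤_ (*-inv 0<p) (ℚ.*-zeroʳ p) (*-monoˡ (ℚ.<⇒≤ 0<p) le)))

recip≤1 : ∀ k → .{{_ : ℕ.NonZero k}} → recip k ≤ 1ℚ
recip≤1 k@(suc _) = subst₂ _≤_ (ℚ.*-identityʳ (recip k)) (trans (ℚ.*-comm (recip k) (ι k)) (ι-recip k))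
  (*-monoˡ (ℚ.<⇒≤ (recip>0 k)) (ι-mono {1} {k} (ℕ.s≤s ℕ.z≤n)))

≤ι∣↥∣ : ∀ p → p ≤ ι ℤ.∣ ↥ p ∣
≤ι∣↥∣ p@(mkℚ (ℤ.+ k) d _) = subst₂ _≤_ (trans (sym (/-ι k (suc d))) (ℚ.↥p/↧p≡p p)) (ℚ.*-identityʳ (ι k))
    (*-monoˡ (ι-mono {0} {k} ℕ.z≤n) (recip≤1 (suc d)))
≤ι∣↥∣ p@(mkℚ (ℤ.-[1+ n ]) d _) = ℚ.≤-trans (ℚ.nonPositive⁻¹ p) (ι-mono {0} {suc n} ℕ.z≤n)

⊔-left : ∀ M N {n} → M ℕ.⊔ N ℕ.≤ n → M ℕ.≤ n
⊔-left M N = ℕ.m⊔n≤o⇒m≤o M N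

⊔-right : ∀ M N {n} → M ℕ.⊔ N ℕ.≤ n → N ℕ.≤ n
⊔-right M N = ℕ.m⊔n≤o⇒n≤o M N

IsCauchy : (ℕ → ℚ) → Set
IsCauchy s = ∀ ε → 0ℚ < ε → ∃[ N ] ∀ m n → N ℕ.≤ m → N ℕ.≤ n → ∣ s m - s n ∣ ≤ ε

OneSided : (ℕ → ℚ) → Set
OneSided s = ∀ ε → 0ℚ < ε → ∃[ N ] ∀ m n → N ℕ.≤ m → N ℕ.≤ n → s m ≤ s n + ε

toOneSided : ∀ s → IsCauchy s → OneSided s
toOneSided s c ε 0<ε = let N , h = c ε 0<ε in N , λ m n N≤m N≤n →
  linear (ℚ.≤-trans (p≤∣p∣ (s m - s n)) (h m n N≤m N≤n))
    (solve 3 (λ a b ε → b :+ ε :- a := ε :- (a :- b)) refl (s m) (s n) ε)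

fromOneSided : ∀ s → OneSided s → IsCauchy s
fromOneSided s c ε 0<ε = let N , h = c ε 0<ε in N , λ m n N≤m N≤n → ∣∣≤
  (linear (h m n N≤m N≤n) (solve 3 (λ a b ε → ε :- (a :- b) := b :+ ε :- a) refl (s m) (s n) ε))
  (linear (h n m N≤n N≤m) (solve 3 (λ a b ε → ε :- (:- (a :- b)) := a :+ ε :- b) refl (s m) (s n) ε))

constCauchy : ∀ p → IsCauchy (λ _ → p)
constCauchy p ε 0<ε = 0 , λ _ _ _ _ → subst (_≤ ε) (cong ∣_∣ (sym (ℚ.+-inverseʳ p))) (ℚ.<⇒≤ 0<ε)

+-cauchy : ∀ s t → IsCauchy s → IsCauchy t → IsCauchy (λ n → s n + t n)
+-cauchy s t cs ct = fromOneSided (λ n → s n + t n) λ ε 0<ε →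
  let M , hs = toOneSided s cs (ε * ½) (0<half 0<ε)
      N , ht = toOneSided t ct (ε * ½) (0<half 0<ε)
  in M ℕ.⊔ N , λ m n le le′ → linear
       (ℚ.+-mono-≤ (hs m n (⊔-left M N le) (⊔-left M N le′))
                   (ht m n (⊔-right M N le) (⊔-right M N le′)))
       (solve 5 (λ a a′ b b′ ε → a′ :+ b′ :+ ε :- (a :+ b) :=
                   (a′ :+ ε :* con ½) :+ (b′ :+ ε :* con ½) :- (a :+ b))
          refl (s m) (s n) (t m) (t n) ε)

neg-cauchy : ∀ s → IsCauchy s → IsCauchy (λ n → - s n)
neg-cauchy s cs = fromOneSided (λ n → - s n) λ ε 0<ε →
  let N , h = toOneSided s cs ε 0<ε in N , λ m n le le′ → linear (h n m le′ le)
    (solve 3 (λ a b ε → :- b :+ ε :- (:- a) := a :+ ε :- b) refl (s m) (s n) ε)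

bounded : ∀ s → IsCauchy s → ∃[ M ] ∃[ N ] ∀ n → N ℕ.≤ n → ∣ s n ∣ ≤ ι (suc M)
bounded s cs =
  let N , h = cs 1ℚ (ℚ.positive⁻¹ 1ℚ)
      B = ∣ s N ∣ + 1ℚ
  in ℤ.∣ ↥ B ∣ , N , λ n N≤n → begin
       ∣ s n ∣                     ≡⟨ cong ∣_∣ (solve 2 (λ a b → a := b :+ (a :- b)) refl (s n) (s N)) ⟩
       ∣ s N + (s n - s N) ∣       ≤⟨ ℚ.∣p+q∣≤∣p∣+∣q∣ (s N) (s n - s N) ⟩
       ∣ s N ∣ + ∣ s n - s N ∣     ≤⟨ ℚ.+-monoʳ-≤ ∣ s N ∣ (h n N N≤n ℕ.≤-refl) ⟩
       B                           ≤⟨ ≤ι∣↥∣ B ⟩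
       ι ℤ.∣ ↥ B ∣                 ≤⟨ ι-mono {ℤ.∣ ↥ B ∣} {suc ℤ.∣ ↥ B ∣} (ℕ.n≤1+n _) ⟩
       ι (suc ℤ.∣ ↥ B ∣)           ∎
  where open ℚ.≤-Reasoning

0<ι : ∀ n → 0ℚ < ι (suc n)
0<ι n = ℚ.<-≤-trans (ℚ.positive⁻¹ 1ℚ) (ι-mono {1} {suc n} (ℕ.s≤s ℕ.z≤n))

*-cauchy : ∀ s t → IsCauchy s → IsCauchy t → IsCauchy (λ n → s n * t n)
*-cauchy s t cs ct ε 0<ε =
  let A , N₁ , hA = bounded s cs
      B , N₂ , hB = bounded t ct
      N₃ , hs = cs (ε * ½ * inv (ι (suc B))) (0<-* (0<half 0<ε) (inv>0 (0<ι B)))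
      N₄ , ht = ct (ε * ½ * inv (ι (suc A))) (0<-* (0<half 0<ε) (inv>0 (0<ι A)))
      N  = (N₁ ℕ.⊔ N₂) ℕ.⊔ (N₃ ℕ.⊔ N₄)
  in N , λ m n le le′ →
    let open ℚ.≤-Reasoning
    in begin
      ∣ s m * t m - s n * t n ∣
        ≡⟨ cong ∣_∣ (solve 4 (λ a a′ b b′ → a :* b :- a′ :* b′ := a :* (b :- b′) :+ b′ :* (a :- a′))
             refl (s m) (s n) (t m) (t n)) ⟩
      ∣ s m * (t m - t n) + t n * (s m - s n) ∣
        ≤⟨ ℚ.∣p+q∣≤∣p∣+∣q∣ (s m * (t m - t n)) (t n * (s m - s n)) ⟩
      ∣ s m * (t m - t n) ∣ + ∣ t n * (s m - s n) ∣
        ≡⟨ cong₂ _+_ (ℚ.∣p*q∣≡∣p∣*∣q∣ (s m) (t m - t n)) (ℚ.∣p*q∣≡∣p∣*∣q∣ (t n) (s m - s n)) ⟩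
      ∣ s m ∣ * ∣ t m - t n ∣ + ∣ t n ∣ * ∣ s m - s n ∣
        ≤⟨ ℚ.+-mono-≤
             (part A (ℚ.0≤∣p∣ (s m)) 0<ε (hA m (⊔-left N₁ N₂ (⊔-left (N₁ ℕ.⊔ N₂) (N₃ ℕ.⊔ N₄) le))) (ht m n (⊔-right N₃ N₄ (⊔-right (N₁ ℕ.⊔ N₂) (N₃ ℕ.⊔ N₄) le)) (⊔-right N₃ N₄ (⊔-right (N₁ ℕ.⊔ N₂) (N₃ ℕ.⊔ N₄) le′))))
             (part B (ℚ.0≤∣p∣ (t n)) 0<ε (hB n (⊔-right N₁ N₂ (⊔-left (N₁ ℕ.⊔ N₂) (N₃ ℕ.⊔ N₄) le′))) (hs m n (⊔-left N₃ N₄ (⊔-right (N₁ ℕ.⊔ N₂) (N₃ ℕ.⊔ N₄) le)) (⊔-left N₃ N₄ (⊔-right (N₁ ℕ.⊔ N₂) (N₃ ℕ.⊔ N₄) le′)))) ⟩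
      ε * ½ + ε * ½
        ≡⟨ half+half ε ⟩
      ε ∎
  where
  part : ∀ {p q ε} A → 0ℚ ≤ p → 0ℚ < ε → p ≤ ι (suc A) → q ≤ ε * ½ * inv (ι (suc A)) → p * q ≤ ε * ½
  part {p} {q} {ε} A 0≤p 0<ε p≤ q≤ = ℚ.≤-trans
    (*-mono 0≤p (ℚ.<⇒≤ (0<-* (0<half 0<ε) (inv>0 (0<ι A)))) p≤ q≤)
    (ℚ.≤-reflexive (trans (solve 3 (λ M h i → M :* (h :* i) := h :* (M :* i)) refl (ι (suc A)) (ε * ½) (inv (ι (suc A))))
      (trans (cong (ε * ½ *_) (*-inv (0<ι A))) (ℚ.*-identityʳ (ε * ½)))))

^-cauchy : ∀ s k → IsCauchy s → IsCauchy (λ n → s n ^ k)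
^-cauchy s zero    cs = constCauchy 1ℚ
^-cauchy s (suc k) cs = *-cauchy s (λ n → s n ^ k) cs (^-cauchy s k cs)

EventuallyPositive : (ℕ → ℚ) → Set
EventuallyPositive s = ∃[ δ ] 0ℚ < δ × ∃[ N ] ∀ n → N ℕ.≤ n → 0ℚ + δ ≤ s n

inv-anti : ∀ {p q} → 0ℚ < p → p ≤ q → inv q ≤ inv p
inv-anti {p} {q} 0<p p≤q = let 0<q = ℚ.<-≤-trans 0<p p≤q in subst₂ _≤_
   (trans (solve 3 (λ p i j → i :* j :* p := (p :* i) :* j) refl p (inv p) (inv q)) (trans (cong (_* inv q) (*-inv 0<p)) (ℚ.*-identityˡ _)))
   (trans (solve 3 (λ q i j → i :* j :* q := (q :* j) :* i) refl q (inv p) (inv q)) (trans (cong (_* inv p) (*-inv 0<q)) (ℚ.*-identityˡ _)))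
   (*-monoˡ (ℚ.<⇒≤ (0<-* (inv>0 0<p) (inv>0 0<q))) p≤q)

inv-cauchy : ∀ s → EventuallyPositive s → IsCauchy s → IsCauchy (λ n → inv (s n))
inv-cauchy s (δ , 0<δ , N₁ , hδ) cs = fromOneSided (λ n → inv (s n)) λ ε 0<ε →
  let η = ε * (δ * δ)
      0<η = 0<-* 0<ε (0<-* 0<δ 0<δ)
      N₂ , h = toOneSided s cs η 0<η
  in N₁ ℕ.⊔ N₂ , λ m n le le′ →
    let δ≤m = subst (_≤ s m) (ℚ.+-identityˡ δ) (hδ m (⊔-left N₁ N₂ le))
        δ≤n = subst (_≤ s n) (ℚ.+-identityˡ δ) (hδ n (⊔-left N₁ N₂ le′))
        0<m = ℚ.<-≤-trans 0<δ δ≤m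
        0<n = ℚ.<-≤-trans 0<δ δ≤n
        sn-sm≤η : s n - s m ≤ η
        sn-sm≤η = linear (h n m (⊔-right N₁ N₂ le′) (⊔-right N₁ N₂ le))
          (solve 3 (λ a b ε → ε :- (b :- a) := a :+ ε :- b) refl (s m) (s n) η)
        open ℚ.≤-Reasoning
    in begin
      inv (s m)
        ≡⟨ solve 2 (λ i j → i := j :+ (con 1ℚ :* i :- con 1ℚ :* j)) refl (inv (s m)) (inv (s n)) ⟩
      inv (s n) + (1ℚ * inv (s m) - 1ℚ * inv (s n))
        ≡⟨ cong₂ (λ x y → inv (s n) + (x * inv (s m) - y * inv (s n))) (*-inv 0<n) (*-inv 0<m) ⟨
      inv (s n) + (s n * inv (s n) * inv (s m) - s m * inv (s m) * inv (s n))
        ≡⟨ solve 4 (λ a b i j → j :+ (b :* j :* i :- a :* i :* j) := j :+ (i :* j) :* (b :- a)) refl (s m) (s n) (inv (s m)) (inv (s n)) ⟩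
      inv (s n) + (inv (s m) * inv (s n)) * (s n - s m)
        ≤⟨ ℚ.+-monoʳ-≤ (inv (s n)) (*-mono (ℚ.<⇒≤ (0<-* (inv>0 0<m) (inv>0 0<n))) (ℚ.<⇒≤ 0<η)
             (*-mono (ℚ.<⇒≤ (inv>0 0<m)) (ℚ.<⇒≤ (inv>0 0<δ)) (inv-anti 0<δ δ≤m) (inv-anti 0<δ δ≤n)) sn-sm≤η) ⟩
      inv (s n) + (inv δ * inv δ) * (ε * (δ * δ))
        ≡⟨ cong (inv (s n) +_) (solve 3 (λ ε d i → (i :* i) :* (ε :* (d :* d)) := ε :* ((d :* i) :* (d :* i))) refl ε δ (inv δ)) ⟩
      inv (s n) + ε * ((δ * inv δ) * (δ * inv δ))
        ≡⟨ cong (λ x → inv (s n) + ε * (x * x)) (*-inv 0<δ) ⟩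
      inv (s n) + ε * (1ℚ * 1ℚ)
        ≡⟨ cong (inv (s n) +_) (ℚ.*-identityʳ ε) ⟩
      inv (s n) + ε ∎

*-positive : ∀ s t → EventuallyPositive s → EventuallyPositive t → EventuallyPositive (λ n → s n * t n)
*-positive s t (δ , 0<δ , M , hs) (η , 0<η , N , ht) = δ * η , 0<-* 0<δ 0<η , M ℕ.⊔ N , λ n le →
  subst (_≤ s n * t n) (solve 2 (λ d e → (con 0ℚ :+ d) :* (con 0ℚ :+ e) := con 0ℚ :+ d :* e) refl δ η)
    (*-mono (subst (0ℚ ≤_) (sym (ℚ.+-identityˡ δ)) (ℚ.<⇒≤ 0<δ))
            (ℚ.≤-trans (subst (0ℚ ≤_) (sym (ℚ.+-identityˡ η)) (ℚ.<⇒≤ 0<η)) (ht n (⊔-right M N le)))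
            (hs n (⊔-left M N le)) (ht n (⊔-right M N le)))

1/! : ℕ → ℚ
1/! k = recip (k !) {{k ℕ.!≢0}}

-- expSum u k = Σ_{i<k} uⁱ/i!
expSum : ℚ → ℕ → ℚ
expSum u zero    = 0ℚ
expSum u (suc k) = expSum u k + u ^ k * 1/! k

recip-* : ∀ m n .{{_ : ℕ.NonZero m}} .{{_ : ℕ.NonZero n}} .{{_ : ℕ.NonZero (m ℕ.* n)}} →
          recip (m ℕ.* n) ≡ recip m * recip n
recip-* m n = begin
  recip (m ℕ.* n)
    ≡⟨ ℚ.*-identityʳ _ ⟨
  recip (m ℕ.* n) * (1ℚ * 1ℚ)
    ≡⟨ cong₂ (λ x y → recip (m ℕ.* n) * (x * y)) (ι-recip m) (ι-recip n) ⟨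
  recip (m ℕ.* n) * ((ι m * recip m) * (ι n * recip n))
    ≡⟨ solve 5 (λ r a i b j → r :* ((a :* i) :* (b :* j)) := ((a :* b) :* r) :* (i :* j)) refl
         (recip (m ℕ.* n)) (ι m) (recip m) (ι n) (recip n) ⟩
  ((ι m * ι n) * recip (m ℕ.* n)) * (recip m * recip n)
    ≡⟨ cong (λ x → (x * recip (m ℕ.* n)) * (recip m * recip n)) (ι-* m n) ⟨
  (ι (m ℕ.* n) * recip (m ℕ.* n)) * (recip m * recip n)
    ≡⟨ cong (_* (recip m * recip n)) (ι-recip (m ℕ.* n)) ⟩
  1ℚ * (recip m * recip n)
    ≡⟨ ℚ.*-identityˡ _ ⟩
  recip m * recip n ∎
  where open ≡-Reasoning

∣term∣ : ℚ → ℕ → ℚ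
∣term∣ u k = ∣ u ^ k * 1/! k ∣

∣term∣-suc : ∀ u k → ∣term∣ u (suc k) ≡ ∣ u ∣ * recip (suc k) * ∣term∣ u k
∣term∣-suc u k = begin
  ∣ u ^ suc k * 1/! (suc k) ∣
    ≡⟨ cong (λ r → ∣ u * u ^ k * r ∣) (recip-* (suc k) (k !) {{_}} {{k ℕ.!≢0}} {{suc k ℕ.!≢0}}) ⟩
  ∣ u * u ^ k * (recip (suc k) * 1/! k) ∣
    ≡⟨ cong ∣_∣ (solve 4 (λ u v i j → u :* v :* (i :* j) := u :* i :* (v :* j)) refl u (u ^ k) (recip (suc k)) (1/! k)) ⟩
  ∣ u * recip (suc k) * (u ^ k * 1/! k) ∣
    ≡⟨ ℚ.∣p*q∣≡∣p∣*∣q∣ (u * recip (suc k)) (u ^ k * 1/! k) ⟩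
  ∣ u * recip (suc k) ∣ * ∣term∣ u k
    ≡⟨ cong (_* ∣term∣ u k) (trans (ℚ.∣p*q∣≡∣p∣*∣q∣ u (recip (suc k)))
         (cong (∣ u ∣ *_) (ℚ.0≤p⇒∣p∣≡p (ℚ.<⇒≤ (recip>0 (suc k)))))) ⟩
  ∣ u ∣ * recip (suc k) * ∣term∣ u k ∎
  where open ≡-Reasoning

module _ (u : ℚ) (M : ℕ) (∣u∣≤M : ∣ u ∣ ≤ ι M) where

  ∣term∣≤ : ∀ k → ∣term∣ u k ≤ ι (M ℕ.^ k)
  ∣term∣≤ zero    = ℚ.≤-refl
  ∣term∣≤ (suc k) = begin
    ∣term∣ u (suc k)                      ≡⟨ ∣term∣-suc u k ⟩
    ∣ u ∣ * recip (suc k) * ∣term∣ u k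
      ≤⟨ *-mono (0≤-* (ℚ.0≤∣p∣ u) (ℚ.<⇒≤ (recip>0 (suc k)))) (ι-mono {0} {M ℕ.^ k} ℕ.z≤n)
           (*-mono (ℚ.0≤∣p∣ u) (ℚ.<⇒≤ (ℚ.positive⁻¹ 1ℚ)) ∣u∣≤M (recip≤1 (suc k))) (∣term∣≤ k) ⟩
    ι M * 1ℚ * ι (M ℕ.^ k)                ≡⟨ cong (_* ι (M ℕ.^ k)) (ℚ.*-identityʳ (ι M)) ⟩
    ι M * ι (M ℕ.^ k)                     ≡⟨ ι-* M (M ℕ.^ k) ⟨
    ι (M ℕ.^ suc k)                       ∎
    where open ℚ.≤-Reasoning

  halving : ∀ k → 2 ℕ.* M ℕ.≤ k → ι 2 * ∣term∣ u (suc k) ≤ ∣term∣ u k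
  halving k 2M≤k = begin
    ι 2 * ∣term∣ u (suc k)                        ≡⟨ cong (ι 2 *_) (∣term∣-suc u k) ⟩
    ι 2 * (∣ u ∣ * recip (suc k) * ∣term∣ u k)
      ≡⟨ solve 4 (λ t a r x → t :* (a :* r :* x) := (t :* a) :* r :* x) refl (ι 2) ∣ u ∣ (recip (suc k)) (∣term∣ u k) ⟩
    (ι 2 * ∣ u ∣) * recip (suc k) * ∣term∣ u k
      ≤⟨ *-mono (0≤-* (0≤-* (ℚ.<⇒≤ (0<ι 1)) (ℚ.0≤∣p∣ u)) 0≤r) (ℚ.0≤∣p∣ _)
           (*-mono (0≤-* (ℚ.<⇒≤ (0<ι 1)) (ℚ.0≤∣p∣ u)) 0≤r
             (ℚ.≤-trans (*-monoˡ (ℚ.<⇒≤ (0<ι 1)) ∣u∣≤M)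
               (subst (_≤ ι (suc k)) (ι-* 2 M) (ι-mono {2 ℕ.* M} {suc k} (ℕ.m≤n⇒m≤1+n 2M≤k)))) ℚ.≤-refl) ℚ.≤-refl ⟩
    ι (suc k) * recip (suc k) * ∣term∣ u k        ≡⟨ cong (_* ∣term∣ u k) (ι-recip (suc k)) ⟩
    1ℚ * ∣term∣ u k                               ≡⟨ ℚ.*-identityˡ _ ⟩
    ∣term∣ u k                                    ∎
    where
    open ℚ.≤-Reasoning
    0≤r : 0ℚ ≤ recip (suc k)
    0≤r = ℚ.<⇒≤ (recip>0 (suc k))

  tail-bound : ∀ N → 2 ℕ.* M ℕ.≤ N → ∀ e →
               ∣ expSum u (e ℕ.+ N) - expSum u N ∣ ≤ ι 2 * ∣term∣ u N - ι 2 * ∣term∣ u (e ℕ.+ N)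
  tail-bound N 2M≤N zero = ℚ.≤-reflexive (trans (cong ∣_∣ (ℚ.+-inverseʳ (expSum u N))) (sym (ℚ.+-inverseʳ (ι 2 * ∣term∣ u N))))
  tail-bound N 2M≤N (suc e) = begin
    ∣ S + T - S₀ ∣
      ≡⟨ cong ∣_∣ (solve 3 (λ s t z → s :+ t :- z := (s :- z) :+ t) refl S T S₀) ⟩
    ∣ (S - S₀) + T ∣
      ≤⟨ ℚ.∣p+q∣≤∣p∣+∣q∣ (S - S₀) T ⟩
    ∣ S - S₀ ∣ + ∣ T ∣
      ≤⟨ ℚ.+-monoˡ-≤ ∣ T ∣ (tail-bound N 2M≤N e) ⟩
    ι 2 * ∣term∣ u N - ι 2 * ∣ T ∣ + ∣ T ∣
      ≤⟨ linear (halving (e ℕ.+ N) (ℕ.≤-trans 2M≤N (ℕ.m≤n+m N e)))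
           (solve 3 (λ a b c → con (ι 2) :* a :- con (ι 2) :* c :- (con (ι 2) :* a :- con (ι 2) :* b :+ b) := b :- con (ι 2) :* c)
             refl (∣term∣ u N) ∣ T ∣ (∣term∣ u (suc e ℕ.+ N))) ⟩
    ι 2 * ∣term∣ u N - ι 2 * ∣term∣ u (suc e ℕ.+ N) ∎
    where
    open ℚ.≤-Reasoning
    S₀ S T : ℚ
    S₀ = expSum u N
    S = expSum u (e ℕ.+ N)
    T = u ^ (e ℕ.+ N) * 1/! (e ℕ.+ N)

  decay : ∀ d → ι (suc d) * ∣term∣ u (d ℕ.+ 2 ℕ.* M) ≤ ι (M ℕ.^ (2 ℕ.* M))
  decay zero    = subst (_≤ ι (M ℕ.^ (2 ℕ.* M))) (sym (ℚ.*-identityˡ _)) (∣term∣≤ (2 ℕ.* M))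
  decay (suc d) = begin
    ι (2 ℕ.+ d) * a′          ≤⟨ *-mono (ℚ.<⇒≤ (0<ι (suc d))) (ℚ.0≤∣p∣ _)
                                   (ι-mono {2 ℕ.+ d} {2 ℕ.* suc d} (ℕ.s≤s (ℕ.≤-trans (ℕ.m≤m+n (suc d) (d ℕ.+ 0))
                                      (ℕ.≤-reflexive (sym (ℕ.+-suc d (d ℕ.+ 0))))))) ℚ.≤-refl ⟩
    ι (2 ℕ.* suc d) * a′      ≡⟨ cong (_* a′) (ι-* 2 (suc d)) ⟩
    ι 2 * ι (suc d) * a′      ≡⟨ solve 3 (λ t s a → t :* s :* a := s :* (t :* a)) refl (ι 2) (ι (suc d)) a′ ⟩
    ι (suc d) * (ι 2 * a′)    ≤⟨ *-monoˡ (ℚ.<⇒≤ (0<ι d)) (halving (d ℕ.+ 2 ℕ.* M) (ℕ.m≤n+m (2 ℕ.* M) d)) ⟩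
    ι (suc d) * ∣term∣ u (d ℕ.+ 2 ℕ.* M)  ≤⟨ decay d ⟩
    ι (M ℕ.^ (2 ℕ.* M))       ∎
    where
    open ℚ.≤-Reasoning
    a′ = ∣term∣ u (suc d ℕ.+ 2 ℕ.* M)

exp-tail : ∀ M ε → 0ℚ < ε → ∃[ N ] ∀ u → ∣ u ∣ ≤ ι M → ∀ k → N ℕ.≤ k → ∣ expSum u k - expSum u N ∣ ≤ ε
exp-tail M ε 0<ε = N , bound
  where
  open ℚ.≤-Reasoning
  C = ι (M ℕ.^ (2 ℕ.* M))
  d = ℤ.∣ ↥ (ι 2 * C * inv ε) ∣
  N = d ℕ.+ 2 ℕ.* M
  small : ∀ u → ∣ u ∣ ≤ ι M → ι 2 * ∣term∣ u N ≤ ε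
  small u u≤ = ℚ.*-cancelˡ-≤-pos (ι (suc d)) {{positive (0<ι d)}} (begin
    ι (suc d) * (ι 2 * ∣term∣ u N)   ≡⟨ solve 3 (λ s t a → s :* (t :* a) := t :* (s :* a)) refl (ι (suc d)) (ι 2) (∣term∣ u N) ⟩
    ι 2 * (ι (suc d) * ∣term∣ u N)   ≤⟨ *-monoˡ (ℚ.<⇒≤ (0<ι 1)) (decay u M u≤ d) ⟩
    ι 2 * C                          ≡⟨ ℚ.*-identityʳ (ι 2 * C) ⟨
    ι 2 * C * 1ℚ                     ≡⟨ cong (ι 2 * C *_) (*-inv 0<ε) ⟨
    ι 2 * C * (ε * inv ε)            ≡⟨ solve 3 (λ c e i → c :* (e :* i) := e :* (c :* i)) refl (ι 2 * C) ε (inv ε) ⟩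
    ε * (ι 2 * C * inv ε)            ≤⟨ *-monoˡ (ℚ.<⇒≤ 0<ε) (≤ι∣↥∣ (ι 2 * C * inv ε)) ⟩
    ε * ι d                          ≤⟨ *-monoˡ (ℚ.<⇒≤ 0<ε) (ι-mono {d} {suc d} (ℕ.n≤1+n d)) ⟩
    ε * ι (suc d)                    ≡⟨ ℚ.*-comm ε (ι (suc d)) ⟩
    ι (suc d) * ε                    ∎)
  bound : ∀ u → ∣ u ∣ ≤ ι M → ∀ k → N ℕ.≤ k → ∣ expSum u k - expSum u N ∣ ≤ ε
  bound u u≤ k N≤k = begin
    ∣ expSum u k - expSum u N ∣
      ≡⟨ cong (λ j → ∣ expSum u j - expSum u N ∣) (ℕ.m∸n+n≡m N≤k) ⟨
    ∣ expSum u (k ℕ.∸ N ℕ.+ N) - expSum u N ∣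
      ≤⟨ tail-bound u M u≤ N (ℕ.m≤n+m (2 ℕ.* M) d) (k ℕ.∸ N) ⟩
    ι 2 * ∣term∣ u N - ι 2 * ∣term∣ u (k ℕ.∸ N ℕ.+ N)
      ≤⟨ linear (0≤-* (ℚ.<⇒≤ (0<ι 1)) (ℚ.0≤∣p∣ (u ^ (k ℕ.∸ N ℕ.+ N) * 1/! (k ℕ.∸ N ℕ.+ N)))) (solve 2 (λ a b → a :- (a :- b) := b :- con 0ℚ) refl (ι 2 * ∣term∣ u N) (ι 2 * ∣term∣ u (k ℕ.∸ N ℕ.+ N))) ⟩
    ι 2 * ∣term∣ u N
      ≤⟨ small u u≤ ⟩
    ε ∎

expSum-cauchy : ∀ s → IsCauchy s → ∀ k → IsCauchy (λ n → expSum (s n) k)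
expSum-cauchy s cs zero    = constCauchy 0ℚ
expSum-cauchy s cs (suc k) = +-cauchy (λ n → expSum (s n) k) (λ n → s n ^ k * 1/! k) (expSum-cauchy s cs k)
  (*-cauchy (λ n → s n ^ k) (λ _ → 1/! k) (^-cauchy s k cs) (constCauchy (1/! k)))

exp-cauchy : ∀ s → IsCauchy s → IsCauchy (λ n → expSum (s n) n)
exp-cauchy s cs = fromOneSided (λ n → expSum (s n) n) λ ε 0<ε →
  let ε/4        = ε * ½ * ½
      0<ε/4      = 0<half (0<half 0<ε)
      B , N₁ , b = bounded s cs
      N₂ , t     = exp-tail (suc B) ε/4 0<ε/4
      N₃ , c     = toOneSided (λ n → expSum (s n) N₂) (expSum-cauchy s cs N₂) (ε * ½) (0<half 0<ε)
      open ℚ.≤-Reasoning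
  in (N₁ ℕ.⊔ N₂) ℕ.⊔ N₃ , λ m n le le′ →
    let le₁  = ⊔-left (N₁ ℕ.⊔ N₂) N₃ le
        le₁′ = ⊔-left (N₁ ℕ.⊔ N₂) N₃ le′
        tm   = t (s m) (b m (⊔-left N₁ N₂ le₁)) m (⊔-right N₁ N₂ le₁)
        tn   = t (s n) (b n (⊔-left N₁ N₂ le₁′)) n (⊔-right N₁ N₂ le₁′)
        cmn  = c m n (⊔-right (N₁ ℕ.⊔ N₂) N₃ le) (⊔-right (N₁ ℕ.⊔ N₂) N₃ le′)
        A = expSum (s m) m ; A₀ = expSum (s m) N₂ ; C = expSum (s n) n ; C₀ = expSum (s n) N₂
    in linear
         (ℚ.+-mono-≤ (ℚ.+-mono-≤ (ℚ.≤-trans (p≤∣p∣ (A - A₀)) tm) cmn)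
                     (ℚ.≤-trans (subst (- (C - C₀) ≤_) (ℚ.∣-p∣≡∣p∣ (C - C₀)) (p≤∣p∣ (- (C - C₀)))) tn))
         (solve 5 (λ A A₀ C C₀ ε → C :+ ε :- A :=
             ε :* con ½ :* con ½ :+ (C₀ :+ ε :* con ½) :+ ε :* con ½ :* con ½ :- ((A :- A₀) :+ A₀ :+ (:- (C :- C₀))))
           refl A A₀ C C₀ ε)

-- The greatest l ≤ B with P l, and 0 if there is none.
greatest : {P : ℕ → Set} → Decidable P → ℕ → ℕ
greatest P? zero    = zero
greatest P? (suc B) with P? (suc B)
... | yes _ = suc B
... | no  _ = greatest P? B

module _ {P : ℕ → Set} (P? : Decidable P) where

  greatest-sat : ∀ B → greatest P? B ≡ 0 ⊎ P (greatest P? B)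
  greatest-sat zero = inj₁ refl
  greatest-sat (suc B) with P? (suc B)
  ... | yes p = inj₂ p
  ... | no  _ = greatest-sat B

  greatest-max : ∀ B l → l ℕ.≤ B → P l → l ℕ.≤ greatest P? B
  greatest-max zero l l≤0 p = l≤0
  greatest-max (suc B) l l≤1+B p with P? (suc B)
  ... | yes _ = l≤1+B
  ... | no ¬p = case ℕ.m≤n⇒m<n∨m≡n l≤1+B of λ where
    (inj₁ (ℕ.s≤s l≤B)) → greatest-max B l l≤B p
    (inj₂ refl)        → contradiction p ¬p

  greatest-next : ∀ B → (∀ l → P l → l ℕ.≤ B) → ¬ P (suc (greatest P? B))
  greatest-next B b p = ℕ.<-irrefl refl (greatest-max B _ (b _ p) p)

recip-small : ∀ ε → 0ℚ < ε → ∃[ N ] ∀ n → N ℕ.≤ n → recip (suc n) ≤ ε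
recip-small ε 0<ε = N , λ n N≤n → begin
    recip (suc n)                      ≡⟨ ℚ.*-identityʳ _ ⟨
    recip (suc n) * 1ℚ                 ≡⟨ cong (recip (suc n) *_) (*-inv 0<ε) ⟨
    recip (suc n) * (ε * inv ε)
      ≤⟨ *-monoˡ (ℚ.<⇒≤ (recip>0 (suc n))) (*-monoˡ (ℚ.<⇒≤ 0<ε)
           (ℚ.≤-trans (≤ι∣↥∣ (inv ε)) (ι-mono {N} {suc n} (ℕ.m≤n⇒m≤1+n N≤n)))) ⟩
    recip (suc n) * (ε * ι (suc n))    ≡⟨ solve 3 (λ r e i → r :* (e :* i) := e :* (i :* r)) refl (recip (suc n)) ε (ι (suc n)) ⟩
    ε * (ι (suc n) * recip (suc n))    ≡⟨ cong (ε *_) (ι-recip (suc n)) ⟩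
    ε * 1ℚ                             ≡⟨ ℚ.*-identityʳ ε ⟩
    ε                                  ∎
  where
  open ℚ.≤-Reasoning
  N = ℤ.∣ ↥ (inv ε) ∣

ratio : ℕ → ℕ → ℚ
ratio l k = ℤ.+ l / suc k

0≤ratio : ∀ l k → 0ℚ ≤ ratio l k
0≤ratio l k = subst (0ℚ ≤_) (sym (/-ι l (suc k))) (0≤-* (ι-mono {0} {l} ℕ.z≤n) (ℚ.<⇒≤ (recip>0 (suc k))))

ratio-suc : ∀ l k → ratio (suc l) k ≡ ratio l k + recip (suc k)
ratio-suc l k = begin
  ratio (suc l) k                         ≡⟨ /-ι (suc l) (suc k) ⟩
  ι (suc l) * recip (suc k)               ≡⟨ cong (_* recip (suc k)) (ι-+ 1 l) ⟩
  (1ℚ + ι l) * recip (suc k)              ≡⟨ solve 2 (λ l r → (con 1ℚ :+ l) :* r := l :* r :+ r) refl (ι l) (recip (suc k)) ⟩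
  ι l * recip (suc k) + recip (suc k)     ≡⟨ cong (_+ recip (suc k)) (/-ι l (suc k)) ⟨
  ratio l k + recip (suc k)               ∎
  where open ≡-Reasoning

SquareBelow : ℚ → ℕ → ℕ → Set
SquareBelow u k s = ratio s k * ratio s k ≤ u

squareBelow? : ∀ u k → Decidable (SquareBelow u k)
squareBelow? u k s = ratio s k * ratio s k ℚ.≤? u

sqrtBound : ℚ → ℕ → ℕ
sqrtBound u k = suc k ℕ.* suc k ℕ.* ℤ.∣ ↥ u ∣

-- With K = k + 1: the greatest multiple s/K of 1/K satisfying (s/K)² ≤ u, and 0
-- for u < 0. The search bound K²∣↥u∣ is never exceeded (sqrtBound-ok).
sqrtApprox : ℚ → ℕ → ℚ
sqrtApprox u k = ratio (greatest (squareBelow? u k) (sqrtBound u k)) k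

scale-square : ∀ {L x K N} → L ≡ K * x → 0ℚ ≤ K → x * x ≤ N → L * L ≤ K * K * N
scale-square {L} {x} {K} {N} refl 0≤K sq = subst (_≤ K * K * N)
  (solve 2 (λ K x → K :* K :* (x :* x) := (K :* x) :* (K :* x)) refl K x) (*-monoˡ (0≤-* 0≤K 0≤K) sq)

ι-ratio : ∀ l k → ι l ≡ ι (suc k) * ratio l k
ι-ratio l k = sym (trans (cong (ι (suc k) *_) (/-ι l (suc k))) (trans (shuffle (ι (suc k)) (ι l) (recip (suc k)))
    (trans (cong (ι l *_) (ι-recip (suc k))) (ℚ.*-identityʳ (ι l)))))
  where
  shuffle : ∀ K l r → K * (l * r) ≡ l * (K * r)
  shuffle = solve 3 (λ K l r → K :* (l :* r) := l :* (K :* r)) refl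

sqrtBound-ok : ∀ u k l → SquareBelow u k l → l ℕ.≤ sqrtBound u k
sqrtBound-ok u k l sq = ℕ.≤-trans (l≤l*l l) (ι-cancel {l ℕ.* l} {suc k ℕ.* suc k ℕ.* N}
    (subst₂ _≤_ (sym (ι-* l l)) (sym (trans (ι-* (suc k ℕ.* suc k) N) (cong (_* ι N) (ι-* (suc k) (suc k)))))
      (scale-square (ι-ratio l k) (ℚ.<⇒≤ (0<ι k)) (ℚ.≤-trans sq (≤ι∣↥∣ u)))))
  where
  N = ℤ.∣ ↥ u ∣
  l≤l*l : ∀ l → l ℕ.≤ l ℕ.* l
  l≤l*l zero    = ℕ.z≤n
  l≤l*l (suc l) = ℕ.m≤m+n (suc l) (l ℕ.* suc l)

ratio-0 : ∀ {l} k → l ≡ 0 → ratio l k ≡ 0ℚ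
ratio-0 k refl = ℚ.0/n≡0 (suc k)

sqrtApprox-lower : ∀ u k → sqrtApprox u k ≡ 0ℚ ⊎ sqrtApprox u k * sqrtApprox u k ≤ u
sqrtApprox-lower u k = Sum.map₁ (ratio-0 k) (greatest-sat (squareBelow? u k) (sqrtBound u k))

sqrtApprox-upper : ∀ u k → u < (sqrtApprox u k + recip (suc k)) * (sqrtApprox u k + recip (suc k))
sqrtApprox-upper u k = ℚ.≰⇒> λ le → greatest-next (squareBelow? u k) (sqrtBound u k) (sqrtBound-ok u k)
  (subst (λ x → x * x ≤ u) (sym (ratio-suc (greatest (squareBelow? u k) (sqrtBound u k)) k)) le)

sqrt-compare : ∀ {u v a b r η} → 0ℚ ≤ η → 0ℚ ≤ b + r → a ≡ 0ℚ ⊎ a * a ≤ u → u ≤ v + η * η →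
               v < (b + r) * (b + r) → a ≤ b + r + η
sqrt-compare {u} {v} {a} {b} {r} {η} 0≤η 0≤b+r lower u≤ upper = step lower (a ℚ.≤? b + r + η)
  where
  open ℚ.≤-Reasoning
  0≤sum : 0ℚ ≤ b + r + η
  0≤sum = ℚ.+-mono-≤ 0≤b+r 0≤η
  step : a ≡ 0ℚ ⊎ a * a ≤ u → Dec (a ≤ b + r + η) → a ≤ b + r + η
  step _         (yes p) = p
  step (inj₁ eq) (no ¬p) = contradiction (subst (_≤ b + r + η) (sym eq) 0≤sum) ¬p
  step (inj₂ sq) (no ¬p) = contradiction (begin-strict
    a * a                                ≤⟨ sq ⟩
    u                                    ≤⟨ u≤ ⟩
    v + η * η                            <⟨ ℚ.+-monoˡ-< (η * η) upper ⟩
    (b + r) * (b + r) + η * η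
      ≤⟨ linear (ℚ.+-mono-≤ (0≤-* 0≤η 0≤b+r) (0≤-* 0≤η 0≤b+r))
           (solve 2 (λ c e → (c :+ e) :* (c :+ e) :- (c :* c :+ e :* e) := (e :* c :+ e :* c) :- (con 0ℚ :+ con 0ℚ)) refl (b + r) η) ⟩
    (b + r + η) * (b + r + η)            ≤⟨ *-mono 0≤sum (ℚ.≤-trans 0≤sum (ℚ.<⇒≤ (ℚ.≰⇒> ¬p))) (ℚ.<⇒≤ (ℚ.≰⇒> ¬p)) (ℚ.<⇒≤ (ℚ.≰⇒> ¬p)) ⟩
    a * a                                ∎) (ℚ.<-irrefl refl)

sqrt-close : ∀ u v a b r ε → 0ℚ < ε → 0ℚ ≤ b → 0ℚ ≤ r → a ≡ 0ℚ ⊎ a * a ≤ u → u ≤ v + ε * ½ * (ε * ½) →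
             v < (b + r) * (b + r) → r ≤ ε * ½ → a ≤ b + ε
sqrt-close u v a b r ε 0<ε 0≤b 0≤r lower u≤ upper r≤ = ℚ.≤-trans
  (sqrt-compare {u} {v} {a} {b} {r} (ℚ.<⇒≤ (0<half 0<ε)) (ℚ.+-mono-≤ 0≤b 0≤r) lower u≤ upper)
  (linear r≤ (solve 3 (λ b r e → b :+ e :- (b :+ r :+ e :* con ½) := e :* con ½ :- r) refl b r ε))

sqrt-cauchy : ∀ s → IsCauchy s → IsCauchy (λ n → sqrtApprox (s n) n)
sqrt-cauchy s cs = fromOneSided (λ n → sqrtApprox (s n) n) λ ε 0<ε →
  let η = ε * ½
      0<η = 0<half 0<ε
      N₁ , h = toOneSided s cs (η * η) (0<-* 0<η 0<η)
      N₂ , r = recip-small η 0<η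
  in N₁ ℕ.⊔ N₂ , λ m n le le′ →
     sqrt-close (s m) (s n) (sqrtApprox (s m) m) (sqrtApprox (s n) n) (recip (suc n)) ε 0<ε
       (0≤ratio (greatest (squareBelow? (s n) n) (sqrtBound (s n) n)) n) (ℚ.<⇒≤ (recip>0 (suc n)))
       (sqrtApprox-lower (s m) m) (h m n (⊔-left N₁ N₂ le) (⊔-left N₁ N₂ le′)) (sqrtApprox-upper (s n) n) (r n (⊔-right N₁ N₂ le′))

ℕ-^-distrib-* : ∀ x y k → (x ℕ.* y) ℕ.^ k ≡ x ℕ.^ k ℕ.* y ℕ.^ k
ℕ-^-distrib-* x y zero    = refl
ℕ-^-distrib-* x y (suc k) = trans (cong (x ℕ.* y ℕ.*_) (ℕ-^-distrib-* x y k))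
  (ℕS.solve 4 (λ x y a b → x ℕS.:* y ℕS.:* (a ℕS.:* b) ℕS.:= x ℕS.:* a ℕS.:* (y ℕS.:* b)) refl x y (x ℕ.^ k) (y ℕ.^ k))

ℚ-^-distrib-* : ∀ x y k → (x * y) ^ k ≡ x ^ k * y ^ k
ℚ-^-distrib-* x y zero    = refl
ℚ-^-distrib-* x y (suc k) = trans (cong (x * y *_) (ℚ-^-distrib-* x y k))
  (solve 4 (λ x y a b → x :* y :* (a :* b) := x :* a :* (y :* b)) refl x y (x ^ k) (y ^ k))

⌊log⌋ : ℕ → ℕ → ℕ
⌊log⌋ b m = greatest (λ l → b ℕ.^ l ℕ.≤? m) m

-- For u = p/q > 0 in lowest terms, log_b u = log_b p - log_b q, and with K = k + 1,
-- log_b m is within 1/K of ⌊log_b mᴷ⌋/K.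
logApprox : ℕ → ℚ → ℕ → ℚ
logApprox b u k = ratio (⌊log⌋ b (ℤ.∣ ↥ u ∣ ℕ.^ suc k)) k - ratio (⌊log⌋ b (↧ₙ u ℕ.^ suc k)) k

module _ {b : ℕ} (1<b : 1 ℕ.< b) where

  private instance
    b≢0 : ℕ.NonZero b
    b≢0 = ℕ.>-nonZero (ℕ.<-trans (ℕ.s≤s ℕ.z≤n) 1<b)

  n<b^n : ∀ n → n ℕ.< b ℕ.^ n
  n<b^n zero    = ℕ.s≤s ℕ.z≤n
  n<b^n (suc n) = ℕ.≤-<-trans (n<b^n n) (ℕ.^-monoʳ-< b 1<b (ℕ.n<1+n n))

  ^-cancel-≤ : ∀ {x y} → b ℕ.^ x ℕ.≤ b ℕ.^ y → x ℕ.≤ y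
  ^-cancel-≤ le = ℕ.≮⇒≥ λ y<x → ℕ.<⇒≱ (ℕ.^-monoʳ-< b 1<b y<x) le

  ⌊log⌋-lower : ∀ m → 1 ℕ.≤ m → b ℕ.^ ⌊log⌋ b m ℕ.≤ m
  ⌊log⌋-lower m 1≤m = case greatest-sat (λ l → b ℕ.^ l ℕ.≤? m) m of λ where
    (inj₁ eq) → subst (λ l → b ℕ.^ l ℕ.≤ m) (sym eq) 1≤m
    (inj₂ le) → le

  ⌊log⌋-upper : ∀ m → m ℕ.≤ b ℕ.^ suc (⌊log⌋ b m)
  ⌊log⌋-upper m = ℕ.<⇒≤ (ℕ.≰⇒> (greatest-next (λ l → b ℕ.^ l ℕ.≤? m) m
    (λ l le → ℕ.<⇒≤ (ℕ.<-≤-trans (n<b^n l) le))))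

  exponents : ∀ p q p′ q′ K J M a d a′ d′ →
    b ℕ.^ a ℕ.≤ p ℕ.^ K → q ℕ.^ K ℕ.≤ b ℕ.^ suc d →
    p′ ℕ.^ J ℕ.≤ b ℕ.^ suc a′ → b ℕ.^ d′ ℕ.≤ q′ ℕ.^ J →
    (p ℕ.* q′) ℕ.^ M ℕ.≤ b ℕ.* (p′ ℕ.* q) ℕ.^ M →
    (a ℕ.* J ℕ.+ d′ ℕ.* K) ℕ.* M ℕ.≤ K ℕ.* J ℕ.+ (suc a′ ℕ.* K ℕ.+ suc d ℕ.* J) ℕ.* M
  exponents p q p′ q′ K J M a d a′ d′ ha hd ha′ hd′ hM = ^-cancel-≤ (begin
    b ^ₙ ((a ℕ.* J ℕ.+ d′ ℕ.* K) ℕ.* M)            ≡⟨ split a J d′ K ⟩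
    ((b ^ₙ a) ^ₙ J ℕ.* (b ^ₙ d′) ^ₙ K) ^ₙ M
      ≤⟨ ℕ.^-monoˡ-≤ M (ℕ.*-mono-≤ (ℕ.^-monoˡ-≤ J ha) (ℕ.^-monoˡ-≤ K hd′)) ⟩
    ((p ^ₙ K) ^ₙ J ℕ.* (q′ ^ₙ J) ^ₙ K) ^ₙ M
      ≡⟨ cong (_^ₙ M) (cong₂ ℕ._*_ (ℕ.^-*-assoc p K J) (trans (ℕ.^-*-assoc q′ J K) (cong (q′ ^ₙ_) (ℕ.*-comm J K)))) ⟩
    (p ^ₙ (K ℕ.* J) ℕ.* q′ ^ₙ (K ℕ.* J)) ^ₙ M        ≡⟨ cong (_^ₙ M) (ℕ-^-distrib-* p q′ (K ℕ.* J)) ⟨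
    ((p ℕ.* q′) ^ₙ (K ℕ.* J)) ^ₙ M                   ≡⟨ flip (p ℕ.* q′) (K ℕ.* J) M ⟩
    ((p ℕ.* q′) ^ₙ M) ^ₙ (K ℕ.* J)                   ≤⟨ ℕ.^-monoˡ-≤ (K ℕ.* J) hM ⟩
    (b ℕ.* (p′ ℕ.* q) ^ₙ M) ^ₙ (K ℕ.* J)             ≡⟨ ℕ-^-distrib-* b ((p′ ℕ.* q) ^ₙ M) (K ℕ.* J) ⟩
    b ^ₙ (K ℕ.* J) ℕ.* ((p′ ℕ.* q) ^ₙ M) ^ₙ (K ℕ.* J)
      ≡⟨ cong (b ^ₙ (K ℕ.* J) ℕ.*_) (flip (p′ ℕ.* q) M (K ℕ.* J)) ⟩
    b ^ₙ (K ℕ.* J) ℕ.* ((p′ ℕ.* q) ^ₙ (K ℕ.* J)) ^ₙ M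
      ≡⟨ cong (λ x → b ^ₙ (K ℕ.* J) ℕ.* x ^ₙ M) (ℕ-^-distrib-* p′ q (K ℕ.* J)) ⟩
    b ^ₙ (K ℕ.* J) ℕ.* (p′ ^ₙ (K ℕ.* J) ℕ.* q ^ₙ (K ℕ.* J)) ^ₙ M
      ≡⟨ cong (λ x → b ^ₙ (K ℕ.* J) ℕ.* x ^ₙ M) (cong₂ ℕ._*_ (trans (ℕ.^-*-assoc p′ J K) (cong (p′ ^ₙ_) (ℕ.*-comm J K))) (ℕ.^-*-assoc q K J)) ⟨
    b ^ₙ (K ℕ.* J) ℕ.* ((p′ ^ₙ J) ^ₙ K ℕ.* (q ^ₙ K) ^ₙ J) ^ₙ M
      ≤⟨ ℕ.*-monoʳ-≤ (b ^ₙ (K ℕ.* J)) (ℕ.^-monoˡ-≤ M (ℕ.*-mono-≤ (ℕ.^-monoˡ-≤ K ha′) (ℕ.^-monoˡ-≤ J hd))) ⟩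
    b ^ₙ (K ℕ.* J) ℕ.* ((b ^ₙ suc a′) ^ₙ K ℕ.* (b ^ₙ suc d) ^ₙ J) ^ₙ M
      ≡⟨ cong (b ^ₙ (K ℕ.* J) ℕ.*_) (split (suc a′) K (suc d) J) ⟨
    b ^ₙ (K ℕ.* J) ℕ.* b ^ₙ ((suc a′ ℕ.* K ℕ.+ suc d ℕ.* J) ℕ.* M)
      ≡⟨ ℕ.^-distribˡ-+-* b (K ℕ.* J) ((suc a′ ℕ.* K ℕ.+ suc d ℕ.* J) ℕ.* M) ⟨
    b ^ₙ (K ℕ.* J ℕ.+ (suc a′ ℕ.* K ℕ.+ suc d ℕ.* J) ℕ.* M)  ∎)
    where
    open ℕ.≤-Reasoning
    infixr 8 _^ₙ_
    _^ₙ_ = ℕ._^_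
    split : ∀ x J y K → b ^ₙ ((x ℕ.* J ℕ.+ y ℕ.* K) ℕ.* M) ≡ ((b ^ₙ x) ^ₙ J ℕ.* (b ^ₙ y) ^ₙ K) ^ₙ M
    split x J y K = sym (trans (cong (_^ₙ M) (trans (cong₂ ℕ._*_ (ℕ.^-*-assoc b x J) (ℕ.^-*-assoc b y K))
      (sym (ℕ.^-distribˡ-+-* b (x ℕ.* J) (y ℕ.* K))))) (ℕ.^-*-assoc b (x ℕ.* J ℕ.+ y ℕ.* K) M))
    flip : ∀ x m n → (x ^ₙ m) ^ₙ n ≡ (x ^ₙ n) ^ₙ m
    flip x m n = trans (ℕ.^-*-assoc x m n) (trans (cong (x ^ₙ_) (ℕ.*-comm m n)) (sym (ℕ.^-*-assoc x n m)))

divide : ∀ {A D A′ D′ K J M k j m : ℚ} → 0ℚ ≤ k → 0ℚ ≤ j → 0ℚ ≤ m → K * k ≡ 1ℚ → J * j ≡ 1ℚ → M * m ≡ 1ℚ →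
  (A * J + D′ * K) * M ≤ K * J + ((1ℚ + A′) * K + (1ℚ + D) * J) * M →
  A * k - D * k ≤ A′ * j - D′ * j + (m + j + k)
divide {A} {D} {A′} {D′} {K} {J} {M} {k} {j} {m} 0≤k 0≤j 0≤m Kk Jj Mm h = linear scaled
    (solve 7 (λ A D A′ D′ k j m → A′ :* j :- D′ :* j :+ (m :+ j :+ k) :- (A :* k :- D :* k) :=
      (con 1ℚ :* con 1ℚ :* m :+ ((con 1ℚ :+ A′) :* con 1ℚ :* con 1ℚ :* j :+ (con 1ℚ :+ D) :* con 1ℚ :* con 1ℚ :* k)) :-
      (A :* con 1ℚ :* con 1ℚ :* k :+ D′ :* con 1ℚ :* con 1ℚ :* j)) refl A D A′ D′ k j m)
  where
  lhs rhs : ℚ → ℚ → ℚ → ℚ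
  lhs x y z = A * y * z * k + D′ * x * z * j
  rhs x y z = x * y * m + ((1ℚ + A′) * x * z * j + (1ℚ + D) * y * z * k)
  to1 : (f : ℚ → ℚ → ℚ → ℚ) → f (K * k) (J * j) (M * m) ≡ f 1ℚ 1ℚ 1ℚ
  to1 f = trans (cong (λ x → f x (J * j) (M * m)) Kk) (trans (cong (λ y → f 1ℚ y (M * m)) Jj) (cong (f 1ℚ 1ℚ) Mm))
  scaled : lhs 1ℚ 1ℚ 1ℚ ≤ rhs 1ℚ 1ℚ 1ℚ
  scaled = subst₂ _≤_
    (trans (solve 8 (λ A D′ K J M k j m → k :* j :* m :* ((A :* J :+ D′ :* K) :* M) :=
        A :* (J :* j) :* (M :* m) :* k :+ D′ :* (K :* k) :* (M :* m) :* j) refl A D′ K J M k j m) (to1 lhs))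
    (trans (solve 8 (λ A′ D K J M k j m → k :* j :* m :* (K :* J :+ ((con 1ℚ :+ A′) :* K :+ (con 1ℚ :+ D) :* J) :* M) :=
        (K :* k) :* (J :* j) :* m :+ ((con 1ℚ :+ A′) :* (K :* k) :* (M :* m) :* j :+ (con 1ℚ :+ D) :* (J :* j) :* (M :* m) :* k)) refl A′ D K J M k j m) (to1 rhs))
    (*-monoˡ (0≤-* (0≤-* 0≤k 0≤j) 0≤m) h)

ι-exponents : ∀ a J d′ K M a′ d →
  (a ℕ.* J ℕ.+ d′ ℕ.* K) ℕ.* M ℕ.≤ K ℕ.* J ℕ.+ (suc a′ ℕ.* K ℕ.+ suc d ℕ.* J) ℕ.* M →
  (ι a * ι J + ι d′ * ι K) * ι M ≤ ι K * ι J + ((1ℚ + ι a′) * ι K + (1ℚ + ι d) * ι J) * ι M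
ι-exponents a J d′ K M a′ d h = subst₂ _≤_
  (trans (ι-* (a ℕ.* J ℕ.+ d′ ℕ.* K) M) (cong (_* ι M) (trans (ι-+ (a ℕ.* J) (d′ ℕ.* K)) (cong₂ _+_ (ι-* a J) (ι-* d′ K)))))
  (trans (ι-+ (K ℕ.* J) ((suc a′ ℕ.* K ℕ.+ suc d ℕ.* J) ℕ.* M)) (cong₂ _+_ (ι-* K J)
    (trans (ι-* (suc a′ ℕ.* K ℕ.+ suc d ℕ.* J) M) (cong (_* ι M) (trans (ι-+ (suc a′ ℕ.* K) (suc d ℕ.* J))
      (cong₂ _+_ (trans (ι-* (suc a′) K) (cong (_* ι K) (ι-+ 1 a′))) (trans (ι-* (suc d) J) (cong (_* ι J) (ι-+ 1 d)))))))))
  (ι-mono {(a ℕ.* J ℕ.+ d′ ℕ.* K) ℕ.* M} {K ℕ.* J ℕ.+ (suc a′ ℕ.* K ℕ.+ suc d ℕ.* J) ℕ.* M} h)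

pos-↥ : ∀ u → 0ℚ < u → ι ℤ.∣ ↥ u ∣ ≡ u * ι (↧ₙ u)
pos-↥ u@(mkℚ (ℤ.+ p) d _) 0<u = sym (begin
  u * ι (suc d)                       ≡⟨ cong (_* ι (suc d)) (ℚ.↥p/↧p≡p u) ⟨
  (ℤ.+ p / suc d) * ι (suc d)         ≡⟨ cong (_* ι (suc d)) (/-ι p (suc d)) ⟩
  ι p * recip (suc d) * ι (suc d)     ≡⟨ rearr (ι p) (recip (suc d)) (ι (suc d)) ⟩
  ι p * (ι (suc d) * recip (suc d))   ≡⟨ cong (ι p *_) (ι-recip (suc d)) ⟩
  ι p * 1ℚ                            ≡⟨ ℚ.*-identityʳ (ι p) ⟩
  ι p                                 ∎)
  where
  open ≡-Reasoning
  rearr : ∀ p r s → p * r * s ≡ p * (s * r)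
  rearr = solve 3 (λ p r s → p :* r :* s := p :* (s :* r)) refl
pos-↥ (mkℚ (ℤ.-[1+ _ ]) _ _) (*<* ())

pos-∣↥∣ : ∀ u → 0ℚ < u → 1 ℕ.≤ ℤ.∣ ↥ u ∣
pos-∣↥∣ (mkℚ (ℤ.+ suc p) _ _)    _        = ℕ.s≤s ℕ.z≤n
pos-∣↥∣ (mkℚ (ℤ.+ zero) _ _)     (*<* (ℤ.+<+ ()))
pos-∣↥∣ (mkℚ (ℤ.-[1+ _ ]) _ _)   (*<* ())

ratio-bound : ∀ {b} u v M → 0ℚ < u → 0ℚ < v → u ^ M ≤ ι b * v ^ M →
  (ℤ.∣ ↥ u ∣ ℕ.* ↧ₙ v) ℕ.^ M ℕ.≤ b ℕ.* (ℤ.∣ ↥ v ∣ ℕ.* ↧ₙ u) ℕ.^ M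
ratio-bound {b} u v M 0<u 0<v h = ι-cancel {(p ℕ.* q′) ℕ.^ M} {b ℕ.* (p′ ℕ.* q) ℕ.^ M} (subst₂ _≤_
    (trans (general u q q′ (u * ι q) refl) (trans (cong (λ x → (x * ι q′) ^ M) (sym (pos-↥ u 0<u))) (sym (cast p q′))))
    (trans (commute (ι b) (v ^ M) ((ι q * ι q′) ^ M)) (trans (cong (ι b *_)
       (trans (cong (λ x → v ^ M * x ^ M) (ℚ.*-comm (ι q) (ι q′)))
       (trans (general v q′ q (v * ι q′) refl) (trans (cong (λ x → (x * ι q) ^ M) (sym (pos-↥ v 0<v))) (sym (cast p′ q))))))
       (sym (ι-* b ((p′ ℕ.* q) ℕ.^ M)))))
    (ℚ.*-monoʳ-≤-nonNeg ((ι q * ι q′) ^ M) {{nonNegative (0≤^ M (0≤-* (ι-mono {0} {q} ℕ.z≤n) (ι-mono {0} {q′} ℕ.z≤n)))}} h))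
  where
  p = ℤ.∣ ↥ u ∣
  q = ↧ₙ u
  p′ = ℤ.∣ ↥ v ∣
  q′ = ↧ₙ v
  commute : ∀ b x y → b * x * y ≡ b * (x * y)
  commute = ℚ.*-assoc
  0≤^ : ∀ {x} k → 0ℚ ≤ x → 0ℚ ≤ x ^ k
  0≤^ zero    0≤x = ℚ.<⇒≤ (ℚ.positive⁻¹ 1ℚ)
  0≤^ (suc k) 0≤x = 0≤-* 0≤x (0≤^ k 0≤x)
  cast : ∀ x y → ι ((x ℕ.* y) ℕ.^ M) ≡ (ι x * ι y) ^ M
  cast x y = trans (ι-^ (x ℕ.* y) M) (cong (_^ M) (ι-* x y))
  general : ∀ w q q′ y → w * ι q ≡ y → w ^ M * (ι q * ι q′) ^ M ≡ (y * ι q′) ^ M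
  general w q q′ y refl = trans (sym (ℚ-^-distrib-* w (ι q * ι q′) M)) (cong (_^ M) (sym (ℚ.*-assoc w (ι q) (ι q′))))

log-compare : ∀ {b} → 1 ℕ.< b → ∀ u v M k j → 0ℚ < u → 0ℚ < v → u ^ suc M ≤ ι b * v ^ suc M →
  logApprox b u k ≤ logApprox b v j + (recip (suc M) + recip (suc j) + recip (suc k))
log-compare {b} 1<b u v M k j 0<u 0<v h = subst₂ _≤_
    (cong₂ _-_ (sym (/-ι a (suc k))) (sym (/-ι d (suc k))))
    (cong (_+ (recip (suc M) + recip (suc j) + recip (suc k))) (cong₂ _-_ (sym (/-ι a′ (suc j))) (sym (/-ι d′ (suc j)))))
    (divide {ι a} {ι d} {ι a′} {ι d′} {ι (suc k)} {ι (suc j)} {ι (suc M)}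
      (ℚ.<⇒≤ (recip>0 (suc k))) (ℚ.<⇒≤ (recip>0 (suc j))) (ℚ.<⇒≤ (recip>0 (suc M)))
      (ι-recip (suc k)) (ι-recip (suc j)) (ι-recip (suc M))
      (ι-exponents a (suc j) d′ (suc k) (suc M) a′ d
        (exponents 1<b p q p′ q′ (suc k) (suc j) (suc M) a d a′ d′
          (⌊log⌋-lower 1<b (p ℕ.^ suc k) (1≤^ p k (pos-∣↥∣ u 0<u))) (⌊log⌋-upper 1<b (q ℕ.^ suc k))
          (⌊log⌋-upper 1<b (p′ ℕ.^ suc j)) (⌊log⌋-lower 1<b (q′ ℕ.^ suc j) (1≤^ q′ j (ℕ.s≤s ℕ.z≤n)))
          (ratio-bound {b} u v (suc M) 0<u 0<v h))))
  where
  p = ℤ.∣ ↥ u ∣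
  q = ↧ₙ u
  p′ = ℤ.∣ ↥ v ∣
  q′ = ↧ₙ v
  a = ⌊log⌋ b (p ℕ.^ suc k)
  d = ⌊log⌋ b (q ℕ.^ suc k)
  a′ = ⌊log⌋ b (p′ ℕ.^ suc j)
  d′ = ⌊log⌋ b (q′ ℕ.^ suc j)
  1≤^ : ∀ p k → 1 ℕ.≤ p → 1 ℕ.≤ p ℕ.^ suc k
  1≤^ p k 1≤p = ℕ.m^n>0 p {{ℕ.>-nonZero 1≤p}} (suc k)

^-mono : ∀ {x y} k → 0ℚ ≤ x → x ≤ y → (0ℚ ≤ x ^ k) × (x ^ k ≤ y ^ k)
^-mono zero    0≤x x≤y = ℚ.<⇒≤ (ℚ.positive⁻¹ 1ℚ) , ℚ.≤-refl
^-mono (suc k) 0≤x x≤y = let 0≤ , le = ^-mono k 0≤x x≤y in 0≤-* 0≤x 0≤ , *-mono 0≤x (ℚ.≤-trans 0≤ le) x≤y le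

0<^ : ∀ {x} k → 0ℚ < x → 0ℚ < x ^ k
0<^ zero    0<x = ℚ.positive⁻¹ 1ℚ
0<^ (suc k) 0<x = 0<-* 0<x (0<^ k 0<x)

log-cauchy : ∀ {b} → 1 ℕ.< b → ∀ s → EventuallyPositive s → IsCauchy s → IsCauchy (λ n → logApprox b (s n) n)
log-cauchy {b} 1<b s (δ , 0<δ , N₁ , hδ) cs = fromOneSided (λ n → logApprox b (s n) n) λ ε 0<ε →
  let M , hM = recip-small (ε * ½ * ½) (0<half (0<half 0<ε))
      N₂ , h = toOneSided (λ n → s n ^ suc M) (^-cauchy s (suc M) cs) (δ ^ suc M) (0<^ (suc M) 0<δ)
      open ℚ.≤-Reasoning
  in N₁ ℕ.⊔ N₂ ℕ.⊔ M , λ m n le le′ →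
     let le₁ = ⊔-left (N₁ ℕ.⊔ N₂) M le
         le₁′ = ⊔-left (N₁ ℕ.⊔ N₂) M le′
         δ≤m = subst (_≤ s m) (ℚ.+-identityˡ δ) (hδ m (⊔-left N₁ N₂ le₁))
         δ≤n = subst (_≤ s n) (ℚ.+-identityˡ δ) (hδ n (⊔-left N₁ N₂ le₁′))
         v = s n ^ suc M
     in close ε (logApprox b (s n) n)
          (log-compare 1<b (s m) (s n) M m n (ℚ.<-≤-trans 0<δ δ≤m) (ℚ.<-≤-trans 0<δ δ≤n) (begin
            s m ^ suc M               ≤⟨ h m n (⊔-right N₁ N₂ le₁) (⊔-right N₁ N₂ le₁′) ⟩
            v + δ ^ suc M             ≤⟨ ℚ.+-monoʳ-≤ v (proj₂ (^-mono (suc M) (ℚ.<⇒≤ 0<δ) δ≤n)) ⟩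
            v + v                     ≡⟨ solve 1 (λ v → v :+ v := con (ι 2) :* v) refl v ⟩
            ι 2 * v                   ≤⟨ ℚ.*-monoʳ-≤-nonNeg v {{nonNegative (ℚ.<⇒≤ (0<^ (suc M) (ℚ.<-≤-trans 0<δ δ≤n)))}} (ι-mono {2} {b} 1<b) ⟩
            ι b * v                   ∎))
          (hM M ℕ.≤-refl) (hM n (⊔-right (N₁ ℕ.⊔ N₂) M le′)) (hM m (⊔-right (N₁ ℕ.⊔ N₂) M le)) (ℚ.<⇒≤ (0<half (0<half 0<ε)))
  where
  close : ∀ ε y {x r₁ r₂ r₃} → x ≤ y + (r₁ + r₂ + r₃) → r₁ ≤ ε * ½ * ½ → r₂ ≤ ε * ½ * ½ → r₃ ≤ ε * ½ * ½ → 0ℚ ≤ ε * ½ * ½ → x ≤ y + ε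
  close ε y {x} {r₁} {r₂} {r₃} h h₁ h₂ h₃ h₄ = ℚ.≤-trans h (linear (ℚ.+-mono-≤ (ℚ.+-mono-≤ (ℚ.+-mono-≤ h₁ h₂) h₃) h₄)
    (solve 5 (λ y e a b c → y :+ e :- (y :+ (a :+ b :+ c)) := e :* con ½ :* con ½ :+ e :* con ½ :* con ½ :+ e :* con ½ :* con ½ :+ e :* con ½ :* con ½ :- (a :+ b :+ c :+ con 0ℚ))
      refl y ε r₁ r₂ r₃))

-- A real number is given by a Cauchy sequence of rationals. Equality of reals would
-- be x ≤ʳ y × y ≤ʳ x; propositional equality of sequences plays no role.
record ℝ : Set where
  constructor mkℝ
  field
    seq    : ℕ → ℚ
    cauchy : IsCauchy seq

open ℝ public

infix  4 _≤ʳ_ _<ʳ_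
infixl 6 _-ʳ_
infixl 7 _*ʳ_

_≤ʳ_ : ℝ → ℝ → Set
x ≤ʳ y = ∀ ε → 0ℚ < ε → ∃[ N ] ∀ n → N ℕ.≤ n → seq x n ≤ seq y n + ε

_<ʳ_ : ℝ → ℝ → Set
x <ʳ y = ∃[ δ ] 0ℚ < δ × ∃[ N ] ∀ n → N ℕ.≤ n → seq x n + δ ≤ seq y n

fromℚ : ℚ → ℝ
fromℚ p = mkℝ (λ _ → p) (constCauchy p)

fromℤ : ℤ → ℝ
fromℤ i = fromℚ (i / 1)

fromℕ : ℕ → ℝ
fromℕ n = fromℚ (ι n)

_-ʳ_ : ℝ → ℝ → ℝ
x -ʳ y = mkℝ (λ n → seq x n - seq y n)
  (+-cauchy (seq x) (λ n → - seq y n) (cauchy x) (neg-cauchy (seq y) (cauchy y)))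

_*ʳ_ : ℝ → ℝ → ℝ
x *ʳ y = mkℝ (λ n → seq x n * seq y n) (*-cauchy (seq x) (seq y) (cauchy x) (cauchy y))

Positiveʳ : ℝ → Set
Positiveʳ x = fromℚ 0ℚ <ʳ x

fromℕ-pos : ∀ n → .{{_ : ℕ.NonTrivial n}} → Positiveʳ (fromℕ n)
fromℕ-pos n@(suc n-1) = 1ℚ , ℚ.positive⁻¹ 1ℚ , 0 , λ _ _ → ι-mono {1} {n} (ℕ.s≤s ℕ.z≤n)

*ʳ-pos : ∀ x y → Positiveʳ x → Positiveʳ y → Positiveʳ (x *ʳ y)
*ʳ-pos x y = *-positive (seq x) (seq y)

recipʳ : (x : ℝ) → Positiveʳ x → ℝ
recipʳ x 0<x = mkℝ (λ n → inv (seq x n)) (inv-cauchy (seq x) 0<x (cauchy x))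

exp : ℝ → ℝ
exp x = mkℝ (λ n → expSum (seq x n) n) (exp-cauchy (seq x) (cauchy x))

-- The square root of max(x, 0).
sqrt : ℝ → ℝ
sqrt x = mkℝ (λ n → sqrtApprox (seq x n) n) (sqrt-cauchy (seq x) (cauchy x))

log : (b : ℕ) → .{{_ : ℕ.NonTrivial b}} → (x : ℝ) → Positiveʳ x → ℝ
log b x 0<x = mkℝ (λ n → logApprox b (seq x n) n)
  (log-cauchy (ℕ.nonTrivial⇒n>1 b) (seq x) 0<x (cauchy x))

-- k = ⌈x⌉, as a relation because the ceiling of a real is not computable.
IsCeiling : ℝ → ℤ → Set
IsCeiling x k = (fromℤ k -ʳ fromℚ 1ℚ <ʳ x) × (x ≤ʳ fromℤ k)

words : {A : Set} → List A → (k : ℕ) → List (Vec A k)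
words xs zero    = [] ∷ []
words xs (suc k) = cartesianProductWith _∷_ xs (words xs k)

module _ (b : ℕ) .{{_ : ℕ.NonZero b}} where

  carry : ∀ {n} → ℕ → Vec (Fin b) n → ℕ
  carry κ X = (κ ℕ.+ Vec.sum (Vec.map toℕ X)) ℕ./ b

  -- κ_r as a function of the digits X_{t,k}, row t being used at step t. The values
  -- lie in {0,…,n-1} since n - 1 + n(b - 1) < nb.
  carries : ∀ {n r} → Vec (Vec (Fin b) n) r → ℕ
  carries = Vec.foldl′ carry 0

-- The probability that κ_r = j when the nr digits are independent and uniform, that is,
-- when all bⁿʳ digit arrays are equally likely.
carriesLaw : (n b r : ℕ) → .{{_ : ℕ.NonTrivial b}} → Fin n → ℚ
carriesLaw n b r j =
  (ℤ.+ length (filter (λ X → carries b X ℕ.≟ toℕ j) (words (words (allFin b) n) r))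
    / b ℕ.^ (n ℕ.* r)) {{ℕ.m^n≢0 b (n ℕ.* r)}}
  where instance
    b≢0 : ℕ.NonZero b
    b≢0 = ℕ.nonTrivial⇒nonZero b

descents : ∀ {m k} → Vec (Fin m) k → ℕ
descents []          = 0
descents (x ∷ [])    = 0
descents (x ∷ y ∷ v) = (if does (y Fin.<? x) then 1 else 0) ℕ.+ descents (y ∷ v)

-- One-line notation: words of length n in Fin n with pairwise distinct letters.
permutations : (n : ℕ) → List (Vec (Fin n) n)
permutations n = filter (allPairs? λ x y → ¬? (x Fin.≟ y)) (words (allFin n) n)

eulerian : ℕ → ℕ → ℕ
eulerian n j = length (filter (λ σ → descents σ ℕ.≟ j) (permutations n))

stationary : (n : ℕ) → Fin n → ℚ
stationary n j = (ℤ.+ eulerian n (toℕ j) / n !) {{n ℕ.!≢0}}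

totalVariation : ∀ {n} → (Fin n → ℚ) → (Fin n → ℚ) → ℚ
totalVariation P Q = ½ * sum (λ x → ∣ P x - Q x ∣)

{-# OPTIONS --safe #-}

-- In base B the carry after adding n random digits to κ is ⌊(κ + ΣX)/B⌋, so r steps in base b
-- are one step in base B = bʳ, and on generating functions a step is multiplication by
-- (1 + z + … + zᴮ⁻¹)ⁿ⁺¹ followed by the extraction of every B-th coefficient. This operator
-- fixes Σ_σ z^{des σ} = (1 - z)ⁿ⁺¹ Σ_x (x + 1)ⁿ zˣ up to the factor Bⁿ, so the Eulerian
-- distribution π is stationary and P - π is the difference between the chains started from 0
-- and from a random number m of descents. Starting from m instead of 0 shifts the law p of ΣX
-- by m, hence Σ_j |P(j) - π(j)| ≤ E[m] V with E[m] = (n - 1)/2 and V = Σ_s |p(s) - p(s - 1)|.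
-- Here V ≤ 2/B, and V ≤ 2(2B² + 1)/(3B³) for n ≥ 4, because adding further digits does not
-- increase V. It follows that Σ_j |P(j) - π(j)| ≤ n/(√2 B) ≤ 1/(√2 c) ≤ √(exp(1/(2c²)) - 1).

module Submission where

open import Defs
open import Algebra.Bundles using (CommutativeMonoid; CommutativeRing)
import Algebra.Construct.Pointwise as Pointwise
import Algebra.Properties.CommutativeMonoid.Sum as FinSum
import Algebra.Solver.Ring as RingSolver
import Algebra.Solver.Ring.AlmostCommutativeRing as ACR
open import Data.Bool.Base using (Bool; true; false; if_then_else_; _∧_)
open import Data.Fin.Base as Fin using (Fin; toℕ; punchIn)
import Data.Fin.Properties as Fin
import Data.Integer.Base as ℤ
open import Data.List.Base as List using (List; []; _∷_; allFin; cartesianProductWith; filter; length)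
open import Data.Maybe.Base using (Maybe; just; nothing)
open import Data.Nat.Base as ℕ using (ℕ; zero; suc; NonTrivial; _!)
import Data.Nat.DivMod as ℕ
import Data.Nat.Properties as ℕ
import Data.Nat.Solver as ℕ
open import Data.Product using (_×_; _,_; ∃-syntax; proj₁; proj₂)
open import Data.Vec.Base as Vec using (Vec; []; _∷_)
open import Data.Vec.Relation.Unary.All using (all?)
open import Data.Vec.Relation.Unary.AllPairs using (allPairs?)
open import Function.Base using (_∘_; id; case_of_)
open import Function.Bundles using (mk⇔)
open import Level using (0ℓ)
open import Relation.Binary.PropositionalEquality as ≡ using (_≡_; cong; cong₂)
import Relation.Binary.Reasoning.Setoid as SetoidReasoning
open import Relation.Nullary
open import Relation.Nullary.Decidable using (does-⇔; dec-true; dec-false)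
open import Relation.Unary using (Pred; Decidable)

-- Sums over words and permutations

-- Among n ≥ 2, the bound V ≤ 2/B alone suffices only for n = 2 and n = 3, because it yields (n -
-- 1)/B and this has to be at most n/(√2 B). For larger n the variation must drop by a factor below
-- 1/√2. The law of ΣX is unimodal, so V is twice its largest value; for large B that is 2/B times
-- the maximum of the density of a sum of uniform variables on [0, 1], which is 3/4 for three
-- summands and 2/3 for four. Since 3/4 > 1/√2 > 2/3, four digits are the first that help. At finite
-- B the factor is (2B² + 1)/(3B²), still too large for B ≤ 2, where the slack at small n and the
-- trivial bound 2 on the sum take over. The factor E[m] comes from 1 - zᵐ = (1 - z)(1 + z + ... +
-- zᵐ⁻¹): a shift by m is m unit shifts. In the exponent n + 1 of a step only n factors are digits;
-- the remaining one, together with the extraction of coefficients, performs the division by B.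

Below : ∀ {m n} → Fin m → Fin n → ℕ
Below l k = if does (l Fin.<? k) then 1 else 0

-- `punchIn k` skips the value `k`: letters below `k` keep their value and the others move up by
-- one, hence past `k`.
punchIn-<? : ∀ {n} (k : Fin (suc n)) l → does (punchIn k l Fin.<? k) ≡ does (l Fin.<? k)
punchIn-<? k l = does-⇔ (mk⇔ (to k l) (from k l)) (punchIn k l Fin.<? k) (l Fin.<? k)
  where
  to : ∀ {n} (k : Fin (suc n)) l → punchIn k l Fin.< k → l Fin.< k
  to (Fin.suc k) Fin.zero    p         = ℕ.s≤s ℕ.z≤n
  to (Fin.suc k) (Fin.suc l) (ℕ.s≤s p) = ℕ.s≤s (to k l p)
  from : ∀ {n} (k : Fin (suc n)) l → l Fin.< k → punchIn k l Fin.< k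
  from (Fin.suc k) Fin.zero    p         = ℕ.s≤s ℕ.z≤n
  from (Fin.suc k) (Fin.suc l) (ℕ.s≤s p) = ℕ.s≤s (from k l p)

punchIn-mono-<? : ∀ {n} (x : Fin (suc n)) k l → does (punchIn x k Fin.<? punchIn x l) ≡ does (k Fin.<? l)
punchIn-mono-<? x k l = does-⇔ (mk⇔
    (λ lt → ℕ.≰⇒> λ le → ℕ.<⇒≱ lt (Fin.punchIn-mono-≤ x l k le))
    (λ lt → ℕ.≰⇒> λ le → ℕ.<⇒≱ lt (Fin.punchIn-cancel-≤ x l k le)))
  (punchIn x k Fin.<? punchIn x l) (k Fin.<? l)

descents-punchIn : ∀ {n k} (x : Fin (suc n)) (w : Vec (Fin n) k) → descents (Vec.map (punchIn x) w) ≡ descents w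
descents-punchIn x []          = ≡.refl
descents-punchIn x (y ∷ [])    = ≡.refl
descents-punchIn x (y ∷ y′ ∷ w) = cong₂ (λ c d → (if c then 1 else 0) ℕ.+ d)
  (punchIn-mono-<? x y′ y) (descents-punchIn x (y′ ∷ w))

-- Deleting the first letter `k` and relabelling leaves a word that starts with `l`, so only the
-- first position contributes a new term. This is the recursion behind both the generating function
-- and the mean of the descents.
descents-∷ : ∀ {n} (k : Fin (suc (suc n))) (l : Fin (suc n)) (w : Vec (Fin n) n) →
  descents (k ∷ Vec.map (punchIn k) (l ∷ Vec.map (punchIn l) w)) ≡ Below l k ℕ.+ descents (l ∷ Vec.map (punchIn l) w)
descents-∷ k l w = cong₂ (λ c d → (if c then 1 else 0) ℕ.+ d) (punchIn-<? k l)
  (descents-punchIn k (l ∷ Vec.map (punchIn l) w))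

avoids : ∀ {m k} → Fin m → Vec (Fin m) k → Bool
avoids x w = does (all? (λ y → ¬? (x Fin.≟ y)) w)

-- Boolean forms, because `does` of a product of decisions computes: `distinct (x ∷ w)` unfolds to
-- `avoids x w ∧ distinct w`, so the filter in `permutations` can be peeled off one letter at a
-- time.
distinct : ∀ {m k} → Vec (Fin m) k → Bool
distinct w = does (allPairs? (λ x y → ¬? (x Fin.≟ y)) w)

avoids-punchIn : ∀ {n k} x y (w : Vec (Fin n) k) → avoids (punchIn x y) (Vec.map (punchIn x) w) ≡ avoids y w
avoids-punchIn x y []       = ≡.refl
avoids-punchIn x y (y′ ∷ w) = cong₂ _∧_
  (does-⇔ (mk⇔ (λ ne eq → ne (cong (punchIn x) eq)) (λ ne eq → ne (Fin.punchIn-injective x y y′ eq)))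
    (¬? (punchIn x y Fin.≟ punchIn x y′)) (¬? (y Fin.≟ y′)))
  (avoids-punchIn x y w)

distinct-punchIn : ∀ {n k} x (w : Vec (Fin n) k) → distinct (Vec.map (punchIn x) w) ≡ distinct w
distinct-punchIn x []      = ≡.refl
distinct-punchIn x (y ∷ w) = cong₂ _∧_ (avoids-punchIn x y w) (distinct-punchIn x w)

-- An arbitrary commutative monoid, because the recursion on permutations is needed twice: in the
-- series, for the descent generating function, and in ℚ, for the number of permutations and of
-- their descents.
module Sums {c ℓ} (M : CommutativeMonoid c ℓ) where

  open CommutativeMonoid M
  open FinSum M using (sum; sum-cong-≋; sum-remove)
  open SetoidReasoning setoid

  sumOver : {A : Set} → (A → Carrier) → List A → Carrier
  sumOver f []       = ε
  sumOver f (x ∷ xs) = f x ∙ sumOver f xs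

  sumOver-cong : ∀ {A} {f g : A → Carrier} → (∀ x → f x ≈ g x) → ∀ xs → sumOver f xs ≈ sumOver g xs
  sumOver-cong eq []       = refl
  sumOver-cong eq (x ∷ xs) = ∙-cong (eq x) (sumOver-cong eq xs)

  sumOver-++ : ∀ {A} (f : A → Carrier) xs ys → sumOver f (xs List.++ ys) ≈ sumOver f xs ∙ sumOver f ys
  sumOver-++ f []       ys = sym (identityˡ _)
  sumOver-++ f (x ∷ xs) ys = trans (∙-congˡ (sumOver-++ f xs ys)) (sym (assoc _ _ _))

  sumOver-map : ∀ {A B} (f : B → Carrier) (g : A → B) xs → sumOver f (List.map g xs) ≡ sumOver (f ∘ g) xs
  sumOver-map f g []       = ≡.refl
  sumOver-map f g (x ∷ xs) = cong (f (g x) ∙_) (sumOver-map f g xs)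

  sumOver-cartesianProductWith : ∀ {A B C} (f : C → Carrier) (g : A → B → C) xs ys →
    sumOver f (cartesianProductWith g xs ys) ≈ sumOver (λ x → sumOver (λ y → f (g x y)) ys) xs
  sumOver-cartesianProductWith f g []       ys = refl
  sumOver-cartesianProductWith f g (x ∷ xs) ys = trans (sumOver-++ f (List.map (g x) ys) _)
    (∙-cong (reflexive (sumOver-map f (g x) ys)) (sumOver-cartesianProductWith f g xs ys))

  sumOver-tabulate : ∀ {A n} (f : A → Carrier) (g : Fin n → A) → sumOver f (List.tabulate g) ≡ sum (f ∘ g)
  sumOver-tabulate {n = zero}  f g = ≡.refl
  sumOver-tabulate {n = suc n} f g = cong (f (g Fin.zero) ∙_) (sumOver-tabulate f (g ∘ Fin.suc))

  sumOver-filter : ∀ {A} {P : Pred A 0ℓ} (P? : Decidable P) (f : A → Carrier) xs →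
    sumOver f (filter P? xs) ≈ sumOver (λ x → if does (P? x) then f x else ε) xs
  sumOver-filter P? f []       = refl
  sumOver-filter P? f (x ∷ xs) with does (P? x)
  ... | true  = ∙-congˡ (sumOver-filter P? f xs)
  ... | false = trans (sumOver-filter P? f xs) (sym (identityˡ _))

  sumOver-homo : ∀ {A} (φ : Carrier → Carrier) → φ ε ≈ ε → (∀ a b → φ (a ∙ b) ≈ φ a ∙ φ b) →
    ∀ (f : A → Carrier) xs → φ (sumOver f xs) ≈ sumOver (φ ∘ f) xs
  sumOver-homo φ φ-ε φ-∙ f []       = φ-ε
  sumOver-homo φ φ-ε φ-∙ f (x ∷ xs) = trans (φ-∙ _ _) (∙-congˡ (sumOver-homo φ φ-ε φ-∙ f xs))

  sumOver-ε : ∀ {A : Set} (xs : List A) → sumOver (λ _ → ε) xs ≈ ε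
  sumOver-ε []       = refl
  sumOver-ε (x ∷ xs) = trans (identityˡ _) (sumOver-ε xs)

  sumOver-∙ : ∀ {A} (f g : A → Carrier) xs → sumOver (λ x → f x ∙ g x) xs ≈ sumOver f xs ∙ sumOver g xs
  sumOver-∙ f g []       = sym (identityˡ ε)
  sumOver-∙ f g (x ∷ xs) = trans (∙-congˡ (sumOver-∙ f g xs)) (interchange (f x) (g x) (sumOver f xs) (sumOver g xs))
    where open import Algebra.Properties.CommutativeSemigroup commutativeSemigroup using (interchange)

  sumOver-words : ∀ {m k} (f : Vec (Fin m) (suc k) → Carrier) →
    sumOver f (words (allFin m) (suc k)) ≈ sum (λ x → sumOver (λ w → f (x ∷ w)) (words (allFin m) k))
  sumOver-words {m} {k} f = trans (sumOver-cartesianProductWith f _∷_ (allFin m) (words (allFin m) k))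
    (reflexive (sumOver-tabulate (λ x → sumOver (λ w → f (x ∷ w)) (words (allFin m) k)) id))

  private

    if-∧ : ∀ a {b} x → (if a ∧ b then x else ε) ≡ (if a then (if b then x else ε) else ε)
    if-∧ true  x = ≡.refl
    if-∧ false x = ≡.refl

    if-true : ∀ {b} → b ≡ true → ∀ x → (if b then x else ε) ≡ x
    if-true ≡.refl x = ≡.refl

    if-false : ∀ {b} → b ≡ false → ∀ x → (if b then x else ε) ≡ ε
    if-false ≡.refl x = ≡.refl

  sumOver-if : ∀ {A : Set} b (f : A → Carrier) xs →
    sumOver (λ x → if b then f x else ε) xs ≈ (if b then sumOver f xs else ε)
  sumOver-if true  f xs = refl
  sumOver-if false f xs = sumOver-ε xs

  -- A word avoiding `x` is the image under `punchIn x` of exactly one word over an alphabet with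
  -- one letter fewer. At each position `sum-remove` splits off the letter `x`, whose summand is ε.
  sumOver-avoiding : ∀ {m} k (x : Fin (suc m)) (g : Vec (Fin (suc m)) k → Carrier) →
    sumOver (λ w → if avoids x w then g w else ε) (words (allFin (suc m)) k) ≈
    sumOver (λ w → g (Vec.map (punchIn x) w)) (words (allFin m) k)
  sumOver-avoiding     zero    x g = refl
  sumOver-avoiding {m} (suc k) x g = begin
    sumOver (λ w → if avoids x w then g w else ε) (words (allFin (suc m)) (suc k))
      ≈⟨ sumOver-words (λ w → if avoids x w then g w else ε) ⟩
    sum (λ y → sumOver (λ w → if avoids x (y ∷ w) then g (y ∷ w) else ε) (words (allFin (suc m)) k))
      ≈⟨ sum-cong-≋ (λ y → trans (sumOver-cong (λ w → reflexive (if-∧ (differs y) (g (y ∷ w)))) (words (allFin (suc m)) k))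
           (trans (sumOver-if (differs y) (λ w → if avoids x w then g (y ∷ w) else ε) (words (allFin (suc m)) k))
                  (if-cong (differs y) (sumOver-avoiding k x (g ∘ (y ∷_)))))) ⟩
    sum (λ y → if differs y then h y else ε)
      ≈⟨ sum-remove {i = x} (λ y → if differs y then h y else ε) ⟩
    (if differs x then h x else ε) ∙ sum (λ y → if differs (punchIn x y) then h (punchIn x y) else ε)
      ≈⟨ ∙-cong (reflexive (if-false (dec-false (¬? (x Fin.≟ x)) (λ ne → ne ≡.refl)) (h x)))
           (sum-cong-≋ (λ y → reflexive (if-true (dec-true (¬? (x Fin.≟ punchIn x y)) (λ eq → Fin.punchInᵢ≢i x y (≡.sym eq))) (h (punchIn x y))))) ⟩
    ε ∙ sum (h ∘ punchIn x)
      ≈⟨ identityˡ _ ⟩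
    sum (h ∘ punchIn x)
      ≈⟨ sumOver-words (λ w → g (Vec.map (punchIn x) w)) ⟨
    sumOver (λ w → g (Vec.map (punchIn x) w)) (words (allFin m) (suc k)) ∎
    where
    differs : Fin (suc m) → Bool
    differs y = does (¬? (x Fin.≟ y))
    h : Fin (suc m) → Carrier
    h y = sumOver (λ w → g (y ∷ Vec.map (punchIn x) w)) (words (allFin m) k)
    if-cong : ∀ b {a a′} → a ≈ a′ → (if b then a else ε) ≈ (if b then a′ else ε)
    if-cong true  eq = eq
    if-cong false eq = refl

  sumOver-permutations : ∀ {n} (f : Vec (Fin (suc n)) (suc n) → Carrier) →
    sumOver f (permutations (suc n)) ≈ sum (λ k → sumOver (λ w → f (k ∷ Vec.map (punchIn k) w)) (permutations n))
  sumOver-permutations {n} f = begin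
    sumOver f (permutations (suc n))
      ≈⟨ sumOver-filter (allPairs? λ x y → ¬? (x Fin.≟ y)) f (words (allFin (suc n)) (suc n)) ⟩
    sumOver (λ w → if distinct w then f w else ε) (words (allFin (suc n)) (suc n))
      ≈⟨ sumOver-words (λ w → if distinct w then f w else ε) ⟩
    sum (λ k → sumOver (λ w → if distinct (k ∷ w) then f (k ∷ w) else ε) (words (allFin (suc n)) n))
      ≈⟨ sum-cong-≋ step ⟩
    sum (λ k → sumOver (λ w → f (k ∷ Vec.map (punchIn k) w)) (permutations n)) ∎
    where
    step : ∀ k → sumOver (λ w → if distinct (k ∷ w) then f (k ∷ w) else ε) (words (allFin (suc n)) n) ≈
                 sumOver (λ w → f (k ∷ Vec.map (punchIn k) w)) (permutations n)
    step k = begin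
      sumOver (λ w → if distinct (k ∷ w) then f (k ∷ w) else ε) (words (allFin (suc n)) n)
        ≈⟨ sumOver-cong (λ w → reflexive (if-∧ (avoids k w) (f (k ∷ w)))) (words (allFin (suc n)) n) ⟩
      sumOver (λ w → if avoids k w then (if distinct w then f (k ∷ w) else ε) else ε) (words (allFin (suc n)) n)
        ≈⟨ sumOver-avoiding n k (λ w → if distinct w then f (k ∷ w) else ε) ⟩
      sumOver (λ w → if distinct (Vec.map (punchIn k) w) then f (k ∷ Vec.map (punchIn k) w) else ε) (words (allFin n) n)
        ≈⟨ sumOver-cong (λ w → reflexive (cong (λ b → if b then f (k ∷ Vec.map (punchIn k) w) else ε) (distinct-punchIn k w))) (words (allFin n) n) ⟩
      sumOver (λ w → if distinct w then f (k ∷ Vec.map (punchIn k) w) else ε) (words (allFin n) n)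
        ≈⟨ sumOver-filter (allPairs? λ x y → ¬? (x Fin.≟ y)) (λ w → f (k ∷ Vec.map (punchIn k) w)) (words (allFin n) n) ⟨
      sumOver (λ w → f (k ∷ Vec.map (punchIn k) w)) (permutations n) ∎

  -- The sum of φ (des σ) over the permutations σ of {0,…,n} with σ(0) = k.
  sumFrom : ∀ n → Fin (suc n) → (ℕ → Carrier) → Carrier
  sumFrom n k φ = sumOver (λ w → φ (descents (k ∷ Vec.map (punchIn k) w))) (permutations n)

  sumOver-descents : ∀ n φ → sumOver (φ ∘ descents) (permutations (suc n)) ≈ sum (λ k → sumFrom n k φ)
  sumOver-descents n φ = sumOver-permutations {n} (φ ∘ descents)

  sumFrom-suc : ∀ n k φ → sumFrom (suc n) k φ ≈ sum (λ l → sumFrom n l (λ d → φ (Below l k ℕ.+ d)))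
  sumFrom-suc n k φ = trans (sumOver-permutations {n} (λ w → φ (descents (k ∷ Vec.map (punchIn k) w))))
    (sum-cong-≋ λ l → sumOver-cong (λ w → reflexive (cong φ (descents-∷ k l w))) (permutations n))

-- Formal power series

open import Data.Rational.Base
import Data.Rational.Properties as ℚ
open import Data.Rational.Solver using (module +-*-Solver)
open import Relation.Binary.PropositionalEquality

open import Algebra.Definitions.RawSemiring +-*-rawSemiring using (_^_)
open +-*-Solver using (solve; _:=_; _:+_; _:*_; _:-_; con)
module ℕS = ℕ.+-*-Solver

Series : Set
Series = ℕ → ℚ

infixl 7 _⊛_

-- The Cauchy product, read off from f = f(0) + z (f ∘ suc). The recursion on the index turns the
-- ring laws into inductions.
_⊛_ : Series → Series → Series
(f ⊛ g) zero    = f 0 * g 0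
(f ⊛ g) (suc x) = f 0 * g (suc x) + (f ∘ suc ⊛ g) x

constant : ℚ → Series
constant p zero    = p
constant p (suc x) = 0ℚ

0-⊛ : ∀ g x → ((λ _ → 0ℚ) ⊛ g) x ≡ 0ℚ
0-⊛ g zero    = ℚ.*-zeroˡ (g 0)
0-⊛ g (suc x) = trans (cong₂ _+_ (ℚ.*-zeroˡ (g (suc x))) (0-⊛ g x)) (ℚ.+-identityˡ 0ℚ)

constant-⊛ : ∀ p g x → (constant p ⊛ g) x ≡ p * g x
constant-⊛ p g zero    = refl
constant-⊛ p g (suc x) = trans (cong (p * g (suc x) +_) (0-⊛ g x)) (ℚ.+-identityʳ (p * g (suc x)))

private

  ⊛-cong : ∀ {f f′ g g′} → f ≗ f′ → g ≗ g′ → f ⊛ g ≗ f′ ⊛ g′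
  ⊛-cong f≗ g≗ zero    = cong₂ _*_ (f≗ 0) (g≗ 0)
  ⊛-cong f≗ g≗ (suc x) = cong₂ _+_ (cong₂ _*_ (f≗ 0) (g≗ (suc x))) (⊛-cong (f≗ ∘ suc) g≗ x)

  ⊛-distribʳ : ∀ h f g x → ((λ y → f y + g y) ⊛ h) x ≡ (f ⊛ h) x + (g ⊛ h) x
  ⊛-distribʳ h f g zero    = ℚ.*-distribʳ-+ (h 0) (f 0) (g 0)
  ⊛-distribʳ h f g (suc x) = trans (cong ((f 0 + g 0) * h (suc x) +_) (⊛-distribʳ h (f ∘ suc) (g ∘ suc) x))
    (solve 5 (λ a b c d e → (a :+ b) :* c :+ (d :+ e) := (a :* c :+ d) :+ (b :* c :+ e)) refl
      (f 0) (g 0) (h (suc x)) ((f ∘ suc ⊛ h) x) ((g ∘ suc ⊛ h) x))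

  ⊛-scaleˡ : ∀ p f g x → ((λ y → p * f y) ⊛ g) x ≡ p * (f ⊛ g) x
  ⊛-scaleˡ p f g zero    = ℚ.*-assoc p (f 0) (g 0)
  ⊛-scaleˡ p f g (suc x) = trans (cong (p * f 0 * g (suc x) +_) (⊛-scaleˡ p (f ∘ suc) g x))
    (solve 4 (λ p a b c → p :* a :* b :+ p :* c := p :* (a :* b :+ c)) refl p (f 0) (g (suc x)) ((f ∘ suc ⊛ g) x))

  ⊛-assoc : ∀ f g h x → (f ⊛ g ⊛ h) x ≡ (f ⊛ (g ⊛ h)) x
  ⊛-assoc f g h zero    = ℚ.*-assoc (f 0) (g 0) (h 0)
  ⊛-assoc f g h (suc x) = begin
    f 0 * g 0 * h (suc x) + ((λ y → f 0 * g (suc y) + (f ∘ suc ⊛ g) y) ⊛ h) x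
      ≡⟨ cong (f 0 * g 0 * h (suc x) +_) (trans (⊛-distribʳ h (λ y → f 0 * g (suc y)) (f ∘ suc ⊛ g) x)
           (cong₂ _+_ (⊛-scaleˡ (f 0) (g ∘ suc) h x) (⊛-assoc (f ∘ suc) g h x))) ⟩
    f 0 * g 0 * h (suc x) + (f 0 * (g ∘ suc ⊛ h) x + (f ∘ suc ⊛ (g ⊛ h)) x)
      ≡⟨ solve 5 (λ a b c d e → a :* b :* c :+ (a :* d :+ e) := a :* (b :* c :+ d) :+ e) refl
           (f 0) (g 0) (h (suc x)) ((g ∘ suc ⊛ h) x) ((f ∘ suc ⊛ (g ⊛ h)) x) ⟩
    f 0 * (g ⊛ h) (suc x) + (f ∘ suc ⊛ (g ⊛ h)) x ∎
    where open ≡-Reasoning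

  -- The mirror image of the defining recursion, which peels the right factor instead; commutativity
  -- follows by comparing the two.
  ⊛-sucʳ : ∀ f g x → (f ⊛ g) (suc x) ≡ f (suc x) * g 0 + (f ⊛ g ∘ suc) x
  ⊛-sucʳ f g zero    = ℚ.+-comm (f 0 * g 1) (f 1 * g 0)
  ⊛-sucʳ f g (suc x) = trans (cong (f 0 * g (suc (suc x)) +_) (⊛-sucʳ (f ∘ suc) g x))
    (solve 3 (λ a b c → a :+ (b :+ c) := b :+ (a :+ c)) refl
      (f 0 * g (suc (suc x))) (f (suc (suc x)) * g 0) ((f ∘ suc ⊛ g ∘ suc) x))

  ⊛-comm : ∀ f g x → (f ⊛ g) x ≡ (g ⊛ f) x
  ⊛-comm f g zero    = ℚ.*-comm (f 0) (g 0)
  ⊛-comm f g (suc x) = trans (cong₂ _+_ (ℚ.*-comm (f 0) (g (suc x))) (⊛-comm (f ∘ suc) g x)) (sym (⊛-sucʳ g f x))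

  ⊛-identityˡ : ∀ f x → (constant 1ℚ ⊛ f) x ≡ f x
  ⊛-identityˡ f x = trans (constant-⊛ 1ℚ f x) (ℚ.*-identityˡ (f x))

series : CommutativeRing 0ℓ 0ℓ
series = record
  { Carrier = Series
  ; _≈_     = _≗_
  ; _+_     = λ f g x → f x + g x
  ; _*_     = _⊛_
  ; -_      = λ f x → - f x
  ; 0#      = λ _ → 0ℚ
  ; 1#      = constant 1ℚ
  ; isCommutativeRing = record
    { isRing = record
      { +-isAbelianGroup = Pointwise.isAbelianGroup ℕ ℚ.+-0-isAbelianGroup
      ; *-cong           = ⊛-cong
      ; *-assoc          = ⊛-assoc
      ; *-identity       = ⊛-identityˡ , λ f x → trans (⊛-comm f (constant 1ℚ) x) (⊛-identityˡ f x)
      ; distrib          = (λ f g h x → trans (⊛-comm f (λ y → g y + h y) x)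
                             (trans (⊛-distribʳ f g h x) (cong₂ _+_ (⊛-comm g f x) (⊛-comm h f x))))
                           , ⊛-distribʳ
      }
    ; *-comm = ⊛-comm
    }
  }

module S = CommutativeRing series

constant-homo : CommutativeRing.rawRing ℚ.+-*-commutativeRing ACR.-Raw-AlmostCommutative⟶ ACR.fromCommutativeRing series
constant-homo = record
  { ⟦_⟧    = constant
  ; +-homo = λ { p q zero → refl ; p q (suc x) → sym (ℚ.+-identityˡ 0ℚ) }
  ; *-homo = λ { p q zero → refl ; p q (suc x) → sym (trans (constant-⊛ p (constant q) (suc x)) (ℚ.*-zeroʳ p)) }
  ; -‿homo = λ { p zero → refl ; p (suc x) → refl }
  ; 0-homo = λ { zero → refl ; (suc x) → refl }
  ; 1-homo = λ _ → refl
  }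

constant-≟ : ∀ p q → Maybe (constant p ≗ constant q)
constant-≟ p q with p ℚ.≟ q
... | yes p≡q = just (λ x → cong (λ r → constant r x) p≡q)
... | no _    = nothing

module SeriesSolver =
  RingSolver (CommutativeRing.rawRing ℚ.+-*-commutativeRing) (ACR.fromCommutativeRing series) constant-homo constant-≟

z : Series
z zero          = 0ℚ
z (suc zero)    = 1ℚ
z (suc (suc _)) = 0ℚ

open S using () renaming (_+_ to _⊕_; _-_ to _⊖_; 0# to 0ˢ; 1# to 1ˢ; _≈_ to _≈ˢ_)
open import Algebra.Properties.CommutativeSemiring.Exp S.commutativeSemiring using () renaming
  (_^_ to _^ˢ_; ^-distrib-* to ^ˢ-distrib-*; ^-congˡ to ^ˢ-congˡ; ^-homo-* to ^ˢ-homo-*; ^-assocʳ to ^ˢ-assocʳ)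
open SeriesSolver using () renaming
  (solve to solveˢ; _:=_ to _:=ˢ_; _:+_ to _:+ˢ_; _:*_ to _:*ˢ_; _:-_ to _:-ˢ_; con to conˢ)

module ≈ˢ-Reasoning = SetoidReasoning S.setoid

-- Geometric sums and the extraction of every B-th coefficient

geom : Series → ℕ → Series
geom q zero    = 0ˢ
geom q (suc a) = 1ˢ ⊕ q ⊛ geom q a

[1-q]geom : ∀ q a → (1ˢ ⊖ q) ⊛ geom q a ≈ˢ 1ˢ ⊖ q ^ˢ a
[1-q]geom q zero    = S.trans (S.zeroʳ (1ˢ ⊖ q)) (S.sym (S.-‿inverseʳ 1ˢ))
[1-q]geom q (suc a) = begin
  (1ˢ ⊖ q) ⊛ (1ˢ ⊕ q ⊛ geom q a)
    ≈⟨ solveˢ 2 (λ q g → (conˢ 1ℚ :-ˢ q) :*ˢ (conˢ 1ℚ :+ˢ q :*ˢ g) :=ˢ conˢ 1ℚ :-ˢ q :+ˢ q :*ˢ ((conˢ 1ℚ :-ˢ q) :*ˢ g)) (λ _ → refl) q (geom q a) ⟩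
  1ˢ ⊖ q ⊕ q ⊛ ((1ˢ ⊖ q) ⊛ geom q a)
    ≈⟨ S.+-congˡ {1ˢ ⊖ q} (S.*-congˡ {q} ([1-q]geom q a)) ⟩
  1ˢ ⊖ q ⊕ q ⊛ (1ˢ ⊖ q ^ˢ a)
    ≈⟨ solveˢ 2 (λ q p → conˢ 1ℚ :-ˢ q :+ˢ q :*ˢ (conˢ 1ℚ :-ˢ p) :=ˢ conˢ 1ℚ :-ˢ q :*ˢ p) (λ _ → refl) q (q ^ˢ a) ⟩
  1ˢ ⊖ q ^ˢ suc a ∎
  where open ≈ˢ-Reasoning

geom-+ : ∀ q a b → geom q (a ℕ.+ b) ≈ˢ geom q a ⊕ q ^ˢ a ⊛ geom q b
geom-+ q zero    b = S.sym (S.trans (S.+-identityˡ (1ˢ ⊛ geom q b)) (S.*-identityˡ (geom q b)))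
geom-+ q (suc a) b = S.trans (S.+-congˡ {1ˢ} (S.*-congˡ {q} (geom-+ q a b)))
  (solveˢ 4 (λ q g p h → conˢ 1ℚ :+ˢ q :*ˢ (g :+ˢ p :*ˢ h) :=ˢ conˢ 1ℚ :+ˢ q :*ˢ g :+ˢ q :*ˢ p :*ˢ h) (λ _ → refl)
    q (geom q a) (q ^ˢ a) (geom q b))

-- For q = z: a digit in base B b is uniquely d + b d′ with digits d in base b and d′ in base B. The
-- second factor then lives in z ^ˢ b, which is why `geom` takes a general q.
geom-* : ∀ q B b → geom q (B ℕ.* b) ≈ˢ geom (q ^ˢ b) B ⊛ geom q b
geom-* q zero    b = S.sym (S.zeroˡ (geom q b))
geom-* q (suc B) b = begin
  geom q (b ℕ.+ B ℕ.* b)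
    ≈⟨ geom-+ q b (B ℕ.* b) ⟩
  geom q b ⊕ q ^ˢ b ⊛ geom q (B ℕ.* b)
    ≈⟨ S.+-congˡ {geom q b} (S.*-congˡ {q ^ˢ b} (geom-* q B b)) ⟩
  geom q b ⊕ q ^ˢ b ⊛ (geom (q ^ˢ b) B ⊛ geom q b)
    ≈⟨ solveˢ 3 (λ g p h → g :+ˢ p :*ˢ (h :*ˢ g) :=ˢ (conˢ 1ℚ :+ˢ p :*ˢ h) :*ˢ g) (λ _ → refl) (geom q b) (q ^ˢ b) (geom (q ^ˢ b) B) ⟩
  geom (q ^ˢ b) (suc B) ⊛ geom q b ∎
  where open ≈ˢ-Reasoning

geom-sucʳ : ∀ q a → geom q (suc a) ≈ˢ geom q a ⊕ q ^ˢ a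
geom-sucʳ q zero    = S.trans (S.+-congˡ {1ˢ} (S.zeroʳ q)) (S.+-comm 1ˢ 0ˢ)
geom-sucʳ q (suc a) = S.trans (S.+-congˡ {1ˢ} (S.*-congˡ {q} (geom-sucʳ q a)))
  (solveˢ 3 (λ q g p → conˢ 1ℚ :+ˢ q :*ˢ (g :+ˢ p) :=ˢ conˢ 1ℚ :+ˢ q :*ˢ g :+ˢ q :*ˢ p) (λ _ → refl) q (geom q a) (q ^ˢ a))

-- For q = z the left side has the coefficients 1, 2, ..., a + 1, ..., 2, 1, a triangle with a
-- bottom row of 2a + 1 ones. Removing that row leaves the triangle for `a`, shifted by one.
-- Algebraically, one factor is expanded as 1 + q [a] and the other as [a] + qᵃ.
geom-square : ∀ q a → geom q (suc a) ⊛ geom q (suc a) ≈ˢ geom q (suc (a ℕ.+ a)) ⊕ q ⊛ (geom q a ⊛ geom q a)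
geom-square q a = begin
  (1ˢ ⊕ q ⊛ G) ⊛ (1ˢ ⊕ q ⊛ G)
    ≈⟨ solveˢ 2 (λ q g → (conˢ 1ℚ :+ˢ q :*ˢ g) :*ˢ (conˢ 1ℚ :+ˢ q :*ˢ g) :=ˢ conˢ 1ℚ :+ˢ q :*ˢ g :+ˢ (conˢ 1ℚ :+ˢ q :*ˢ g) :*ˢ (q :*ˢ g)) (λ _ → refl) q G ⟩
  1ˢ ⊕ q ⊛ G ⊕ (1ˢ ⊕ q ⊛ G) ⊛ (q ⊛ G)
    ≈⟨ S.+-congˡ {1ˢ ⊕ q ⊛ G} (S.*-congʳ {q ⊛ G} (geom-sucʳ q a)) ⟩
  1ˢ ⊕ q ⊛ G ⊕ (G ⊕ q ^ˢ a) ⊛ (q ⊛ G)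
    ≈⟨ solveˢ 3 (λ q g p → conˢ 1ℚ :+ˢ q :*ˢ g :+ˢ (g :+ˢ p) :*ˢ (q :*ˢ g) :=ˢ conˢ 1ℚ :+ˢ q :*ˢ (g :+ˢ p :*ˢ g) :+ˢ q :*ˢ (g :*ˢ g)) (λ _ → refl) q G (q ^ˢ a) ⟩
  1ˢ ⊕ q ⊛ (G ⊕ q ^ˢ a ⊛ G) ⊕ q ⊛ (G ⊛ G)
    ≈⟨ S.+-congʳ {q ⊛ (G ⊛ G)} (S.+-congˡ {1ˢ} (S.*-congˡ {q} (geom-+ q a a))) ⟨
  geom q (suc (a ℕ.+ a)) ⊕ q ⊛ (G ⊛ G) ∎
  where
  open ≈ˢ-Reasoning
  G = geom q a

z-⊛-zero : ∀ f → (z ⊛ f) 0 ≡ 0ℚ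
z-⊛-zero f = ℚ.*-zeroˡ (f 0)

z-⊛-suc : ∀ f x → (z ⊛ f) (suc x) ≡ f x
z-⊛-suc f x = trans (cong₂ _+_ (ℚ.*-zeroˡ (f (suc x)))
    (trans (S.*-congʳ {f} {z ∘ suc} {1ˢ} (λ { zero → refl ; (suc _) → refl }) x) (S.*-identityˡ f x)))
  (ℚ.+-identityˡ (f x))

z^-⊛-below : ∀ k f x → x ℕ.< k → (z ^ˢ k ⊛ f) x ≡ 0ℚ
z^-⊛-below (suc k) f zero    _           = trans (S.*-assoc z (z ^ˢ k) f 0) (z-⊛-zero (z ^ˢ k ⊛ f))
z^-⊛-below (suc k) f (suc x) (ℕ.s≤s x<k) =
  trans (S.*-assoc z (z ^ˢ k) f (suc x)) (trans (z-⊛-suc (z ^ˢ k ⊛ f) x) (z^-⊛-below k f x x<k))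

z^-⊛-above : ∀ k f x → (z ^ˢ k ⊛ f) (k ℕ.+ x) ≡ f x
z^-⊛-above zero    f x = S.*-identityˡ f x
z^-⊛-above (suc k) f x =
  trans (S.*-assoc z (z ^ˢ k) f (suc (k ℕ.+ x))) (trans (z-⊛-suc (z ^ˢ k ⊛ f) (k ℕ.+ x)) (z^-⊛-above k f x))

-- Picks the coefficients of index B - 1, 2B - 1, 3B - 1, ….
dil : ℕ → Series → Series
dil B f j = f (ℕ.pred B ℕ.+ j ℕ.* B)

-- The offsets compose because (b - 1) + (B - 1) b = B b - 1.
dil-dil : ∀ B b .{{_ : ℕ.NonZero B}} .{{_ : ℕ.NonZero b}} f → dil B (dil b f) ≈ˢ dil (B ℕ.* b) f
dil-dil B@(suc B′) b@(suc b′) f j = cong f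
  (ℕS.solve 3 (λ B′ b′ j → b′ ℕS.:+ (B′ ℕS.:+ j ℕS.:* (ℕS.con 1 ℕS.:+ B′)) ℕS.:* (ℕS.con 1 ℕS.:+ b′) ℕS.:=
      (b′ ℕS.:+ B′ ℕS.:* (ℕS.con 1 ℕS.:+ b′)) ℕS.:+ j ℕS.:* ((ℕS.con 1 ℕS.:+ B′) ℕS.:* (ℕS.con 1 ℕS.:+ b′)))
    refl B′ b′ j)

module _ (B : ℕ) .{{_ : ℕ.NonZero B}} where

  -- Meant for g = h(zᴮ): a series in zᴮ can be pulled out of the extraction with zᴮ replaced by z.
  -- As a relation between g and h it needs no substitution operator on series, only closure under
  -- sums and products.
  Intertwines : Series → Series → Set
  Intertwines g h = ∀ f → dil B (g ⊛ f) ≈ˢ h ⊛ dil B f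

  dil-cong : ∀ {f g} → f ≈ˢ g → dil B f ≈ˢ dil B g
  dil-cong eq j = eq _

  intertwines-z : Intertwines (z ^ˢ B) z
  intertwines-z f zero    = trans (z^-⊛-below B f (ℕ.pred B ℕ.+ 0)
      (subst (ℕ._< B) (sym (ℕ.+-identityʳ (ℕ.pred B))) (ℕ.≤-reflexive (ℕ.suc-pred B))))
    (sym (z-⊛-zero (dil B f)))
  intertwines-z f (suc j) = trans (trans (cong (z ^ˢ B ⊛ f)
      (ℕS.solve 3 (λ p B j → p ℕS.:+ (B ℕS.:+ j) ℕS.:= B ℕS.:+ (p ℕS.:+ j)) refl (ℕ.pred B) B (j ℕ.* B)))
      (z^-⊛-above B f (ℕ.pred B ℕ.+ j ℕ.* B)))
    (sym (z-⊛-suc (dil B f) j))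

  intertwines-1 : Intertwines 1ˢ 1ˢ
  intertwines-1 f = S.trans (dil-cong (S.*-identityˡ f)) (S.sym (S.*-identityˡ (dil B f)))

  intertwines-+ : ∀ g g′ h h′ → Intertwines g h → Intertwines g′ h′ → Intertwines (g ⊕ g′) (h ⊕ h′)
  intertwines-+ g g′ h h′ i i′ f = S.trans (dil-cong (S.distribʳ f g g′))
    (S.trans (S.+-cong (i f) (i′ f)) (S.sym (S.distribʳ (dil B f) h h′)))

  intertwines-* : ∀ g g′ h h′ → Intertwines g h → Intertwines g′ h′ → Intertwines (g ⊛ g′) (h ⊛ h′)
  intertwines-* g g′ h h′ i i′ f = S.trans (dil-cong (S.*-assoc g g′ f))
    (S.trans (i (g′ ⊛ f)) (S.trans (S.*-congˡ {h} (i′ f)) (S.sym (S.*-assoc h h′ (dil B f)))))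

  intertwines-^ : ∀ g h k → Intertwines g h → Intertwines (g ^ˢ k) (h ^ˢ k)
  intertwines-^ g h zero    i = intertwines-1
  intertwines-^ g h (suc k) i = intertwines-* g (g ^ˢ k) h (h ^ˢ k) i (intertwines-^ g h k i)

  intertwines-geom : ∀ a → Intertwines (geom (z ^ˢ B) a) (geom z a)
  intertwines-geom zero    f = S.trans (dil-cong (S.zeroˡ f)) (S.sym (S.zeroˡ (dil B f)))
  intertwines-geom (suc a) = intertwines-+ 1ˢ (z ^ˢ B ⊛ geom (z ^ˢ B) a) 1ˢ (z ⊛ geom z a) intertwines-1
    (intertwines-* (z ^ˢ B) (geom (z ^ˢ B) a) z (geom z a) intertwines-z (intertwines-geom a))

  intertwines-1-z : Intertwines (1ˢ ⊖ z ^ˢ B) (1ˢ ⊖ z)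
  intertwines-1-z = intertwines-+ 1ˢ (S.- (z ^ˢ B)) 1ˢ (S.- z) intertwines-1 λ f →
    S.trans (dil-cong (S.sym (-ˡ (z ^ˢ B) f))) (S.trans (λ j → cong -_ (intertwines-z f j)) (-ˡ z (dil B f)))
    where
    -ˡ : ∀ f g → S.- (f ⊛ g) ≈ˢ S.- f ⊛ g
    -ˡ = -‿distribˡ-*
      where open import Algebra.Properties.Ring S.ring

ones : Series
ones _ = 1ℚ

[1-z]ones : (1ˢ ⊖ z) ⊛ ones ≈ˢ 1ˢ
[1-z]ones x = trans (solveˢ 2 (λ z u → (conˢ 1ℚ :-ˢ z) :*ˢ u :=ˢ u :-ˢ z :*ˢ u) (λ _ → refl) z ones x) (lemma x)
  where
  lemma : ones ⊖ z ⊛ ones ≈ˢ 1ˢ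
  lemma zero    = cong (λ p → 1ℚ - p) (z-⊛-zero ones)
  lemma (suc x) = cong (λ p → 1ℚ - p) (z-⊛-suc ones x)

geom-z : ∀ a → geom z a ≈ˢ (1ˢ ⊖ z ^ˢ a) ⊛ ones
geom-z a = begin
  geom z a                             ≈⟨ S.*-identityˡ (geom z a) ⟨
  1ˢ ⊛ geom z a                        ≈⟨ S.*-congʳ {geom z a} [1-z]ones ⟨
  (1ˢ ⊖ z) ⊛ ones ⊛ geom z a           ≈⟨ solveˢ 3 (λ p u g → p :*ˢ u :*ˢ g :=ˢ p :*ˢ g :*ˢ u) (λ _ → refl) (1ˢ ⊖ z) ones (geom z a) ⟩
  (1ˢ ⊖ z) ⊛ geom z a ⊛ ones           ≈⟨ S.*-congʳ {ones} ([1-q]geom z a) ⟩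
  (1ˢ ⊖ z ^ˢ a) ⊛ ones                 ∎
  where open ≈ˢ-Reasoning

-- The coefficient of `geom z b ⊛ f` at b - 1 + j b is the sum of the coefficients of f at j b, ...,
-- j b + b - 1, the indices whose quotient by b is j. So multiplication by `geom z b` followed by
-- `dil b` rounds exponents down after division by b. The proof splits s into s % b and a multiple
-- of b, and the latter is pulled out.
dil-geom-z^ : ∀ b .{{_ : ℕ.NonZero b}} s → dil b (geom z b ⊛ z ^ˢ s) ≈ˢ z ^ˢ (s ℕ./ b)
dil-geom-z^ b s = begin
  dil b (geom z b ⊛ z ^ˢ s)
    ≈⟨ dil-cong b (S.*-cong (geom-z b) (S.trans (λ x → cong (λ t → (z ^ˢ t) x) (trans (ℕ.m≡m%n+[m/n]*n s b) (cong (s ℕ.% b ℕ.+_) (ℕ.*-comm (s ℕ./ b) b))))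
         (S.trans (^ˢ-homo-* z (s ℕ.% b) (b ℕ.* (s ℕ./ b))) (S.*-congˡ {z ^ˢ (s ℕ.% b)} (S.sym (^ˢ-assocʳ z b (s ℕ./ b))))))) ⟩
  dil b ((1ˢ ⊖ z ^ˢ b) ⊛ ones ⊛ (z ^ˢ (s ℕ.% b) ⊛ (z ^ˢ b) ^ˢ (s ℕ./ b)))
    ≈⟨ dil-cong b (solveˢ 4 (λ p u t q → p :*ˢ u :*ˢ (t :*ˢ q) :=ˢ q :*ˢ (p :*ˢ (t :*ˢ u))) (λ _ → refl)
         (1ˢ ⊖ z ^ˢ b) ones (z ^ˢ (s ℕ.% b)) ((z ^ˢ b) ^ˢ (s ℕ./ b))) ⟩
  dil b ((z ^ˢ b) ^ˢ (s ℕ./ b) ⊛ ((1ˢ ⊖ z ^ˢ b) ⊛ (z ^ˢ (s ℕ.% b) ⊛ ones)))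
    ≈⟨ intertwines-^ b (z ^ˢ b) z (s ℕ./ b) (intertwines-z b) ((1ˢ ⊖ z ^ˢ b) ⊛ (z ^ˢ (s ℕ.% b) ⊛ ones)) ⟩
  z ^ˢ (s ℕ./ b) ⊛ dil b ((1ˢ ⊖ z ^ˢ b) ⊛ (z ^ˢ (s ℕ.% b) ⊛ ones))
    ≈⟨ S.*-congˡ {z ^ˢ (s ℕ./ b)} (S.trans (intertwines-1-z b (z ^ˢ (s ℕ.% b) ⊛ ones)) (S.*-congˡ {1ˢ ⊖ z} full)) ⟩
  z ^ˢ (s ℕ./ b) ⊛ ((1ˢ ⊖ z) ⊛ ones)
    ≈⟨ S.*-congˡ {z ^ˢ (s ℕ./ b)} [1-z]ones ⟩
  z ^ˢ (s ℕ./ b) ⊛ 1ˢ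
    ≈⟨ S.*-identityʳ (z ^ˢ (s ℕ./ b)) ⟩
  z ^ˢ (s ℕ./ b) ∎
  where
  open ≈ˢ-Reasoning
  -- The offset b - 1 of `dil` matters here: s % b ≤ b - 1, so every extracted index lies beyond the
  -- leading zeros of `z ^ˢ (s ℕ.% b) ⊛ ones`.
  full : dil b (z ^ˢ (s ℕ.% b) ⊛ ones) ≈ˢ ones
  full j = trans (cong (z ^ˢ (s ℕ.% b) ⊛ ones) (sym (ℕ.m+[n∸m]≡n {s ℕ.% b} {ℕ.pred b ℕ.+ j ℕ.* b}
      (ℕ.≤-trans (ℕ.<⇒≤pred (ℕ.m%n<n s b)) (ℕ.m≤m+n (ℕ.pred b) (j ℕ.* b))))))
    (z^-⊛-above (s ℕ.% b) ones (ℕ.pred b ℕ.+ j ℕ.* b ℕ.∸ s ℕ.% b))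

-- The generating function of the carries

open Sums S.+-commutativeMonoid using () renaming
  ( sumOver to sumOverˢ; sumOver-cong to sumOverˢ-cong; sumOver-homo to sumOverˢ-homo; sumOver-∙ to sumOverˢ-⊕
  ; sumOver-cartesianProductWith to sumOverˢ-cartesianProductWith; sumOver-words to sumOverˢ-words
  ; sumFrom to sumFromˢ; sumFrom-suc to sumFromˢ-suc; sumOver-descents to sumOverˢ-descents )
open import Algebra.Properties.Semiring.Sum S.semiring using () renaming
  (sum to sumˢ; sum-cong-≋ to sumˢ-cong; *-distribˡ-sum to ⊛-distribˡ-sumˢ; *-distribʳ-sum to ⊛-distribʳ-sumˢ)
open Sums ℚ.+-0-commutativeMonoid using (sumOver; sumOver-cong; sumOver-homo; sumOver-∙; sumFrom; sumFrom-suc; sumOver-descents)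
open import Algebra.Properties.Semiring.Sum (CommutativeRing.semiring ℚ.+-*-commutativeRing) using
  (sum; sum-cong-≗; ∑-distrib-+; *-distribˡ-sum)

z^-coefficient : ∀ d j → (z ^ˢ d) j ≡ (if does (d ℕ.≟ j) then 1ℚ else 0ℚ)
z^-coefficient zero    zero    = refl
z^-coefficient zero    (suc j) = refl
z^-coefficient (suc d) zero    = z-⊛-zero (z ^ˢ d)
z^-coefficient (suc d) (suc j) = trans (z-⊛-suc (z ^ˢ d) j) (z^-coefficient d j)

-- The bridge from the counts in `carriesLaw` and `eulerian` to coefficients: an element x
-- contributes the monomial z ^ˢ g x.
ι-length-filter : ∀ {A : Set} (g : A → ℕ) j xs →
  ι (length (filter (λ x → g x ℕ.≟ j) xs)) ≡ sumOverˢ (λ x → z ^ˢ g x) xs j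
ι-length-filter g j []       = refl
ι-length-filter g j (x ∷ xs) with does (g x ℕ.≟ j) | z^-coefficient (g x) j
... | true  | eq = trans (ι-+ 1 (length (filter (λ x → g x ℕ.≟ j) xs))) (cong₂ _+_ (sym eq) (ι-length-filter g j xs))
... | false | eq = trans (ι-length-filter g j xs) (sym (trans (cong (_+ _) eq) (ℚ.+-identityˡ _)))

⊛-sumOverˢ : ∀ {A : Set} g (f : A → Series) xs → g ⊛ sumOverˢ f xs ≈ˢ sumOverˢ (λ x → g ⊛ f x) xs
⊛-sumOverˢ g = sumOverˢ-homo (g ⊛_) (S.zeroʳ g) (S.distribˡ g)

sum-z^ : ∀ b → sumˢ (λ (i : Fin b) → z ^ˢ toℕ i) ≈ˢ geom z b
sum-z^ zero    = S.refl
sum-z^ (suc b) = S.+-congˡ {1ˢ} (S.trans (S.sym (⊛-distribˡ-sumˢ z (λ (i : Fin b) → z ^ˢ toℕ i))) (S.*-congˡ {z} (sum-z^ b)))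

sum-words : ∀ b n → sumOverˢ (λ X → z ^ˢ Vec.sum (Vec.map toℕ X)) (words (allFin b) n) ≈ˢ geom z b ^ˢ n
sum-words b zero    = S.+-identityʳ 1ˢ
sum-words b (suc n) = begin
  sumOverˢ (λ X → z ^ˢ Vec.sum (Vec.map toℕ X)) (words (allFin b) (suc n))
    ≈⟨ sumOverˢ-words {b} {n} (λ X → z ^ˢ Vec.sum (Vec.map toℕ X)) ⟩
  sumˢ (λ (x : Fin b) → sumOverˢ (λ X → z ^ˢ (toℕ x ℕ.+ Vec.sum (Vec.map toℕ X))) (words (allFin b) n))
    ≈⟨ sumˢ-cong {b} (λ x → S.trans (sumOverˢ-cong (λ X → ^ˢ-homo-* z (toℕ x) (Vec.sum (Vec.map toℕ X))) (words (allFin b) n))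
         (S.trans (S.sym (⊛-sumOverˢ (z ^ˢ toℕ x) (λ X → z ^ˢ Vec.sum (Vec.map toℕ X)) (words (allFin b) n))) (S.*-congˡ {z ^ˢ toℕ x} (sum-words b n)))) ⟩
  sumˢ (λ (x : Fin b) → z ^ˢ toℕ x ⊛ geom z b ^ˢ n)
    ≈⟨ ⊛-distribʳ-sumˢ (geom z b ^ˢ n) (λ (x : Fin b) → z ^ˢ toℕ x) ⟨
  sumˢ (λ (x : Fin b) → z ^ˢ toℕ x) ⊛ geom z b ^ˢ n
    ≈⟨ S.*-congʳ {geom z b ^ˢ n} (sum-z^ b) ⟩
  geom z b ^ˢ suc n ∎
  where open ≈ˢ-Reasoning

-- If f is the generating function of a starting carry, then step n B f is that of the
-- next carry when n numbers are added in base B, weighted by the Bⁿ digit columns.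
step : ℕ → ℕ → Series → Series
step n B f = dil B (geom z B ^ˢ suc n ⊛ f)

module _ (n : ℕ) where

  step-cong : ∀ B .{{_ : ℕ.NonZero B}} {f g} → f ≈ˢ g → step n B f ≈ˢ step n B g
  step-cong B eq = dil-cong B (S.*-congˡ {geom z B ^ˢ suc n} eq)

  step-sumOver : ∀ B .{{_ : ℕ.NonZero B}} {A : Set} (f : A → Series) xs →
    step n B (sumOverˢ f xs) ≈ˢ sumOverˢ (step n B ∘ f) xs
  step-sumOver B = sumOverˢ-homo (step n B) (dil-cong B (S.zeroʳ (geom z B ^ˢ suc n)))
    (λ f g → dil-cong B (S.distribˡ (geom z B ^ˢ suc n) f g))

  -- The outer factor `geom z B` passes through `dil b` and becomes `geom (z ^ˢ b) B`, which
  -- `geom-*` merges with `geom z b` into the digit polynomial of base B b.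
  step-step : ∀ B b .{{_ : ℕ.NonZero B}} .{{_ : ℕ.NonZero b}} f → step n B (step n b f) ≈ˢ step n (B ℕ.* b) f
  step-step B b f = begin
    dil B (geom z B ^ˢ N ⊛ dil b (geom z b ^ˢ N ⊛ f))
      ≈⟨ dil-cong B (intertwines-^ b (geom (z ^ˢ b) B) (geom z B) N (intertwines-geom b B) (geom z b ^ˢ N ⊛ f)) ⟨
    dil B (dil b (geom (z ^ˢ b) B ^ˢ N ⊛ (geom z b ^ˢ N ⊛ f)))
      ≈⟨ dil-dil B b (geom (z ^ˢ b) B ^ˢ N ⊛ (geom z b ^ˢ N ⊛ f)) ⟩
    dil (B ℕ.* b) (geom (z ^ˢ b) B ^ˢ N ⊛ (geom z b ^ˢ N ⊛ f))
      ≈⟨ dil-cong (B ℕ.* b) (S.sym (S.*-assoc (geom (z ^ˢ b) B ^ˢ N) (geom z b ^ˢ N) f)) ⟩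
    dil (B ℕ.* b) (geom (z ^ˢ b) B ^ˢ N ⊛ geom z b ^ˢ N ⊛ f)
      ≈⟨ dil-cong (B ℕ.* b) (S.*-congʳ {f} (S.trans (S.sym (^ˢ-distrib-* (geom (z ^ˢ b) B) (geom z b) N))
           (^ˢ-congˡ N (S.sym (geom-* z B b))))) ⟩
    dil (B ℕ.* b) (geom z (B ℕ.* b) ^ˢ N ⊛ f) ∎
    where
    open ≈ˢ-Reasoning
    N = suc n
    instance
      B*b≢0 : ℕ.NonZero (B ℕ.* b)
      B*b≢0 = ℕ.m*n≢0 B b

  step-1 : ∀ f → step n 1 f ≈ˢ f
  step-1 f j = trans (dil-cong 1 {geom z 1 ^ˢ suc n ⊛ f} {f} (S.trans (S.*-congʳ {f} (geom-1^ (suc n))) (S.*-identityˡ f)) j)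
                     (cong f (ℕ.*-identityʳ j))
    where
    geom-1^ : ∀ k → geom z 1 ^ˢ k ≈ˢ 1ˢ
    geom-1^ zero    = S.refl
    geom-1^ (suc k) = S.trans (S.*-cong (S.trans (S.+-congˡ {1ˢ} (S.zeroʳ z)) (S.+-identityʳ 1ˢ)) (geom-1^ k)) (S.*-identityˡ 1ˢ)

  module _ (b : ℕ) .{{_ : ℕ.NonZero b}} where

    columns : List (Vec (Fin b) n)
    columns = words (allFin b) n

    -- Of the n + 1 factors `geom z b` in `step`, n generate the digits of a column and one performs
    -- the division by b through `dil-geom-z^`.
    sum-carry : ∀ κ → sumOverˢ (λ X → z ^ˢ carry b κ X) columns ≈ˢ step n b (z ^ˢ κ)
    sum-carry κ = begin
      sumOverˢ (λ X → z ^ˢ carry b κ X) columns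
        ≈⟨ sumOverˢ-cong (λ X → dil-geom-z^ b (κ ℕ.+ digits X)) columns ⟨
      sumOverˢ (λ X → dil b (geom z b ⊛ z ^ˢ (κ ℕ.+ digits X))) columns
        ≈⟨ sumOverˢ-homo (dil b) S.refl (λ _ _ → S.refl) (λ X → geom z b ⊛ z ^ˢ (κ ℕ.+ digits X)) columns ⟨
      dil b (sumOverˢ (λ X → geom z b ⊛ z ^ˢ (κ ℕ.+ digits X)) columns)
        ≈⟨ dil-cong b (begin
             sumOverˢ (λ X → geom z b ⊛ z ^ˢ (κ ℕ.+ digits X)) columns
               ≈⟨ sumOverˢ-cong (λ X → S.trans (S.*-congˡ {geom z b} (^ˢ-homo-* z κ (digits X)))
                    (S.sym (S.*-assoc (geom z b) (z ^ˢ κ) (z ^ˢ digits X)))) columns ⟩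
             sumOverˢ (λ X → geom z b ⊛ z ^ˢ κ ⊛ z ^ˢ digits X) columns
               ≈⟨ ⊛-sumOverˢ (geom z b ⊛ z ^ˢ κ) (λ X → z ^ˢ digits X) columns ⟨
             geom z b ⊛ z ^ˢ κ ⊛ sumOverˢ (λ X → z ^ˢ digits X) columns
               ≈⟨ S.*-congˡ {geom z b ⊛ z ^ˢ κ} (sum-words b n) ⟩
             geom z b ⊛ z ^ˢ κ ⊛ geom z b ^ˢ n
               ≈⟨ solveˢ 3 (λ g k h → g :*ˢ k :*ˢ h :=ˢ g :*ˢ h :*ˢ k) (λ _ → refl) (geom z b) (z ^ˢ κ) (geom z b ^ˢ n) ⟩
             geom z b ^ˢ suc n ⊛ z ^ˢ κ ∎) ⟩
      step n b (z ^ˢ κ) ∎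
      where
      open ≈ˢ-Reasoning
      digits : Vec (Fin b) n → ℕ
      digits X = Vec.sum (Vec.map toℕ X)

    -- The induction runs over all starting carries because `foldl′` consumes the first row of
    -- digits first and continues from the carry that it produces.
    sum-carries : ∀ r κ → sumOverˢ (λ X → z ^ˢ Vec.foldl′ (carry b) κ X) (words columns r) ≈ˢ step n (b ℕ.^ r) (z ^ˢ κ)
    sum-carries zero    κ = S.trans (S.+-identityʳ (z ^ˢ κ)) (S.sym (step-1 (z ^ˢ κ)))
    sum-carries (suc r) κ = begin
      sumOverˢ (λ X → z ^ˢ Vec.foldl′ (carry b) κ X) (words columns (suc r))
        ≈⟨ sumOverˢ-cartesianProductWith (λ X → z ^ˢ Vec.foldl′ (carry b) κ X) _∷_ columns (words columns r) ⟩
      sumOverˢ (λ X → sumOverˢ (λ Xs → z ^ˢ Vec.foldl′ (carry b) (carry b κ X) Xs) (words columns r)) columns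
        ≈⟨ sumOverˢ-cong (λ X → sum-carries r (carry b κ X)) columns ⟩
      sumOverˢ (λ X → step n (b ℕ.^ r) (z ^ˢ carry b κ X)) columns
        ≈⟨ step-sumOver (b ℕ.^ r) (λ X → z ^ˢ carry b κ X) columns ⟨
      step n (b ℕ.^ r) (sumOverˢ (λ X → z ^ˢ carry b κ X) columns)
        ≈⟨ step-cong (b ℕ.^ r) (sum-carry κ) ⟩
      step n (b ℕ.^ r) (step n b (z ^ˢ κ))
        ≈⟨ step-step (b ℕ.^ r) b (z ^ˢ κ) ⟩
      step n (b ℕ.^ r ℕ.* b) (z ^ˢ κ)
        ≡⟨ cong (λ B → step n B (z ^ˢ κ)) (ℕ.*-comm (b ℕ.^ r) b) ⟩
      step n (b ℕ.^ suc r) (z ^ˢ κ) ∎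
      where
      open ≈ˢ-Reasoning
      instance
        b^r≢0 : ℕ.NonZero (b ℕ.^ r)
        b^r≢0 = ℕ.m^n≢0 b r

-- The descent generating function

-- Used for k ≤ n only, since ∸ truncates.
powers : ℕ → ℕ → Series
powers n k x = ι (x ℕ.^ k ℕ.* suc x ℕ.^ (n ℕ.∸ k))

-- Because (x + 1) - x = 1. In this form sums over the first letter of a permutation telescope.
powers-difference : ∀ {n k} → k ℕ.≤ n → powers n k ≈ˢ powers (suc n) k ⊖ powers (suc n) (suc k)
powers-difference {n} {k} k≤n x = begin
  ι (a ℕ.* c)                               ≡⟨ solve 2 (λ u v → u := u :+ v :- v) refl (ι (a ℕ.* c)) (ι (x ℕ.* a ℕ.* c)) ⟩
  ι (a ℕ.* c) + ι (x ℕ.* a ℕ.* c) - ι (x ℕ.* a ℕ.* c)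
    ≡⟨ cong (_- ι (x ℕ.* a ℕ.* c)) (ι-+ (a ℕ.* c) (x ℕ.* a ℕ.* c)) ⟨
  ι (a ℕ.* c ℕ.+ x ℕ.* a ℕ.* c) - ι (x ℕ.* a ℕ.* c)
    ≡⟨ cong (λ m → ι m - ι (x ℕ.* a ℕ.* c))
         (ℕS.solve 3 (λ x a c → a ℕS.:* c ℕS.:+ x ℕS.:* a ℕS.:* c ℕS.:= a ℕS.:* ((ℕS.con 1 ℕS.:+ x) ℕS.:* c)) refl x a c) ⟩
  ι (a ℕ.* suc x ℕ.^ suc (n ℕ.∸ k)) - ι (x ℕ.* a ℕ.* c)
    ≡⟨ cong (λ m → ι (a ℕ.* suc x ℕ.^ m) - ι (x ℕ.* a ℕ.* c)) (ℕ.+-∸-assoc 1 k≤n) ⟨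
  powers (suc n) k x - powers (suc n) (suc k) x ∎
  where
  open ≡-Reasoning
  a = x ℕ.^ k
  c = suc x ℕ.^ (n ℕ.∸ k)

-- The shift by one index turns (x + 1)ⁿ⁺¹ into xⁿ⁺¹; at index 0 both sides vanish because the
-- exponent is positive.
z-⊛-powers : ∀ n → z ⊛ powers (suc n) 0 ≈ˢ powers (suc n) (suc n)
z-⊛-powers n zero    = z-⊛-zero (powers (suc n) 0)
z-⊛-powers n (suc x) = trans (z-⊛-suc (powers (suc n) 0) x) (cong ι (begin
  1 ℕ.* suc x ℕ.^ suc n                          ≡⟨ ℕ.*-comm 1 (suc x ℕ.^ suc n) ⟩
  suc x ℕ.^ suc n ℕ.* 1                          ≡⟨ cong (λ m → suc x ℕ.^ suc n ℕ.* suc (suc x) ℕ.^ m) (ℕ.n∸n≡0 (suc n)) ⟨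
  suc x ℕ.^ suc n ℕ.* suc (suc x) ℕ.^ (n ℕ.∸ n)  ∎))
  where open ≡-Reasoning

telescope : ∀ m (t : ℕ → Series) → sumˢ (λ (l : Fin m) → t (toℕ l) ⊖ t (suc (toℕ l))) ≈ˢ t 0 ⊖ t m
telescope zero    t = S.sym (S.-‿inverseʳ (t 0))
telescope (suc m) t = S.trans (S.+-congˡ {t 0 ⊖ t 1} (telescope m (t ∘ suc)))
  (solveˢ 3 (λ a b c → (a :-ˢ b) :+ˢ (b :-ˢ c) :=ˢ a :-ˢ c) (λ _ → refl) (t 0) (t 1) (t (suc m)))

telescope-Below : ∀ m (k : Fin (suc m)) (t : ℕ → Series) →
  sumˢ (λ (l : Fin m) → z ^ˢ Below l k ⊛ (t (toℕ l) ⊖ t (suc (toℕ l)))) ≈ˢ z ⊛ (t 0 ⊖ t (toℕ k)) ⊕ (t (toℕ k) ⊖ t m)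
telescope-Below m Fin.zero t = S.trans (sumˢ-cong {m} (λ l → S.*-identityˡ (t (toℕ l) ⊖ t (suc (toℕ l)))))
  (S.trans (telescope m t) (S.sym (S.trans (S.+-congʳ {t 0 ⊖ t m} (S.trans (S.*-congˡ {z} (S.-‿inverseʳ (t 0))) (S.zeroʳ z)))
    (S.+-identityˡ (t 0 ⊖ t m)))))
telescope-Below (suc m) (Fin.suc k) t = S.trans
  (S.+-cong (S.*-congʳ {t 0 ⊖ t 1} (S.*-identityʳ z)) (telescope-Below m k (t ∘ suc)))
  (solveˢ 5 (λ z a b c d → z :*ˢ (a :-ˢ b) :+ˢ (z :*ˢ (b :-ˢ c) :+ˢ (c :-ˢ d)) :=ˢ z :*ˢ (a :-ˢ c) :+ˢ (c :-ˢ d)) (λ _ → refl)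
    z (t 0) (t 1) (t (suc (toℕ k))) (t (suc m)))

-- Refines the closed form of the descent series by the first letter. In the induction the second
-- letters l < k carry a factor z, and both ranges of l telescope to z (t 0 - t k) + (t k - t (n +
-- 1)). By `z-⊛-powers` the two end terms cancel, which leaves (1 - z) t k, the next power of 1 - z.
sumFrom-z^ : ∀ n k → sumFromˢ n k (z ^ˢ_) ≈ˢ (1ˢ ⊖ z) ^ˢ suc n ⊛ powers n (toℕ k)
sumFrom-z^ zero    Fin.zero = S.trans (S.+-identityʳ 1ˢ) (S.sym (S.trans
  (S.*-congʳ {ones} (S.*-identityʳ (1ˢ ⊖ z))) [1-z]ones))
sumFrom-z^ (suc n) k = begin
  sumFromˢ (suc n) k (z ^ˢ_)
    ≈⟨ sumFromˢ-suc n k (z ^ˢ_) ⟩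
  sumˢ (λ (l : Fin (suc n)) → sumFromˢ n l (λ d → z ^ˢ (Below l k ℕ.+ d)))
    ≈⟨ sumˢ-cong {suc n} (λ l → begin
         sumFromˢ n l (λ d → z ^ˢ (Below l k ℕ.+ d))
           ≈⟨ sumOverˢ-cong (λ w → ^ˢ-homo-* z (Below l k) (descents (l ∷ Vec.map (punchIn l) w))) (permutations n) ⟩
         sumFromˢ n l (λ d → z ^ˢ Below l k ⊛ z ^ˢ d)
           ≈⟨ ⊛-sumOverˢ (z ^ˢ Below l k) (λ w → z ^ˢ descents (l ∷ Vec.map (punchIn l) w)) (permutations n) ⟨
         z ^ˢ Below l k ⊛ sumFromˢ n l (z ^ˢ_)
           ≈⟨ S.*-congˡ {z ^ˢ Below l k} (S.trans (sumFrom-z^ n l)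
                (S.*-congˡ {u} (powers-difference (ℕ.s≤s⁻¹ (Fin.toℕ<n l))))) ⟩
         z ^ˢ Below l k ⊛ (u ⊛ (t (toℕ l) ⊖ t (suc (toℕ l))))
           ≈⟨ solveˢ 3 (λ a b c → a :*ˢ (b :*ˢ c) :=ˢ b :*ˢ (a :*ˢ c)) (λ _ → refl) (z ^ˢ Below l k) u (t (toℕ l) ⊖ t (suc (toℕ l))) ⟩
         u ⊛ (z ^ˢ Below l k ⊛ (t (toℕ l) ⊖ t (suc (toℕ l)))) ∎) ⟩
  sumˢ (λ (l : Fin (suc n)) → u ⊛ (z ^ˢ Below l k ⊛ (t (toℕ l) ⊖ t (suc (toℕ l)))))
    ≈⟨ ⊛-distribˡ-sumˢ u (λ (l : Fin (suc n)) → z ^ˢ Below l k ⊛ (t (toℕ l) ⊖ t (suc (toℕ l)))) ⟨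
  u ⊛ sumˢ (λ (l : Fin (suc n)) → z ^ˢ Below l k ⊛ (t (toℕ l) ⊖ t (suc (toℕ l))))
    ≈⟨ S.*-congˡ {u} (telescope-Below (suc n) k t) ⟩
  u ⊛ (z ⊛ (t 0 ⊖ t (toℕ k)) ⊕ (t (toℕ k) ⊖ t (suc n)))
    ≈⟨ solveˢ 5 (λ u z a b c → u :*ˢ (z :*ˢ (a :-ˢ b) :+ˢ (b :-ˢ c)) :=ˢ u :*ˢ ((conˢ 1ℚ :-ˢ z) :*ˢ b :+ˢ (z :*ˢ a :-ˢ c))) (λ _ → refl)
         u z (t 0) (t (toℕ k)) (t (suc n)) ⟩
  u ⊛ ((1ˢ ⊖ z) ⊛ t (toℕ k) ⊕ (z ⊛ t 0 ⊖ t (suc n)))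
    ≈⟨ S.*-congˡ {u} (S.trans (S.+-congˡ {(1ˢ ⊖ z) ⊛ t (toℕ k)} (S.trans (S.+-congʳ {S.- t (suc n)} (z-⊛-powers n)) (S.-‿inverseʳ (t (suc n)))))
         (S.+-identityʳ ((1ˢ ⊖ z) ⊛ t (toℕ k)))) ⟩
  u ⊛ ((1ˢ ⊖ z) ⊛ t (toℕ k))
    ≈⟨ solveˢ 3 (λ u w b → u :*ˢ (w :*ˢ b) :=ˢ w :*ˢ u :*ˢ b) (λ _ → refl) u (1ˢ ⊖ z) (t (toℕ k)) ⟩
  (1ˢ ⊖ z) ^ˢ suc (suc n) ⊛ t (toℕ k) ∎
  where
  open ≈ˢ-Reasoning
  u = (1ˢ ⊖ z) ^ˢ suc n
  t = powers (suc n)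

descentSeries : ℕ → Series
descentSeries n = sumOverˢ (λ σ → z ^ˢ descents σ) (permutations n)

-- Worpitzky's identity as a generating function. Summing the refined identity over the first letter
-- telescopes once more, and `z-⊛-powers` turns the far end into z times the near one.
descentSeries-closed : ∀ n → descentSeries (suc n) ≈ˢ (1ˢ ⊖ z) ^ˢ suc (suc n) ⊛ powers (suc n) 0
descentSeries-closed n = begin
  descentSeries (suc n)
    ≈⟨ sumOverˢ-descents n (z ^ˢ_) ⟩
  sumˢ (λ (k : Fin (suc n)) → sumFromˢ n k (z ^ˢ_))
    ≈⟨ sumˢ-cong {suc n} (λ k → S.trans (sumFrom-z^ n k) (S.*-congˡ {u} (powers-difference (ℕ.s≤s⁻¹ (Fin.toℕ<n k))))) ⟩
  sumˢ (λ (k : Fin (suc n)) → u ⊛ (t (toℕ k) ⊖ t (suc (toℕ k))))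
    ≈⟨ ⊛-distribˡ-sumˢ u (λ (k : Fin (suc n)) → t (toℕ k) ⊖ t (suc (toℕ k))) ⟨
  u ⊛ sumˢ (λ (k : Fin (suc n)) → t (toℕ k) ⊖ t (suc (toℕ k)))
    ≈⟨ S.*-congˡ {u} (S.trans (telescope (suc n) t) (S.+-congˡ {t 0} (S.-‿cong (S.sym (z-⊛-powers n))))) ⟩
  u ⊛ (t 0 ⊖ z ⊛ t 0)
    ≈⟨ solveˢ 3 (λ u z a → u :*ˢ (a :-ˢ z :*ˢ a) :=ˢ (conˢ 1ℚ :-ˢ z) :*ˢ u :*ˢ a) (λ _ → refl) u z (t 0) ⟩
  (1ˢ ⊖ z) ^ˢ suc (suc n) ⊛ t 0 ∎
  where
  open ≈ˢ-Reasoning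
  u = (1ˢ ⊖ z) ^ˢ suc n
  t = powers (suc n)

-- The Eulerian distribution is stationary, up to the weight of step.
step-descentSeries : ∀ n B .{{_ : ℕ.NonZero B}} →
  step (suc n) B (descentSeries (suc n)) ≈ˢ constant (ι (B ℕ.^ suc n)) ⊛ descentSeries (suc n)
step-descentSeries n B = begin
  dil B (geom z B ^ˢ N ⊛ descentSeries (suc n))
    ≈⟨ dil-cong B (begin
         geom z B ^ˢ N ⊛ descentSeries (suc n)          ≈⟨ S.*-congˡ {geom z B ^ˢ N} (descentSeries-closed n) ⟩
         geom z B ^ˢ N ⊛ ((1ˢ ⊖ z) ^ˢ N ⊛ h)            ≈⟨ solveˢ 3 (λ a b c → a :*ˢ (b :*ˢ c) :=ˢ b :*ˢ a :*ˢ c) (λ _ → refl) (geom z B ^ˢ N) ((1ˢ ⊖ z) ^ˢ N) h ⟩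
         (1ˢ ⊖ z) ^ˢ N ⊛ geom z B ^ˢ N ⊛ h              ≈⟨ S.*-congʳ {h} (^ˢ-distrib-* (1ˢ ⊖ z) (geom z B) N) ⟨
         ((1ˢ ⊖ z) ⊛ geom z B) ^ˢ N ⊛ h                 ≈⟨ S.*-congʳ {h} (^ˢ-congˡ N ([1-q]geom z B)) ⟩
         (1ˢ ⊖ z ^ˢ B) ^ˢ N ⊛ h                         ∎) ⟩
  dil B ((1ˢ ⊖ z ^ˢ B) ^ˢ N ⊛ h)
    ≈⟨ intertwines-^ B (1ˢ ⊖ z ^ˢ B) (1ˢ ⊖ z) N (intertwines-1-z B) h ⟩
  (1ˢ ⊖ z) ^ˢ N ⊛ dil B h
    ≈⟨ S.*-congˡ {(1ˢ ⊖ z) ^ˢ N} dil-h ⟩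
  (1ˢ ⊖ z) ^ˢ N ⊛ (constant (ι (B ℕ.^ suc n)) ⊛ h)
    ≈⟨ solveˢ 3 (λ a b c → a :*ˢ (b :*ˢ c) :=ˢ b :*ˢ (a :*ˢ c)) (λ _ → refl) ((1ˢ ⊖ z) ^ˢ N) (constant (ι (B ℕ.^ suc n))) h ⟩
  constant (ι (B ℕ.^ suc n)) ⊛ ((1ˢ ⊖ z) ^ˢ N ⊛ h)
    ≈⟨ S.*-congˡ {constant (ι (B ℕ.^ suc n))} (descentSeries-closed n) ⟨
  constant (ι (B ℕ.^ suc n)) ⊛ descentSeries (suc n) ∎
  where
  open ≈ˢ-Reasoning
  N = suc (suc n)
  h = powers (suc n) 0
  -- The extracted index B - 1 + j B has successor B (j + 1), and the coefficients of `h` are powers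
  -- of the successor; this produces the factor Bⁿ⁺¹.
  dil-h : dil B h ≈ˢ constant (ι (B ℕ.^ suc n)) ⊛ h
  dil-h j = trans (cong ι (trans (ℕ.*-identityˡ _) (trans (cong (ℕ._^ suc n)
      (trans (cong (ℕ._+ j ℕ.* B) (ℕ.suc-pred B)) (ℕ.*-comm (suc j) B)))
      (trans (ℕ-^-distrib-* B (suc j) (suc n)) (cong (B ℕ.^ suc n ℕ.*_) (sym (ℕ.*-identityˡ _)))))))
    (trans (ι-* (B ℕ.^ suc n) (1 ℕ.* suc j ℕ.^ suc n)) (sym (constant-⊛ (ι (B ℕ.^ suc n)) h j)))

-- The mean number of descents

sum-const : ∀ m p → sum {m} (λ _ → p) ≡ ι m * p
sum-const zero    p = sym (ℚ.*-zeroˡ p)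
sum-const (suc m) p = trans (cong (p +_) (sum-const m p)) (sym (trans (cong (_* p) (ι-+ 1 m))
  (solve 2 (λ m p → (con 1ℚ :+ m) :* p := p :+ m :* p) refl (ι m) p)))

sum-Below : ∀ m (k : Fin (suc m)) → sum {m} (λ l → ι (Below l k)) ≡ ι (toℕ k)
sum-Below zero    Fin.zero    = refl
sum-Below (suc m) Fin.zero    = trans (ℚ.+-identityˡ _) (sum-Below m Fin.zero)
sum-Below (suc m) (Fin.suc k) = trans (cong (1ℚ +_) (sum-Below m k)) (sym (ι-+ 1 (toℕ k)))

sum-toℕ : ∀ m → ι 2 * sum {m} (λ k → ι (toℕ k)) ≡ ι m * (ι m - 1ℚ)
sum-toℕ zero    = refl
sum-toℕ (suc m) = begin
  ι 2 * (0ℚ + sum {m} (λ k → ι (suc (toℕ k))))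
    ≡⟨ cong (λ s → ι 2 * (0ℚ + s)) (trans (sum-cong-≗ {m} (λ k → ι-+ 1 (toℕ k))) (trans (∑-distrib-+ {m} (λ _ → 1ℚ) (λ k → ι (toℕ k))) (cong (_+ s) (sum-const m 1ℚ)))) ⟩
  ι 2 * (0ℚ + (ι m * 1ℚ + s))
    ≡⟨ solve 2 (λ m s → con (ι 2) :* (con 0ℚ :+ (m :* con 1ℚ :+ s)) := con (ι 2) :* m :+ con (ι 2) :* s) refl (ι m) s ⟩
  ι 2 * ι m + ι 2 * s
    ≡⟨ cong (ι 2 * ι m +_) (sum-toℕ m) ⟩
  ι 2 * ι m + ι m * (ι m - 1ℚ)
    ≡⟨ solve 1 (λ m → con (ι 2) :* m :+ m :* (m :- con 1ℚ) := (con 1ℚ :+ m) :* ((con 1ℚ :+ m) :- con 1ℚ)) refl (ι m) ⟩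
  (1ℚ + ι m) * ((1ℚ + ι m) - 1ℚ)
    ≡⟨ cong (λ p → p * (p - 1ℚ)) (ι-+ 1 m) ⟨
  ι (suc m) * (ι (suc m) - 1ℚ) ∎
  where
  open ≡-Reasoning
  s = sum {m} (λ k → ι (toℕ k))

sum-permutations-1 : ∀ n → sumOver (λ _ → 1ℚ) (permutations n) ≡ ι (n !)
sum-permutations-1 zero    = refl
sum-permutations-1 (suc n) = begin
  sumOver (λ _ → 1ℚ) (permutations (suc n))        ≡⟨ sumOver-descents n (λ _ → 1ℚ) ⟩
  sum {suc n} (λ k → sumFrom n k (λ _ → 1ℚ))       ≡⟨ sum-cong-≗ {suc n} (λ _ → sum-permutations-1 n) ⟩
  sum {suc n} (λ _ → ι (n !))                      ≡⟨ sum-const (suc n) (ι (n !)) ⟩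
  ι (suc n) * ι (n !)                              ≡⟨ ι-* (suc n) (n !) ⟨
  ι (suc n !)                                      ∎
  where open ≡-Reasoning

totalDescents : ℕ → ℚ
totalDescents n = sumOver (λ σ → ι (descents σ)) (permutations n)

-- With first letter k, the first position is a descent for k choices of the second letter, each
-- completed in n! ways; the remaining positions see every shorter permutation once.
totalDescents-suc : ∀ n → totalDescents (suc (suc n)) ≡
  sum {suc (suc n)} (λ k → ι (toℕ k)) * ι (n !) + ι (suc (suc n)) * totalDescents (suc n)
totalDescents-suc n = begin
  totalDescents (suc (suc n))
    ≡⟨ sumOver-descents (suc n) ι ⟩
  sum {suc (suc n)} (λ k → sumFrom (suc n) k ι)
    ≡⟨ sum-cong-≗ {suc (suc n)} inner ⟩
  sum {suc (suc n)} (λ k → ι (n !) * ι (toℕ k) + totalDescents (suc n))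
    ≡⟨ ∑-distrib-+ {suc (suc n)} (λ k → ι (n !) * ι (toℕ k)) (λ _ → totalDescents (suc n)) ⟩
  sum {suc (suc n)} (λ k → ι (n !) * ι (toℕ k)) + sum {suc (suc n)} (λ _ → totalDescents (suc n))
    ≡⟨ cong₂ _+_ (trans (sym (*-distribˡ-sum {suc (suc n)} (ι (n !)) (λ k → ι (toℕ k)))) (ℚ.*-comm (ι (n !)) _)) (sum-const (suc (suc n)) (totalDescents (suc n))) ⟩
  sum {suc (suc n)} (λ k → ι (toℕ k)) * ι (n !) + ι (suc (suc n)) * totalDescents (suc n) ∎
  where
  open ≡-Reasoning
  inner : ∀ k → sumFrom (suc n) k ι ≡ ι (n !) * ι (toℕ k) + totalDescents (suc n)
  inner k = begin
    sumFrom (suc n) k ι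
      ≡⟨ sumFrom-suc n k ι ⟩
    sum {suc n} (λ l → sumFrom n l (λ d → ι (Below l k ℕ.+ d)))
      ≡⟨ sum-cong-≗ {suc n} (λ l → begin
           sumFrom n l (λ d → ι (Below l k ℕ.+ d))
             ≡⟨ sumOver-cong (λ w → trans (ι-+ (Below l k) (descents (l ∷ Vec.map (punchIn l) w)))
                  (cong (_+ ι (descents (l ∷ Vec.map (punchIn l) w))) (sym (ℚ.*-identityʳ (ι (Below l k)))))) (permutations n) ⟩
           sumFrom n l (λ d → ι (Below l k) * 1ℚ + ι d)
             ≡⟨ sumOver-∙ (λ _ → ι (Below l k) * 1ℚ) (λ w → ι (descents (l ∷ Vec.map (punchIn l) w))) (permutations n) ⟩
           sumOver (λ _ → ι (Below l k) * 1ℚ) (permutations n) + sumFrom n l ι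
             ≡⟨ cong (_+ sumFrom n l ι) (trans (sym (sumOver-homo (ι (Below l k) *_) (ℚ.*-zeroʳ (ι (Below l k))) (ℚ.*-distribˡ-+ (ι (Below l k))) (λ _ → 1ℚ) (permutations n)))
                  (trans (cong (ι (Below l k) *_) (sum-permutations-1 n)) (ℚ.*-comm (ι (Below l k)) (ι (n !))))) ⟩
           ι (n !) * ι (Below l k) + sumFrom n l ι ∎) ⟩
    sum {suc n} (λ l → ι (n !) * ι (Below l k) + sumFrom n l ι)
      ≡⟨ ∑-distrib-+ {suc n} (λ l → ι (n !) * ι (Below l k)) (λ l → sumFrom n l ι) ⟩
    sum {suc n} (λ l → ι (n !) * ι (Below l k)) + sum {suc n} (λ l → sumFrom n l ι)
      ≡⟨ cong₂ _+_ (trans (sym (*-distribˡ-sum {suc n} (ι (n !)) (λ l → ι (Below l k)))) (cong (ι (n !) *_) (sum-Below (suc n) k)))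
           (sym (sumOver-descents n ι)) ⟩
    ι (n !) * ι (toℕ k) + totalDescents (suc n) ∎

-- The mean over n + 1 letters is n/2, a descent at each of the n positions having probability 1/2.
-- Doubled, so that no division occurs.
totalDescents-closed : ∀ n → ι 2 * totalDescents (suc n) ≡ ι n * ι (suc n !)
totalDescents-closed zero    = refl
totalDescents-closed (suc n) = begin
  ι 2 * totalDescents (suc (suc n))
    ≡⟨ cong (ι 2 *_) (totalDescents-suc n) ⟩
  ι 2 * (s * ι (n !) + ι (suc (suc n)) * totalDescents (suc n))
    ≡⟨ solve 4 (λ s f m t → con (ι 2) :* (s :* f :+ m :* t) := con (ι 2) :* s :* f :+ m :* (con (ι 2) :* t)) refl s (ι (n !)) (ι (suc (suc n))) (totalDescents (suc n)) ⟩
  ι 2 * s * ι (n !) + ι (suc (suc n)) * (ι 2 * totalDescents (suc n))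
    ≡⟨ cong₂ (λ p q → p * ι (n !) + ι (suc (suc n)) * q) (sum-toℕ (suc (suc n))) (totalDescents-closed n) ⟩
  ι (suc (suc n)) * (ι (suc (suc n)) - 1ℚ) * ι (n !) + ι (suc (suc n)) * (ι n * ι (suc n !))
    ≡⟨ cong₂ (λ p q → ι (suc (suc n)) * (p - 1ℚ) * ι (n !) + ι (suc (suc n)) * (ι n * q)) (ι-+ 1 (suc n)) (ι-* (suc n) (n !)) ⟩
  ι (suc (suc n)) * ((1ℚ + ι (suc n)) - 1ℚ) * ι (n !) + ι (suc (suc n)) * (ι n * (ι (suc n) * ι (n !)))
    ≡⟨ solve 4 (λ m f k n → m :* ((con 1ℚ :+ k) :- con 1ℚ) :* f :+ m :* (n :* (k :* f)) := (con 1ℚ :+ n) :* (m :* (k :* f))) refl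
         (ι (suc (suc n))) (ι (n !)) (ι (suc n)) (ι n) ⟩
  (1ℚ + ι n) * (ι (suc (suc n)) * (ι (suc n) * ι (n !)))
    ≡⟨ cong₂ _*_ (ι-+ 1 n) (trans (ι-* (suc (suc n)) (suc n !)) (cong (ι (suc (suc n)) *_) (ι-* (suc n) (n !)))) ⟨
  ι (suc n) * ι (suc (suc n) !) ∎
  where
  open ≡-Reasoning
  s = sum {suc (suc n)} (λ k → ι (toℕ k))

-- Total variation of coefficients

norm : ℕ → Series → ℚ
norm m f = sum {m} (λ i → ∣ f (toℕ i) ∣)

norm-suc : ∀ m f → norm (suc m) f ≡ norm m f + ∣ f m ∣
norm-suc zero    f = ℚ.+-comm (∣ f 0 ∣) 0ℚ
norm-suc (suc m) f = trans (cong (∣ f 0 ∣ +_) (norm-suc m (f ∘ suc))) (sym (ℚ.+-assoc (∣ f 0 ∣) (norm m (f ∘ suc)) (∣ f (suc m) ∣)))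

norm-cong : ∀ m {f g} → f ≈ˢ g → norm m f ≡ norm m g
norm-cong m eq = sum-cong-≗ {m} (λ i → cong ∣_∣ (eq (toℕ i)))

norm-⊕ : ∀ m f g → norm m (f ⊕ g) ≤ norm m f + norm m g
norm-⊕ zero    f g = ℚ.≤-refl
norm-⊕ (suc m) f g = subst (norm (suc m) (f ⊕ g) ≤_)
  (solve 4 (λ a b c d → a :+ b :+ (c :+ d) := a :+ c :+ (b :+ d)) refl (∣ f 0 ∣) (∣ g 0 ∣) (norm m (f ∘ suc)) (norm m (g ∘ suc)))
  (ℚ.+-mono-≤ (ℚ.∣p+q∣≤∣p∣+∣q∣ (f 0) (g 0)) (norm-⊕ m (f ∘ suc) (g ∘ suc)))

-- A bound on the ℓ¹ norm of the coefficients. Bounding all partial sums uniformly avoids infinite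
-- sums, and the bound survives shifts without keeping track of degrees.
record Bounded (f : Series) (V : ℚ) : Set where
  constructor mkBounded
  field norm≤ : ∀ m → norm m f ≤ V

open Bounded

bounded-cong : ∀ {f g V} → f ≈ˢ g → Bounded f V → Bounded g V
bounded-cong {f} {g} eq h = mkBounded λ m → subst (_≤ _) (norm-cong m {f} {g} eq) (norm≤ h m)

bounded-≡ : ∀ {f V W} → V ≡ W → Bounded f V → Bounded f W
bounded-≡ {f} eq = subst (Bounded f) eq

bounded-0 : Bounded 0ˢ 0ℚ
bounded-0 = mkBounded λ m → ℚ.≤-reflexive (trans (sum-const m 0ℚ) (ℚ.*-zeroʳ (ι m)))

bounded-1 : Bounded 1ˢ 1ℚ
bounded-1 = mkBounded λ where
  zero    → ℚ.<⇒≤ (ℚ.positive⁻¹ 1ℚ)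
  (suc m) → ℚ.+-monoʳ-≤ 1ℚ (norm≤ bounded-0 m)

module _ {f : Series} {V : ℚ} (f≤V : Bounded f V) where

  bounded-⊕ : ∀ {g W} → Bounded g W → Bounded (f ⊕ g) (V + W)
  bounded-⊕ {g} g≤W = mkBounded λ m → ℚ.≤-trans (norm-⊕ m f g) (ℚ.+-mono-≤ (norm≤ f≤V m) (norm≤ g≤W m))

  bounded-neg : Bounded (S.- f) V
  bounded-neg = mkBounded λ m → subst (_≤ V) (sum-cong-≗ {m} (λ i → sym (ℚ.∣-p∣≡∣p∣ (f (toℕ i))))) (norm≤ f≤V m)

  bounded-z : Bounded (z ⊛ f) V
  bounded-z = mkBounded λ where
    zero    → norm≤ f≤V 0
    (suc m) → subst (_≤ V) (sym (trans (cong₂ _+_ (cong ∣_∣ (z-⊛-zero f)) (norm-cong m (z-⊛-suc f))) (ℚ.+-identityˡ (norm m f)))) (norm≤ f≤V m)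

bounded-z^ : ∀ {f V} k → Bounded f V → Bounded (z ^ˢ k ⊛ f) V
bounded-z^ {f} zero    h = bounded-cong (S.sym (S.*-identityˡ f)) h
bounded-z^ {f} (suc k) h = bounded-cong (S.sym (S.*-assoc z (z ^ˢ k) f)) (bounded-z (bounded-z^ k h))

bounded-geom : ∀ {f V} a → Bounded f V → Bounded (geom z a ⊛ f) (ι a * V)
bounded-geom {f} {V} zero    h = bounded-≡ (sym (ℚ.*-zeroˡ V)) (bounded-cong (S.sym (S.zeroˡ f)) bounded-0)
bounded-geom {f} {V} (suc a) h = bounded-≡
  (trans (solve 2 (λ a v → v :+ a :* v := (con 1ℚ :+ a) :* v) refl (ι a) V) (cong (_* V) (sym (ι-+ 1 a))))
  (bounded-cong (solveˢ 3 (λ f z g → f :+ˢ z :*ˢ (g :*ˢ f) :=ˢ (conˢ 1ℚ :+ˢ z :*ˢ g) :*ˢ f) (λ _ → refl) f z (geom z a))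
    (bounded-⊕ h (bounded-z (bounded-geom a h))))

bounded-geom^ : ∀ B k → Bounded (geom z B ^ˢ k) (ι (B ℕ.^ k))
bounded-geom^ B zero    = bounded-1
bounded-geom^ B (suc k) = bounded-≡ (sym (ι-* B (B ℕ.^ k))) (bounded-geom B (bounded-geom^ B k))

bounded-1-z^ : ∀ {f V} k → Bounded f V → Bounded ((1ˢ ⊖ z ^ˢ k) ⊛ f) (V + V)
bounded-1-z^ {f} k h = bounded-cong (solveˢ 2 (λ f p → f :-ˢ p :*ˢ f :=ˢ (conˢ 1ℚ :-ˢ p) :*ˢ f) (λ _ → refl) f (z ^ˢ k))
  (bounded-⊕ h (bounded-neg (bounded-z^ k h)))

bounded-sumOver : ∀ {A : Set} (f : A → Series) (V : A → ℚ) → (∀ x → Bounded (f x) (V x)) →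
  ∀ xs → Bounded (sumOverˢ f xs) (sumOver V xs)
bounded-sumOver f V h []       = bounded-0
bounded-sumOver f V h (x ∷ xs) = bounded-⊕ (h x) (bounded-sumOver f V h xs)

-- The coefficient on the left is f(t) + ... + f(a + t), and these are exactly the entries that
-- `norm t f` leaves out.
geom-window : ∀ f a t → ∣ (geom z (suc a) ⊛ f) (a ℕ.+ t) ∣ + norm t f ≤ norm (suc a ℕ.+ t) f
geom-window f zero    t = ℚ.≤-reflexive (trans (cong (λ p → ∣ p ∣ + norm t f)
    (S.trans (S.*-congʳ {f} (S.trans (S.+-congˡ {1ˢ} (S.zeroʳ z)) (S.+-identityʳ 1ˢ))) (S.*-identityˡ f) t))
  (trans (ℚ.+-comm (∣ f t ∣) (norm t f)) (sym (norm-suc t f))))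
geom-window f (suc a) t = begin
  ∣ (geom z (suc (suc a)) ⊛ f) (suc a ℕ.+ t) ∣ + norm t f
    ≡⟨ cong (λ p → ∣ p ∣ + norm t f) (trans (solveˢ 3 (λ f z g → (conˢ 1ℚ :+ˢ z :*ˢ g) :*ˢ f :=ˢ f :+ˢ z :*ˢ (g :*ˢ f)) (λ _ → refl) f z (geom z (suc a)) (suc a ℕ.+ t))
         (cong (f (suc a ℕ.+ t) +_) (z-⊛-suc (geom z (suc a) ⊛ f) (a ℕ.+ t)))) ⟩
  ∣ f (suc a ℕ.+ t) + y ∣ + norm t f
    ≤⟨ ℚ.+-monoˡ-≤ (norm t f) (ℚ.∣p+q∣≤∣p∣+∣q∣ (f (suc a ℕ.+ t)) y) ⟩
  ∣ f (suc a ℕ.+ t) ∣ + ∣ y ∣ + norm t f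
    ≡⟨ solve 3 (λ a b c → a :+ b :+ c := b :+ c :+ a) refl (∣ f (suc a ℕ.+ t) ∣) (∣ y ∣) (norm t f) ⟩
  ∣ y ∣ + norm t f + ∣ f (suc a ℕ.+ t) ∣
    ≤⟨ ℚ.+-monoˡ-≤ (∣ f (suc a ℕ.+ t) ∣) (geom-window f a t) ⟩
  norm (suc a ℕ.+ t) f + ∣ f (suc a ℕ.+ t) ∣
    ≡⟨ norm-suc (suc a ℕ.+ t) f ⟨
  norm (suc (suc a) ℕ.+ t) f ∎
  where
  open ℚ.≤-Reasoning
  y = (geom z (suc a) ⊛ f) (a ℕ.+ t)

-- The coefficients on the left are sums of f over disjoint windows of length B, so the division by
-- B cannot increase an ℓ¹ distance.
norm-dil-geom : ∀ B .{{_ : ℕ.NonZero B}} f m → norm m (dil B (geom z B ⊛ f)) ≤ norm (m ℕ.* B) f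
norm-dil-geom B        f zero    = ℚ.≤-refl
norm-dil-geom B@(suc a) f (suc m) = begin
  norm (suc m) (dil B (geom z B ⊛ f))
    ≡⟨ norm-suc m (dil B (geom z B ⊛ f)) ⟩
  norm m (dil B (geom z B ⊛ f)) + y
    ≤⟨ ℚ.+-monoˡ-≤ y (norm-dil-geom B f m) ⟩
  norm (m ℕ.* B) f + y
    ≡⟨ ℚ.+-comm (norm (m ℕ.* B) f) y ⟩
  y + norm (m ℕ.* B) f
    ≤⟨ geom-window f a (m ℕ.* B) ⟩
  norm (suc m ℕ.* B) f ∎
  where
  open ℚ.≤-Reasoning
  y = ∣ (geom z B ⊛ f) (a ℕ.+ m ℕ.* B) ∣

bounded-dil-geom : ∀ B .{{_ : ℕ.NonZero B}} {f V} → Bounded f V → Bounded (dil B (geom z B ⊛ f)) V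
bounded-dil-geom B {f} h = mkBounded λ m → ℚ.≤-trans (norm-dil-geom B f m) (norm≤ h (m ℕ.* B))

-- One digit is spent on (1 - z) [B] = 1 - zᴮ, which leaves two copies of the law of the other n
-- digits, each of weight Bⁿ. Relative to the weight Bⁿ⁺¹ this is 2/B.
variation : ∀ B n → Bounded ((1ˢ ⊖ z) ⊛ geom z B ^ˢ suc n) (ι (2 ℕ.* B ℕ.^ n))
variation B n = bounded-≡
  (trans (sym (ι-+ (B ℕ.^ n) (B ℕ.^ n))) (cong (λ m → ι (B ℕ.^ n ℕ.+ m)) (sym (ℕ.+-identityʳ (B ℕ.^ n)))))
  (bounded-cong (S.trans (S.*-congʳ {geom z B ^ˢ n} (S.sym ([1-q]geom z B))) (S.*-assoc (1ˢ ⊖ z) (geom z B) (geom z B ^ˢ n)))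
    (bounded-1-z^ B (bounded-geom^ B n)))

-- Twice the largest coefficient of `geom z B ^ˢ 4`, namely (4B³ + 2B)/3. The recursion is the one
-- that the induction in `quartic` produces.
quarticBound : ℕ → ℕ
quarticBound zero    = 0
quarticBound (suc B) = 2 ℕ.* suc (B ℕ.+ B) ℕ.+ 4 ℕ.* (B ℕ.* B) ℕ.+ quarticBound B

quarticBound-closed : ∀ B → 3 ℕ.* quarticBound B ≡ 4 ℕ.* (B ℕ.* B ℕ.* B) ℕ.+ 2 ℕ.* B
quarticBound-closed zero    = refl
quarticBound-closed (suc B) = trans (ℕ.*-distribˡ-+ 3 (2 ℕ.* suc (B ℕ.+ B) ℕ.+ 4 ℕ.* (B ℕ.* B)) (quarticBound B))
  (trans (cong (3 ℕ.* (2 ℕ.* suc (B ℕ.+ B) ℕ.+ 4 ℕ.* (B ℕ.* B)) ℕ.+_) (quarticBound-closed B))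
    (ℕS.solve 1 (λ B → ℕS.con 3 ℕS.:* (ℕS.con 2 ℕS.:* (ℕS.con 1 ℕS.:+ (B ℕS.:+ B)) ℕS.:+ ℕS.con 4 ℕS.:* (B ℕS.:* B)) ℕS.:+
        (ℕS.con 4 ℕS.:* (B ℕS.:* B ℕS.:* B) ℕS.:+ ℕS.con 2 ℕS.:* B) ℕS.:=
        ℕS.con 4 ℕS.:* ((ℕS.con 1 ℕS.:+ B) ℕS.:* (ℕS.con 1 ℕS.:+ B) ℕS.:* (ℕS.con 1 ℕS.:+ B)) ℕS.:+ ℕS.con 2 ℕS.:* (ℕS.con 1 ℕS.:+ B))
      refl B))

-- [B + 1]² = [2B + 1] + z [B]² with [a] = geom z a, and (1 - z)[2B + 1] = 1 - z²ᴮ⁺¹.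
quartic : ∀ B → Bounded ((1ˢ ⊖ z) ⊛ (geom z B ⊛ geom z B ⊛ (geom z B ⊛ geom z B))) (ι (quarticBound B))
quartic zero    = bounded-cong (S.sym (S.trans (S.*-congˡ {1ˢ ⊖ z} (S.trans (S.*-congʳ {0ˢ ⊛ 0ˢ} (S.zeroˡ 0ˢ)) (S.zeroˡ (0ˢ ⊛ 0ˢ)))) (S.zeroʳ (1ˢ ⊖ z)))) bounded-0
quartic (suc B) = bounded-≡ value (bounded-cong identity
    (bounded-⊕ (bounded-1-z^ c (bounded-cong (S.*-identityʳ (geom z c)) (bounded-geom c bounded-1)))
      (bounded-⊕ (bounded-⊕ (bounded-z mixed) (bounded-z mixed)) (bounded-z (bounded-z (quartic B))))))
  where
  c = suc (B ℕ.+ B)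
  g = geom z B
  g′ = geom z (suc B)
  mixed : Bounded ((1ˢ ⊖ z ^ˢ c) ⊛ (g ⊛ g)) (ι B * ι B + ι B * ι B)
  mixed = bounded-1-z^ c (bounded-geom B (bounded-≡ (ℚ.*-identityʳ (ι B)) (bounded-cong (S.*-identityʳ g) (bounded-geom B bounded-1))))
  value : ι c * 1ℚ + ι c * 1ℚ + ((ι B * ι B + ι B * ι B) + (ι B * ι B + ι B * ι B) + ι (quarticBound B)) ≡ ι (quarticBound (suc B))
  value = trans (solve 3 (λ c b q → c :* con 1ℚ :+ c :* con 1ℚ :+ ((b :* b :+ b :* b) :+ (b :* b :+ b :* b) :+ q) :=
      con (ι 2) :* c :+ con (ι 4) :* (b :* b) :+ q) refl (ι c) (ι B) (ι (quarticBound B)))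
    (sym (trans (ι-+ (2 ℕ.* c ℕ.+ 4 ℕ.* (B ℕ.* B)) (quarticBound B)) (cong (_+ ι (quarticBound B))
      (trans (ι-+ (2 ℕ.* c) (4 ℕ.* (B ℕ.* B))) (cong₂ _+_ (ι-* 2 c) (trans (ι-* 4 (B ℕ.* B)) (cong (ι 4 *_) (ι-* B B))))))))
  identity : (1ˢ ⊖ z ^ˢ c) ⊛ geom z c ⊕ (z ⊛ ((1ˢ ⊖ z ^ˢ c) ⊛ (g ⊛ g)) ⊕ z ⊛ ((1ˢ ⊖ z ^ˢ c) ⊛ (g ⊛ g)) ⊕ z ⊛ (z ⊛ ((1ˢ ⊖ z) ⊛ (g ⊛ g ⊛ (g ⊛ g)))))
             ≈ˢ (1ˢ ⊖ z) ⊛ (g′ ⊛ g′ ⊛ (g′ ⊛ g′))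
  identity = begin
    p ⊛ u ⊕ (z ⊛ (p ⊛ (g ⊛ g)) ⊕ z ⊛ (p ⊛ (g ⊛ g)) ⊕ z ⊛ (z ⊛ ((1ˢ ⊖ z) ⊛ (g ⊛ g ⊛ (g ⊛ g)))))
      ≈⟨ S.+-cong (S.*-congʳ {u} p≈) (S.+-congʳ {z ⊛ (z ⊛ ((1ˢ ⊖ z) ⊛ (g ⊛ g ⊛ (g ⊛ g))))} (S.+-cong zp zp)) ⟩
    (1ˢ ⊖ z) ⊛ u ⊛ u ⊕ (z ⊛ ((1ˢ ⊖ z) ⊛ u ⊛ (g ⊛ g)) ⊕ z ⊛ ((1ˢ ⊖ z) ⊛ u ⊛ (g ⊛ g)) ⊕ z ⊛ (z ⊛ ((1ˢ ⊖ z) ⊛ (g ⊛ g ⊛ (g ⊛ g)))))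
      ≈⟨ solveˢ 4 (λ e z u s → e :*ˢ u :*ˢ u :+ˢ (z :*ˢ (e :*ˢ u :*ˢ s) :+ˢ z :*ˢ (e :*ˢ u :*ˢ s) :+ˢ z :*ˢ (z :*ˢ (e :*ˢ (s :*ˢ s)))) :=ˢ
           e :*ˢ ((u :+ˢ z :*ˢ s) :*ˢ (u :+ˢ z :*ˢ s))) (λ _ → refl) (1ˢ ⊖ z) z u (g ⊛ g) ⟩
    (1ˢ ⊖ z) ⊛ ((u ⊕ z ⊛ (g ⊛ g)) ⊛ (u ⊕ z ⊛ (g ⊛ g)))
      ≈⟨ S.*-congˡ {1ˢ ⊖ z} (S.*-cong (geom-square z B) (geom-square z B)) ⟨
    (1ˢ ⊖ z) ⊛ (g′ ⊛ g′ ⊛ (g′ ⊛ g′)) ∎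
    where
    open ≈ˢ-Reasoning
    u = geom z c
    p = 1ˢ ⊖ z ^ˢ c
    p≈ : p ≈ˢ (1ˢ ⊖ z) ⊛ u
    p≈ = S.sym ([1-q]geom z c)
    zp : z ⊛ (p ⊛ (g ⊛ g)) ≈ˢ z ⊛ ((1ˢ ⊖ z) ⊛ u ⊛ (g ⊛ g))
    zp = S.*-congˡ {z} (S.*-congʳ {g ⊛ g} p≈)

variation₄ : ∀ B n → Bounded ((1ˢ ⊖ z) ⊛ geom z B ^ˢ (4 ℕ.+ n)) (ι (B ℕ.^ n ℕ.* quarticBound B))
variation₄ B zero    = bounded-≡ (cong ι (sym (ℕ.*-identityˡ (quarticBound B))))
  (bounded-cong (solveˢ 2 (λ e g → e :*ˢ (g :*ˢ g :*ˢ (g :*ˢ g)) :=ˢ e :*ˢ (g :*ˢ (g :*ˢ (g :*ˢ (g :*ˢ conˢ 1ℚ))))) (λ _ → refl) (1ˢ ⊖ z) (geom z B))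
    (quartic B))
variation₄ B (suc n) = bounded-≡
  (trans (sym (ι-* B (B ℕ.^ n ℕ.* quarticBound B))) (cong ι (sym (ℕ.*-assoc B (B ℕ.^ n) (quarticBound B)))))
  (bounded-cong (solveˢ 3 (λ e g h → g :*ˢ (e :*ˢ h) :=ˢ e :*ˢ (g :*ˢ h)) (λ _ → refl) (1ˢ ⊖ z) (geom z B) (geom z B ^ˢ (4 ℕ.+ n)))
    (bounded-geom B (variation₄ B n)))

-- The distance between the carries law and the Eulerian law

sum-mono : ∀ m {f g : Fin m → ℚ} → (∀ i → f i ≤ g i) → sum f ≤ sum g
sum-mono zero    le = ℚ.≤-refl
sum-mono (suc m) le = ℚ.+-mono-≤ (le Fin.zero) (sum-mono m (le ∘ Fin.suc))

ι-*-/ : ∀ l k .{{_ : ℕ.NonZero k}} → ι k * (ℤ.+ l / k) ≡ ι l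
ι-*-/ l k = trans (cong (ι k *_) (/-ι l k)) (trans (solve 3 (λ a l i → a :* (l :* i) := l :* (a :* i)) refl (ι k) (ι l) (recip k))
  (trans (cong (ι l *_) (ι-recip k)) (ℚ.*-identityʳ (ι l))))

constant-! : ∀ n → sumOverˢ (λ _ → 1ˢ) (permutations n) ≈ˢ constant (ι (n !))
constant-! n j = trans (coefficient (permutations n) j) (cong (λ p → constant p j) (sum-permutations-1 n))
  where
  coefficient : ∀ {A : Set} (xs : List A) j → sumOverˢ (λ _ → 1ˢ) xs j ≡ constant (sumOver (λ _ → 1ℚ) xs) j
  coefficient []       zero    = refl
  coefficient []       (suc j) = refl
  coefficient (x ∷ xs) zero    = cong (1ℚ +_) (coefficient xs zero)
  coefficient (x ∷ xs) (suc j) = trans (ℚ.+-identityˡ _) (coefficient xs (suc j))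

-- Each permutation contributes 1 - zᵈ, the difference between the starting carries 0 and d, written
-- as d unit differences.
!-descentSeries : ∀ n → constant (ι (n !)) ⊖ descentSeries n ≈ˢ
  sumOverˢ (λ σ → (1ˢ ⊖ z) ⊛ geom z (descents σ)) (permutations n)
!-descentSeries n = begin
  constant (ι (n !)) ⊖ descentSeries n
    ≈⟨ S.+-cong (constant-! n) (sumOverˢ-neg (λ σ → z ^ˢ descents σ) (permutations n)) ⟨
  sumOverˢ (λ _ → 1ˢ) (permutations n) ⊕ sumOverˢ (λ σ → S.- (z ^ˢ descents σ)) (permutations n)
    ≈⟨ sumOverˢ-⊕ (λ _ → 1ˢ) (λ σ → S.- (z ^ˢ descents σ)) (permutations n) ⟨
  sumOverˢ (λ σ → 1ˢ ⊖ z ^ˢ descents σ) (permutations n)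
    ≈⟨ sumOverˢ-cong (λ σ → [1-q]geom z (descents σ)) (permutations n) ⟨
  sumOverˢ (λ σ → (1ˢ ⊖ z) ⊛ geom z (descents σ)) (permutations n) ∎
  where
  open ≈ˢ-Reasoning
  sumOverˢ-neg : ∀ {A : Set} (f : A → Series) xs → sumOverˢ (S.-_ ∘ f) xs ≈ˢ S.- sumOverˢ f xs
  sumOverˢ-neg f xs = S.sym (sumOverˢ-homo S.-_ (λ _ → refl) (λ g h x → ℚ.neg-distrib-+ (g x) (h x)) f xs)

module _ (n-1 B : ℕ) .{{_ : ℕ.NonZero B}} where

  private
    n = suc n-1
    g = geom z B
    E = descentSeries n

  -- Equal to gⁿ (n! - E), the difference of the digit sums for the two starts before the division
  -- by B. The factor 1 - z is attached to gⁿ, whose variation is bounded, and the remaining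
  -- `geom z (descents σ)` costs a factor `descents σ`.
  excess : Series
  excess = sumOverˢ (λ σ → geom z (descents σ) ⊛ ((1ˢ ⊖ z) ⊛ g ^ˢ n)) (permutations n)

  -- By stationarity BⁿE is itself a step applied to E, so the left side is a step applied to n! -
  -- E. One of its n + 1 factors stays outside `excess` for the division.
  step-difference : constant (ι (n !)) ⊛ step n B 1ˢ ⊖ constant (ι (B ℕ.^ n)) ⊛ E ≈ˢ dil B (g ⊛ excess)
  step-difference = begin
    c ⊛ step n B 1ˢ ⊖ constant (ι (B ℕ.^ n)) ⊛ E
      ≈⟨ S.+-cong scale (S.-‿cong (S.sym (step-descentSeries n-1 B))) ⟩
    dil B (c ⊛ (g ^ˢ suc n ⊛ 1ˢ) ⊖ g ^ˢ suc n ⊛ E)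
      ≈⟨ dil-cong B (solveˢ 4 (λ c g h e → c :*ˢ (g :*ˢ h :*ˢ conˢ 1ℚ) :-ˢ g :*ˢ h :*ˢ e :=ˢ g :*ˢ (h :*ˢ (c :-ˢ e))) (λ _ → refl) c g (g ^ˢ n) E) ⟩
    dil B (g ⊛ (g ^ˢ n ⊛ (c ⊖ E)))
      ≈⟨ dil-cong B (S.*-congˡ {g} (S.trans (S.*-congˡ {g ^ˢ n} (!-descentSeries n))
           (S.trans (⊛-sumOverˢ (g ^ˢ n) (λ σ → (1ˢ ⊖ z) ⊛ geom z (descents σ)) (permutations n))
             (sumOverˢ-cong (λ σ → solveˢ 3 (λ h e d → h :*ˢ (e :*ˢ d) :=ˢ d :*ˢ (e :*ˢ h)) (λ _ → refl) (g ^ˢ n) (1ˢ ⊖ z) (geom z (descents σ)))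
               (permutations n))))) ⟩
    dil B (g ⊛ excess) ∎
    where
    open ≈ˢ-Reasoning
    c = constant (ι (n !))
    scale : c ⊛ step n B 1ˢ ≈ˢ dil B (c ⊛ (g ^ˢ suc n ⊛ 1ˢ))
    scale j = trans (constant-⊛ (ι (n !)) (step n B 1ˢ) j) (sym (constant-⊛ (ι (n !)) (g ^ˢ suc n ⊛ 1ˢ) (ℕ.pred B ℕ.+ j ℕ.* B)))

  bounded-excess : ∀ {V} → Bounded ((1ˢ ⊖ z) ⊛ g ^ˢ n) V → Bounded excess (totalDescents n * V)
  bounded-excess {V} h = bounded-≡ (trans (sumOver-cong (λ σ → ℚ.*-comm (ι (descents σ)) V) (permutations n))
      (trans (sym (sumOver-homo (V *_) (ℚ.*-zeroʳ V) (ℚ.*-distribˡ-+ V) (ι ∘ descents) (permutations n))) (ℚ.*-comm V (totalDescents n))))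
    (bounded-sumOver (λ σ → geom z (descents σ) ⊛ ((1ˢ ⊖ z) ⊛ g ^ˢ n)) (λ σ → ι (descents σ) * V) (λ σ → bounded-geom (descents σ) h) (permutations n))

-- Twice the total variation distance; the factor ½ returns only in the theorem.
distance : ∀ {n} → (Fin n → ℚ) → (Fin n → ℚ) → ℚ
distance P Q = sum (λ x → ∣ P x - Q x ∣)

module _ (n-1 b r : ℕ) .{{_ : NonTrivial b}} where

  private
    n = suc n-1
    B = b ℕ.^ r
    E = descentSeries n
    C = step n B 1ˢ
    K = ι (n !) * ι (B ℕ.^ n)
    instance
      b≢0 : ℕ.NonZero b
      b≢0 = ℕ.nonTrivial⇒nonZero b
      B≢0 : ℕ.NonZero B
      B≢0 = ℕ.m^n≢0 b r
      B^n≢0 : ℕ.NonZero (B ℕ.^ n)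
      B^n≢0 = ℕ.m^n≢0 B n
      b^nr≢0 : ℕ.NonZero (b ℕ.^ (n ℕ.* r))
      b^nr≢0 = ℕ.m^n≢0 b (n ℕ.* r)
      n!≢0 : ℕ.NonZero (n !)
      n!≢0 = n ℕ.!≢0

    T : ℚ
    T = distance (carriesLaw n b r) (stationary n)

  carriesLaw-coefficient : ∀ j → ι (B ℕ.^ n) * carriesLaw n b r j ≡ C (toℕ j)
  carriesLaw-coefficient j = trans (cong (λ m → ι m * carriesLaw n b r j) (trans (ℕ.^-*-assoc b r n) (cong (b ℕ.^_) (ℕ.*-comm r n))))
    (trans (ι-*-/ (length (filter (λ X → carries b X ℕ.≟ toℕ j) (words (columns n b) r))) (b ℕ.^ (n ℕ.* r)))
    (trans (ι-length-filter (carries b) (toℕ j) (words (columns n b) r)) (sum-carries n b r 0 (toℕ j))))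

  stationary-coefficient : ∀ j → ι (n !) * stationary n j ≡ E (toℕ j)
  stationary-coefficient j = trans (ι-*-/ (eulerian n (toℕ j)) (n !)) (ι-length-filter descents (toℕ j) (permutations n))

  0≤K : 0ℚ ≤ K
  0≤K = 0≤-* (ι-mono {0} {n !} ℕ.z≤n) (ι-mono {0} {B ℕ.^ n} ℕ.z≤n)

  K*distance : ∀ {V} → Bounded ((1ˢ ⊖ z) ⊛ geom z B ^ˢ n) V → K * T ≤ totalDescents n * V
  K*distance {V} h = begin
    K * T
      ≡⟨ *-distribˡ-sum {n} K (λ x → ∣ carriesLaw n b r x - stationary n x ∣) ⟩
    sum {n} (λ x → K * ∣ carriesLaw n b r x - stationary n x ∣)
      ≡⟨ sum-cong-≗ {n} (λ x → trans (cong (_* ∣ carriesLaw n b r x - stationary n x ∣) (sym (ℚ.0≤p⇒∣p∣≡p 0≤K)))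
           (trans (sym (ℚ.∣p*q∣≡∣p∣*∣q∣ K (carriesLaw n b r x - stationary n x))) (cong ∣_∣ (difference x)))) ⟩
    norm n (dil B (geom z B ⊛ excess n-1 B))
      ≤⟨ norm≤ (bounded-dil-geom B (bounded-excess n-1 B h)) n ⟩
    totalDescents n * V ∎
    where
    open ℚ.≤-Reasoning
    difference : ∀ x → K * (carriesLaw n b r x - stationary n x) ≡ dil B (geom z B ⊛ excess n-1 B) (toℕ x)
    difference x = trans (solve 4 (λ f a p q → f :* a :* (p :- q) := f :* (a :* p) :- a :* (f :* q)) refl (ι (n !)) (ι (B ℕ.^ n)) (carriesLaw n b r x) (stationary n x))
      (trans (cong₂ (λ p q → ι (n !) * p - ι (B ℕ.^ n) * q) (carriesLaw-coefficient x) (stationary-coefficient x))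
      (trans (cong₂ _-_ (sym (constant-⊛ (ι (n !)) C (toℕ x))) (sym (constant-⊛ (ι (B ℕ.^ n)) E (toℕ x))))
        (step-difference n-1 B (toℕ x))))

  distance-variation : ∀ {V} → Bounded ((1ˢ ⊖ z) ⊛ geom z B ^ˢ n) V → ι 2 * ι (B ℕ.^ n) * T ≤ ι n-1 * V
  distance-variation {V} h = ℚ.*-cancelˡ-≤-pos (ι (n !)) {{positive (0<!)}} (begin
    ι (n !) * (ι 2 * ι (B ℕ.^ n) * T)
      ≡⟨ solve 4 (λ f t a T → f :* (t :* a :* T) := t :* (f :* a :* T)) refl (ι (n !)) (ι 2) (ι (B ℕ.^ n)) T ⟩
    ι 2 * (K * T)
      ≤⟨ *-monoˡ (ι-mono {0} {2} ℕ.z≤n) (K*distance h) ⟩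
    ι 2 * (totalDescents n * V)
      ≡⟨ ℚ.*-assoc (ι 2) (totalDescents n) V ⟨
    ι 2 * totalDescents n * V
      ≡⟨ cong (_* V) (totalDescents-closed n-1) ⟩
    ι n-1 * ι (n !) * V
      ≡⟨ solve 3 (λ m f v → m :* f :* v := f :* (m :* v)) refl (ι n-1) (ι (n !)) V ⟩
    ι (n !) * (ι n-1 * V) ∎)
    where
    open ℚ.≤-Reasoning
    0<! : 0ℚ < ι (n !)
    0<! = ℚ.<-≤-trans (ℚ.positive⁻¹ 1ℚ) (ι-mono {1} {n !} (ℕ.>-nonZero⁻¹ (n !)))

  -- Each law has mass at most 1, since the unnormalized series have norms at most Bⁿ and n!.
  distance≤2 : T ≤ ι 2
  distance≤2 = begin
    sum {n} (λ x → ∣ P x - Q x ∣)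
      ≤⟨ sum-mono n (λ x → ℚ.≤-trans (ℚ.∣p+q∣≤∣p∣+∣q∣ (P x) (- Q x)) (ℚ.≤-reflexive (cong (∣ P x ∣ +_) (ℚ.∣-p∣≡∣p∣ (Q x))))) ⟩
    sum {n} (λ x → ∣ P x ∣ + ∣ Q x ∣)
      ≡⟨ ∑-distrib-+ {n} (∣_∣ ∘ P) (∣_∣ ∘ Q) ⟩
    sum {n} (∣_∣ ∘ P) + sum {n} (∣_∣ ∘ Q)
      ≤⟨ ℚ.+-mono-≤ (mass (B ℕ.^ n) P C carriesLaw-coefficient 
             (bounded-cong (dil-cong B (S.sym (S.*-identityʳ (geom z B ^ˢ suc n)))) (bounded-dil-geom B (bounded-geom^ B n))))
             (mass (n !) Q E stationary-coefficient bounded-E) ⟩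
    1ℚ + 1ℚ ∎
    where
    open ℚ.≤-Reasoning
    P = carriesLaw n b r
    Q = stationary n
    bounded-E : Bounded E (ι (n !))
    bounded-E = bounded-≡ (sum-permutations-1 n) (bounded-sumOver (λ σ → z ^ˢ descents σ) (λ _ → 1ℚ)
      (λ σ → bounded-cong (S.*-identityʳ (z ^ˢ descents σ)) (bounded-z^ (descents σ) bounded-1)) (permutations n))
    mass : ∀ k .{{_ : ℕ.NonZero k}} (p : Fin n → ℚ) F → (∀ x → ι k * p x ≡ F (toℕ x)) → Bounded F (ι k) → sum {n} (∣_∣ ∘ p) ≤ 1ℚ
    mass k p F eq h = ℚ.*-cancelˡ-≤-pos (ι k) {{positive 0<k}} (begin
      ι k * sum {n} (∣_∣ ∘ p)
        ≡⟨ *-distribˡ-sum {n} (ι k) (∣_∣ ∘ p) ⟩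
      sum {n} (λ x → ι k * ∣ p x ∣)
        ≡⟨ sum-cong-≗ {n} (λ x → trans (cong (_* ∣ p x ∣) (sym (ℚ.0≤p⇒∣p∣≡p (ℚ.<⇒≤ 0<k))))
             (trans (sym (ℚ.∣p*q∣≡∣p∣*∣q∣ (ι k) (p x))) (cong ∣_∣ (eq x)))) ⟩
      norm n F
        ≤⟨ norm≤ h n ⟩
      ι k
        ≡⟨ ℚ.*-identityʳ (ι k) ⟨
      ι k * 1ℚ ∎)
      where
      0<k : 0ℚ < ι k
      0<k = ℚ.<-≤-trans (ℚ.positive⁻¹ 1ℚ) (ι-mono {1} {k} (ℕ.>-nonZero⁻¹ k))

0≤distance : ∀ {n} (P Q : Fin n → ℚ) → 0ℚ ≤ distance P Q
0≤distance {n} P Q = subst (_≤ distance P Q) (trans (sum-const n 0ℚ) (ℚ.*-zeroʳ (ι n))) (sum-mono n (λ x → ℚ.0≤∣p∣ (P x - Q x)))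

ι-*-assoc : ∀ k l p → ι (k ℕ.* l) * p ≡ ι k * (ι l * p)
ι-*-assoc k l p = trans (cong (_* p) (ι-* k l)) (ℚ.*-assoc (ι k) (ι l) p)

0<ι-nonZero : ∀ k .{{_ : ℕ.NonZero k}} → 0ℚ < ι k
0<ι-nonZero (suc k) = 0<ι k

ι-cancelˡ-≤ : ∀ k .{{_ : ℕ.NonZero k}} {p q} → ι k * p ≤ ι k * q → p ≤ q
ι-cancelˡ-≤ k = ℚ.*-cancelˡ-≤-pos (ι k) {{positive (0<ι-nonZero k)}}

0≤ι : ∀ k → 0ℚ ≤ ι k
0≤ι k = ι-mono {0} {k} ℕ.z≤n

module _ (m b r : ℕ) .{{_ : NonTrivial b}} where

  private
    B = b ℕ.^ r
    instance
      b≢0 : ℕ.NonZero b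
      b≢0 = ℕ.nonTrivial⇒nonZero b
      B≢0 : ℕ.NonZero B
      B≢0 = ℕ.m^n≢0 b r

    T : ∀ n → ℚ
    T n = distance (carriesLaw n b r) (stationary n)

  distance-linear : ι B * T (suc m) ≤ ι m
  distance-linear = ι-cancelˡ-≤ (2 ℕ.* B ℕ.^ m) {{ℕ.m*n≢0 2 (B ℕ.^ m) {{_}} {{ℕ.m^n≢0 B m}}}} (begin
    ι (2 ℕ.* B ℕ.^ m) * (ι B * t)
      ≡⟨ ι-*-assoc (2 ℕ.* B ℕ.^ m) B t ⟨
    ι (2 ℕ.* B ℕ.^ m ℕ.* B) * t
      ≡⟨ cong (λ m → ι m * t) (ℕS.solve 2 (λ c B → ℕS.con 2 ℕS.:* c ℕS.:* B ℕS.:= ℕS.con 2 ℕS.:* (B ℕS.:* c)) refl (B ℕ.^ m) B) ⟩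
    ι (2 ℕ.* B ℕ.^ suc m) * t
      ≡⟨ cong (_* t) (ι-* 2 (B ℕ.^ suc m)) ⟩
    ι 2 * ι (B ℕ.^ suc m) * t
      ≤⟨ distance-variation m b r (variation B m) ⟩
    ι m * ι (2 ℕ.* B ℕ.^ m)
      ≡⟨ ℚ.*-comm (ι m) (ι (2 ℕ.* B ℕ.^ m)) ⟩
    ι (2 ℕ.* B ℕ.^ m) * ι m ∎)
    where
    open ℚ.≤-Reasoning
    t = T (suc m)

  -- The bound B T ≤ (n - 1)(2B² + 1)/(3B²) for n = m + 4 with denominators cleared; the common
  -- factor `k` = 2Bᵐ⁺¹ is cancelled.
  distance-quartic : ι (3 ℕ.* (B ℕ.* B)) * (ι B * T (4 ℕ.+ m)) ≤ ι ((3 ℕ.+ m) ℕ.* (2 ℕ.* (B ℕ.* B) ℕ.+ 1))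
  distance-quartic = ι-cancelˡ-≤ k {{ℕ.m*n≢0 (2 ℕ.* c) B {{ℕ.m*n≢0 2 c {{_}} {{ℕ.m^n≢0 B m}}}}}} (begin
    ι k * (ι (3 ℕ.* (B ℕ.* B)) * (ι B * t))
      ≡⟨ cong (ι k *_) (ι-*-assoc (3 ℕ.* (B ℕ.* B)) B t) ⟨
    ι k * (ι (3 ℕ.* (B ℕ.* B) ℕ.* B) * t)
      ≡⟨ ι-*-assoc k (3 ℕ.* (B ℕ.* B) ℕ.* B) t ⟨
    ι (k ℕ.* (3 ℕ.* (B ℕ.* B) ℕ.* B)) * t
      ≡⟨ cong (λ m → ι m * t) (ℕS.solve 2 (λ c B → ℕS.con 2 ℕS.:* c ℕS.:* B ℕS.:* (ℕS.con 3 ℕS.:* (B ℕS.:* B) ℕS.:* B) ℕS.:=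
           ℕS.con 3 ℕS.:* (ℕS.con 2 ℕS.:* (B ℕS.:* (B ℕS.:* (B ℕS.:* (B ℕS.:* c)))))) refl c B) ⟩
    ι (3 ℕ.* (2 ℕ.* B ℕ.^ (4 ℕ.+ m))) * t
      ≡⟨ ι-*-assoc 3 (2 ℕ.* B ℕ.^ (4 ℕ.+ m)) t ⟩
    ι 3 * (ι (2 ℕ.* B ℕ.^ (4 ℕ.+ m)) * t)
      ≡⟨ cong (λ p → ι 3 * (p * t)) (ι-* 2 (B ℕ.^ (4 ℕ.+ m))) ⟩
    ι 3 * (ι 2 * ι (B ℕ.^ (4 ℕ.+ m)) * t)
      ≤⟨ *-monoˡ (0≤ι 3) (distance-variation (3 ℕ.+ m) b r (variation₄ B m)) ⟩
    ι 3 * (ι (3 ℕ.+ m) * ι (c ℕ.* quarticBound B))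
      ≡⟨ trans (cong (ι 3 *_) (sym (ι-* (3 ℕ.+ m) (c ℕ.* quarticBound B)))) (sym (ι-* 3 ((3 ℕ.+ m) ℕ.* (c ℕ.* quarticBound B)))) ⟩
    ι (3 ℕ.* ((3 ℕ.+ m) ℕ.* (c ℕ.* quarticBound B)))
      ≡⟨ cong ι (trans (ℕS.solve 3 (λ m c q → ℕS.con 3 ℕS.:* (m ℕS.:* (c ℕS.:* q)) ℕS.:= m ℕS.:* (c ℕS.:* (ℕS.con 3 ℕS.:* q))) refl (3 ℕ.+ m) c (quarticBound B))
           (trans (cong (λ q → (3 ℕ.+ m) ℕ.* (c ℕ.* q)) (quarticBound-closed B))
             (ℕS.solve 3 (λ m c B → m ℕS.:* (c ℕS.:* (ℕS.con 4 ℕS.:* (B ℕS.:* B ℕS.:* B) ℕS.:+ ℕS.con 2 ℕS.:* B)) ℕS.:=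
               ℕS.con 2 ℕS.:* c ℕS.:* B ℕS.:* (m ℕS.:* (ℕS.con 2 ℕS.:* (B ℕS.:* B) ℕS.:+ ℕS.con 1))) refl (3 ℕ.+ m) c B))) ⟩
    ι (k ℕ.* ((3 ℕ.+ m) ℕ.* (2 ℕ.* (B ℕ.* B) ℕ.+ 1)))
      ≡⟨ ι-* k ((3 ℕ.+ m) ℕ.* (2 ℕ.* (B ℕ.* B) ℕ.+ 1)) ⟩
    ι k * ι ((3 ℕ.+ m) ℕ.* (2 ℕ.* (B ℕ.* B) ℕ.+ 1)) ∎)
    where
    open ℚ.≤-Reasoning
    t = T (4 ℕ.+ m)
    c = B ℕ.^ m
    k = 2 ℕ.* c ℕ.* B

-- Reduces y ≤ q/p ≤ n/√2 to an inequality between natural numbers.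
square-bound : ∀ p q n .{{_ : ℕ.NonZero p}} {y} → 0ℚ ≤ y → ι p * y ≤ ι q → 2 ℕ.* (q ℕ.* q) ℕ.≤ p ℕ.* p ℕ.* (n ℕ.* n) →
  ι 2 * (y * y) ≤ ι (n ℕ.* n)
square-bound p q n {y} 0≤y py≤q le = ι-cancelˡ-≤ (p ℕ.* p) {{ℕ.m*n≢0 p p}} (begin
  ι (p ℕ.* p) * (ι 2 * (y * y))     ≡⟨ cong (_* (ι 2 * (y * y))) (ι-* p p) ⟩
  ι p * ι p * (ι 2 * (y * y))       ≡⟨ solve 3 (λ p t y → p :* p :* (t :* (y :* y)) := t :* ((p :* y) :* (p :* y))) refl (ι p) (ι 2) y ⟩
  ι 2 * ((ι p * y) * (ι p * y))     ≤⟨ *-monoˡ (0≤ι 2) (*-mono (0≤-* (0≤ι p) 0≤y) (0≤ι q) py≤q py≤q) ⟩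
  ι 2 * (ι q * ι q)                 ≡⟨ trans (cong (ι 2 *_) (sym (ι-* q q))) (sym (ι-* 2 (q ℕ.* q))) ⟩
  ι (2 ℕ.* (q ℕ.* q))               ≤⟨ ι-mono le ⟩
  ι (p ℕ.* p ℕ.* (n ℕ.* n))         ≡⟨ ι-* (p ℕ.* p) (n ℕ.* n) ⟩
  ι (p ℕ.* p) * ι (n ℕ.* n)         ∎)
  where open ℚ.≤-Reasoning

-- For B ≥ 3 the factor (2B² + 1)/3B² is at most 19/27 < 1/√2; for B ≤ 2 and larger n
-- the trivial bound y ≤ 2B is enough.
square-bound₄ : ∀ m B .{{_ : ℕ.NonZero B}} {y} → 0ℚ ≤ y → y ≤ ι (2 ℕ.* B) →
  ι (3 ℕ.* (B ℕ.* B)) * y ≤ ι ((3 ℕ.+ m) ℕ.* (2 ℕ.* (B ℕ.* B) ℕ.+ 1)) → ι 2 * (y * y) ≤ ι ((4 ℕ.+ m) ℕ.* (4 ℕ.+ m))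
square-bound₄ m 1 {y} 0≤y y≤2B h = square-bound 1 2 (4 ℕ.+ m) 0≤y (subst (_≤ ι 2) (sym (ℚ.*-identityˡ y)) y≤2B)
  (ℕ.≤-trans (ℕ.≤-trans (ℕ.m≤m+n 8 8) (ℕ.*-mono-≤ (ℕ.m≤m+n 4 m) (ℕ.m≤m+n 4 m))) (ℕ.≤-reflexive (sym (ℕ.*-identityˡ _))))
-- For B = 2: 12 = 3B², and 27 and 36 are (n - 1)(2B² + 1) for n = 4 and 5. The trivial bound y ≤ 4
-- is good enough from n = 6 on.
square-bound₄ 0 2 0≤y y≤2B h = square-bound 12 27 4 0≤y h (ℕ.≤ᵇ⇒≤ _ _ _)
square-bound₄ 1 2 0≤y y≤2B h = square-bound 12 36 5 0≤y h (ℕ.≤ᵇ⇒≤ _ _ _)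
square-bound₄ (suc (suc m)) 2 {y} 0≤y y≤2B h = square-bound 1 4 (6 ℕ.+ m) 0≤y (subst (_≤ ι 4) (sym (ℚ.*-identityˡ y)) y≤2B)
  (ℕ.≤-trans (ℕ.≤-trans (ℕ.m≤m+n 32 4) (ℕ.*-mono-≤ (ℕ.m≤m+n 6 m) (ℕ.m≤m+n 6 m))) (ℕ.≤-reflexive (sym (ℕ.*-identityˡ _))))
square-bound₄ m B@(suc (suc (suc B-3))) {y} 0≤y y≤2B h = square-bound 27 (19 ℕ.* (3 ℕ.+ m)) (4 ℕ.+ m) 0≤y
    (ι-cancelˡ-≤ (B ℕ.* B) scaled)
    (ℕ.≤-trans (ℕ.≤-reflexive (ℕS.solve 1 (λ k → ℕS.con 2 ℕS.:* (ℕS.con 19 ℕS.:* k ℕS.:* (ℕS.con 19 ℕS.:* k)) ℕS.:= ℕS.con 722 ℕS.:* (k ℕS.:* k)) refl (3 ℕ.+ m)))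
      (ℕ.*-mono-≤ (ℕ.m≤m+n 722 7) (ℕ.*-mono-≤ (ℕ.n≤1+n (3 ℕ.+ m)) (ℕ.n≤1+n (3 ℕ.+ m)))))
  where
  9≤B² : 9 ℕ.≤ B ℕ.* B
  9≤B² = ℕ.*-mono-≤ (ℕ.m≤m+n 3 B-3) (ℕ.m≤m+n 3 B-3)
  scaled : ι (B ℕ.* B) * (ι 27 * y) ≤ ι (B ℕ.* B) * ι (19 ℕ.* (3 ℕ.+ m))
  scaled = begin
    ι (B ℕ.* B) * (ι 27 * y)
      ≡⟨ ι-*-assoc (B ℕ.* B) 27 y ⟨
    ι (B ℕ.* B ℕ.* 27) * y
      ≡⟨ cong (λ k → ι k * y) (ℕS.solve 1 (λ s → s ℕS.:* ℕS.con 27 ℕS.:= ℕS.con 9 ℕS.:* (ℕS.con 3 ℕS.:* s)) refl (B ℕ.* B)) ⟩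
    ι (9 ℕ.* (3 ℕ.* (B ℕ.* B))) * y
      ≡⟨ ι-*-assoc 9 (3 ℕ.* (B ℕ.* B)) y ⟩
    ι 9 * (ι (3 ℕ.* (B ℕ.* B)) * y)
      ≤⟨ *-monoˡ (0≤ι 9) h ⟩
    ι 9 * ι ((3 ℕ.+ m) ℕ.* (2 ℕ.* (B ℕ.* B) ℕ.+ 1))
      ≡⟨ ι-* 9 ((3 ℕ.+ m) ℕ.* (2 ℕ.* (B ℕ.* B) ℕ.+ 1)) ⟨
    ι (9 ℕ.* ((3 ℕ.+ m) ℕ.* (2 ℕ.* (B ℕ.* B) ℕ.+ 1)))
      ≤⟨ ι-mono (ℕ.≤-trans (ℕ.≤-reflexive (ℕS.solve 2 (λ k s → ℕS.con 9 ℕS.:* (k ℕS.:* (ℕS.con 2 ℕS.:* s ℕS.:+ ℕS.con 1)) ℕS.:= k ℕS.:* (ℕS.con 18 ℕS.:* s ℕS.:+ ℕS.con 9)) refl (3 ℕ.+ m) (B ℕ.* B)))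
           (ℕ.≤-trans (ℕ.*-monoʳ-≤ (3 ℕ.+ m) (ℕ.+-monoʳ-≤ (18 ℕ.* (B ℕ.* B)) 9≤B²))
             (ℕ.≤-reflexive (ℕS.solve 2 (λ k s → k ℕS.:* (ℕS.con 18 ℕS.:* s ℕS.:+ s) ℕS.:= s ℕS.:* (ℕS.con 19 ℕS.:* k)) refl (3 ℕ.+ m) (B ℕ.* B))))) ⟩
    ι (B ℕ.* B ℕ.* (19 ℕ.* (3 ℕ.+ m)))
      ≡⟨ ι-* (B ℕ.* B) (19 ℕ.* (3 ℕ.+ m)) ⟩
    ι (B ℕ.* B) * ι (19 ℕ.* (3 ℕ.+ m)) ∎
    where open ℚ.≤-Reasoning

-- This is B T ≤ n/√2, squared so as to stay in ℚ. The linear bound settles n = 2 and 3, where 2 ·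
-- 1² ≤ 2² and 2 · 2² ≤ 3².
distance-square : ∀ n b r .{{_ : NonTrivial n}} .{{_ : NonTrivial b}} →
  let y = ι (b ℕ.^ r) * distance (carriesLaw n b r) (stationary n) in ι 2 * (y * y) ≤ ι (n ℕ.* n)
distance-square n b r = go n
  where
  B = b ℕ.^ r
  instance
    b≢0 : ℕ.NonZero b
    b≢0 = ℕ.nonTrivial⇒nonZero b
    B≢0 : ℕ.NonZero B
    B≢0 = ℕ.m^n≢0 b r
  y : ℕ → ℚ
  y n = ι B * distance (carriesLaw n b r) (stationary n)
  0≤y : ∀ n → 0ℚ ≤ y n
  0≤y n = 0≤-* (0≤ι B) (0≤distance (carriesLaw n b r) (stationary n))
  linear-bound : ∀ n-1 → ι 1 * y (suc n-1) ≤ ι n-1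
  linear-bound n-1 = subst (_≤ ι n-1) (sym (ℚ.*-identityˡ (y (suc n-1)))) (distance-linear n-1 b r)
  go : ∀ n .{{_ : NonTrivial n}} → ι 2 * (y n * y n) ≤ ι (n ℕ.* n)
  go 2 = square-bound 1 1 2 (0≤y 2) (linear-bound 1) (ℕ.≤ᵇ⇒≤ _ _ _)
  go 3 = square-bound 1 2 3 (0≤y 3) (linear-bound 2) (ℕ.≤ᵇ⇒≤ _ _ _)
  go (suc (suc (suc (suc m)))) = square-bound₄ m B (0≤y (4 ℕ.+ m))
    (subst (y (4 ℕ.+ m) ≤_) (trans (sym (ι-* B 2)) (cong ι (ℕ.*-comm B 2))) (*-monoˡ (0≤ι B) (distance≤2 (3 ℕ.+ m) b r)))
    (distance-quartic m b r)

-- Real logarithm, exponential and square root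

ι-^-^ : ∀ m K L → ι ((m ℕ.^ K) ℕ.^ L) ≡ (ι m ^ K) ^ L
ι-^-^ m K L = trans (ι-^ (m ℕ.^ K) L) (cong (_^ L) (ι-^ m K))

module _ {b : ℕ} (1<b : 1 ℕ.< b) where

  private instance
    b≢0 : ℕ.NonZero b
    b≢0 = ℕ.>-nonZero (ℕ.<-trans ℕ.z<s 1<b)

  -- The hypothesis times (k + 1)(l + 1), moved to ℕ so that both sides can serve as exponents of b.
  ratio-difference-≤ : ∀ a d r k l → ratio a k - ratio d k ≤ ι r + recip (suc l) →
    a ℕ.* suc l ℕ.≤ r ℕ.* suc k ℕ.* suc l ℕ.+ suc k ℕ.+ d ℕ.* suc l
  ratio-difference-≤ a d r k l h = ι-cancel {a ℕ.* L} {r ℕ.* K ℕ.* L ℕ.+ K ℕ.+ d ℕ.* L} (begin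
    ι (a ℕ.* L)
      ≡⟨ trans (ι-* a L) (cong (_* ι L) (ι-ratio a k)) ⟩
    ι K * ratio a k * ι L
      ≤⟨ linear (*-monoˡ (0≤-* (0≤ι K) (0≤ι L)) h)
           (solve 6 (λ K L x y r i → r :* K :* L :+ K :* (L :* i) :+ K :* y :* L :- K :* x :* L := K :* L :* (r :+ i) :- K :* L :* (x :- y)) refl
             (ι K) (ι L) (ratio a k) (ratio d k) (ι r) (recip L)) ⟩
    ι r * ι K * ι L + ι K * (ι L * recip L) + ι K * ratio d k * ι L
      ≡⟨ cong₂ (λ p q → ι r * ι K * ι L + p + q * ι L) (trans (cong (ι K *_) (ι-recip L)) (ℚ.*-identityʳ (ι K))) (sym (ι-ratio d k)) ⟩
    ι r * ι K * ι L + ι K + ι d * ι L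
      ≡⟨ trans (ι-+ (r ℕ.* K ℕ.* L ℕ.+ K) (d ℕ.* L)) (cong₂ _+_ (trans (ι-+ (r ℕ.* K ℕ.* L) K)
           (cong (_+ ι K) (trans (ι-* (r ℕ.* K) L) (cong (_* ι L) (ι-* r K))))) (ι-* d L)) ⟨
    ι (r ℕ.* K ℕ.* L ℕ.+ K ℕ.+ d ℕ.* L) ∎)
    where
    open ℚ.≤-Reasoning
    K = suc k
    L = suc l

  -- With u = p/q, K = k + 1 and L = l + 1, the exponent consists of the exact part r K L, of K from
  -- the tolerance 1/L, and of L from rounding down log_b of pᴷ. The rounding for q goes in the
  -- favourable direction.
  logApprox-upper : ∀ u r k l → 0ℚ < u → logApprox b u k ≤ ι r + recip (suc l) →
    (u ^ suc k) ^ suc l ≤ ι (b ℕ.^ (r ℕ.* suc k ℕ.* suc l ℕ.+ suc k ℕ.+ suc l))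
  logApprox-upper u r k l 0<u h = ℚ.*-cancelʳ-≤-pos (ι ((q ℕ.^ K) ℕ.^ L)) {{positive (0<ι-nonZero ((q ℕ.^ K) ℕ.^ L) {{q^≢0}})}} (begin
    (u ^ K) ^ L * ι ((q ℕ.^ K) ℕ.^ L)
      ≡⟨ cong ((u ^ K) ^ L *_) (ι-^-^ q K L) ⟩
    (u ^ K) ^ L * (ι q ^ K) ^ L
      ≡⟨ trans (cong (_^ L) (ℚ-^-distrib-* u (ι q) K)) (ℚ-^-distrib-* (u ^ K) (ι q ^ K) L) ⟨
    ((u * ι q) ^ K) ^ L
      ≡⟨ cong (λ x → (x ^ K) ^ L) (pos-↥ u 0<u) ⟨
    (ι p ^ K) ^ L
      ≡⟨ ι-^-^ p K L ⟨
    ι ((p ℕ.^ K) ℕ.^ L)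
      ≤⟨ ι-mono {(p ℕ.^ K) ℕ.^ L} {b ℕ.^ N ℕ.* (q ℕ.^ K) ℕ.^ L} integral ⟩
    ι (b ℕ.^ N ℕ.* (q ℕ.^ K) ℕ.^ L)
      ≡⟨ ι-* (b ℕ.^ N) ((q ℕ.^ K) ℕ.^ L) ⟩
    ι (b ℕ.^ N) * ι ((q ℕ.^ K) ℕ.^ L) ∎)
    where
    K = suc k
    L = suc l
    p = ℤ.∣ ↥ u ∣
    q = ↧ₙ u
    N = r ℕ.* K ℕ.* L ℕ.+ K ℕ.+ L
    a = ⌊log⌋ b (p ℕ.^ K)
    d = ⌊log⌋ b (q ℕ.^ K)
    q^≢0 : ℕ.NonZero ((q ℕ.^ K) ℕ.^ L)
    q^≢0 = ℕ.m^n≢0 (q ℕ.^ K) L {{ℕ.m^n≢0 q K}}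
    integral : (p ℕ.^ K) ℕ.^ L ℕ.≤ b ℕ.^ N ℕ.* (q ℕ.^ K) ℕ.^ L
    integral = begin
      (p ℕ.^ K) ℕ.^ L
        ≤⟨ ℕ.^-monoˡ-≤ L (⌊log⌋-upper 1<b (p ℕ.^ K)) ⟩
      (b ℕ.^ suc a) ℕ.^ L
        ≡⟨ ℕ.^-*-assoc b (suc a) L ⟩
      b ℕ.^ (L ℕ.+ a ℕ.* L)
        ≤⟨ ℕ.^-monoʳ-≤ b (ℕ.+-monoʳ-≤ L (ratio-difference-≤ a d r k l h)) ⟩
      b ℕ.^ (L ℕ.+ (r ℕ.* K ℕ.* L ℕ.+ K ℕ.+ d ℕ.* L))
        ≡⟨ cong (b ℕ.^_) (ℕS.solve 4 (λ l x k y → l ℕS.:+ (x ℕS.:+ k ℕS.:+ y) ℕS.:= x ℕS.:+ k ℕS.:+ l ℕS.:+ y) refl L (r ℕ.* K ℕ.* L) K (d ℕ.* L)) ⟩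
      b ℕ.^ (N ℕ.+ d ℕ.* L)
        ≡⟨ trans (ℕ.^-distribˡ-+-* b N (d ℕ.* L)) (cong (b ℕ.^ N ℕ.*_) (sym (ℕ.^-*-assoc b d L))) ⟩
      b ℕ.^ N ℕ.* (b ℕ.^ d) ℕ.^ L
        ≤⟨ ℕ.*-monoʳ-≤ (b ℕ.^ N) (ℕ.^-monoˡ-≤ L (⌊log⌋-lower 1<b (q ℕ.^ K) (ℕ.m^n>0 q K))) ⟩
      b ℕ.^ N ℕ.* (q ℕ.^ K) ℕ.^ L ∎
      where open ℕ.≤-Reasoning
    open ℚ.≤-Reasoning

  bernoulli : ∀ {η} → 0ℚ ≤ η → ∀ l → 1ℚ + ι l * η ≤ (1ℚ + η) ^ l
  bernoulli {η} 0≤η zero    = ℚ.≤-reflexive (trans (cong (1ℚ +_) (ℚ.*-zeroˡ η)) (ℚ.+-identityʳ 1ℚ))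
  bernoulli {η} 0≤η (suc l) = begin
    1ℚ + ι (suc l) * η
      ≤⟨ linear (0≤-* (0≤-* (0≤ι l) 0≤η) 0≤η) (trans
           (cong (λ p → (1ℚ + η) * (1ℚ + ι l * η) - (1ℚ + p * η)) (ι-+ 1 l))
           (solve 2 (λ l e → (con 1ℚ :+ e) :* (con 1ℚ :+ l :* e) :- (con 1ℚ :+ (con 1ℚ :+ l) :* e) := l :* e :* e :- con 0ℚ) refl (ι l) η)) ⟩
    (1ℚ + η) * (1ℚ + ι l * η)
      ≤⟨ *-monoˡ (ℚ.+-mono-≤ (0≤ι 1) 0≤η) (bernoulli 0≤η l) ⟩
    (1ℚ + η) ^ suc l ∎
    where open ℚ.≤-Reasoning

  -- Raising to the power (k + 1)(l + 1), the errors of logApprox u k and of r + 1/(l + 1)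
  -- amount to a factor b^(k+l+2), which is less than (1 + η)^((k+1)(l+1)) ≥ b^(2(k+1)).
  logApprox-≤⇒≤ : ∀ u r k l η → 0ℚ < u → 0ℚ < η → ι (b ℕ.* b) ≤ (1ℚ + η) ^ suc l → suc l ℕ.≤ k →
    logApprox b u k ≤ ι r + recip (suc l) → u ≤ ι (b ℕ.^ r) * (1ℚ + η)
  logApprox-≤⇒≤ u r k l η 0<u 0<η b²≤ l<k h = case u ℚ.≤? w of λ where
      (yes u≤w) → u≤w
      (no  u≰w) → contradiction (ℕ.+-cancelˡ-≤ (r ℕ.* K ℕ.* L ℕ.+ K) K L (subst (ℕ._≤ r ℕ.* K ℕ.* L ℕ.+ K ℕ.+ L)
        (ℕS.solve 2 (λ x k → x ℕS.:+ ℕS.con 2 ℕS.:* k ℕS.:= x ℕS.:+ k ℕS.:+ k) refl (r ℕ.* K ℕ.* L) K)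
        (^-cancel-≤ 1<b (ι-cancel {b ℕ.^ (r ℕ.* K ℕ.* L ℕ.+ 2 ℕ.* K)} {b ℕ.^ (r ℕ.* K ℕ.* L ℕ.+ K ℕ.+ L)} (chain (ℚ.<⇒≤ (ℚ.≰⇒> u≰w)))))))
        (ℕ.<⇒≱ (ℕ.s≤s l<k))
    where
    K = suc k
    L = suc l
    w = ι (b ℕ.^ r) * (1ℚ + η)
    0≤1+η : 0ℚ ≤ 1ℚ + η
    0≤1+η = ℚ.+-mono-≤ (0≤ι 1) (ℚ.<⇒≤ 0<η)
    ^-flip : ∀ x → (x ^ L) ^ K ≡ (x ^ K) ^ L
    ^-flip x = trans (^-assocʳ x L K) (trans (cong (x ^_) (ℕ.*-comm L K)) (sym (^-assocʳ x K L)))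
      where open import Algebra.Properties.Semiring.Exp (CommutativeRing.semiring ℚ.+-*-commutativeRing) using (^-assocʳ)
    chain : w ≤ u → ι (b ℕ.^ (r ℕ.* K ℕ.* L ℕ.+ 2 ℕ.* K)) ≤ ι (b ℕ.^ (r ℕ.* K ℕ.* L ℕ.+ K ℕ.+ L))
    chain w≤u = begin
      ι (b ℕ.^ (r ℕ.* K ℕ.* L ℕ.+ 2 ℕ.* K))
        ≡⟨ cong ι (trans (ℕ.^-distribˡ-+-* b (r ℕ.* K ℕ.* L) (2 ℕ.* K)) (cong₂ ℕ._*_
             (sym (trans (ℕ.^-*-assoc (b ℕ.^ r) K L) (trans (ℕ.^-*-assoc b r (K ℕ.* L)) (cong (b ℕ.^_) (sym (ℕ.*-assoc r K L))))))
             (trans (sym (ℕ.^-*-assoc b 2 K)) (cong (λ m → (b ℕ.* m) ℕ.^ K) (ℕ.*-identityʳ b))))) ⟩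
      ι (((b ℕ.^ r) ℕ.^ K) ℕ.^ L ℕ.* (b ℕ.* b) ℕ.^ K)
        ≡⟨ trans (ι-* (((b ℕ.^ r) ℕ.^ K) ℕ.^ L) ((b ℕ.* b) ℕ.^ K)) (cong₂ _*_ (ι-^-^ (b ℕ.^ r) K L) (ι-^ (b ℕ.* b) K)) ⟩
      (ι (b ℕ.^ r) ^ K) ^ L * ι (b ℕ.* b) ^ K
        ≤⟨ *-monoˡ (proj₁ (^-mono L (proj₁ (^-mono K (0≤ι (b ℕ.^ r)) ℚ.≤-refl)) ℚ.≤-refl)) (proj₂ (^-mono K (0≤ι (b ℕ.* b)) b²≤)) ⟩
      (ι (b ℕ.^ r) ^ K) ^ L * ((1ℚ + η) ^ L) ^ K
        ≡⟨ cong ((ι (b ℕ.^ r) ^ K) ^ L *_) (^-flip (1ℚ + η)) ⟩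
      (ι (b ℕ.^ r) ^ K) ^ L * ((1ℚ + η) ^ K) ^ L
        ≡⟨ trans (cong (_^ L) (ℚ-^-distrib-* (ι (b ℕ.^ r)) (1ℚ + η) K)) (ℚ-^-distrib-* (ι (b ℕ.^ r) ^ K) ((1ℚ + η) ^ K) L) ⟨
      (w ^ K) ^ L
        ≤⟨ proj₂ (^-mono L (proj₁ (^-mono K 0≤w ℚ.≤-refl)) (proj₂ (^-mono K 0≤w w≤u))) ⟩
      (u ^ K) ^ L
        ≤⟨ logApprox-upper u r k l 0<u h ⟩
      ι (b ℕ.^ (r ℕ.* K ℕ.* L ℕ.+ K ℕ.+ L)) ∎
      where
      open ℚ.≤-Reasoning
      0≤w : 0ℚ ≤ w
      0≤w = 0≤-* (0≤ι (b ℕ.^ r)) 0≤1+η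

  bernoulli-large : ∀ η → 0ℚ < η → ∃[ l ] ι (b ℕ.* b) ≤ (1ℚ + η) ^ suc l
  bernoulli-large η 0<η = l , (begin
    ι (b ℕ.* b)                       ≡⟨ ℚ.*-identityʳ (ι (b ℕ.* b)) ⟨
    ι (b ℕ.* b) * 1ℚ                  ≡⟨ cong (ι (b ℕ.* b) *_) (*-inv 0<η) ⟨
    ι (b ℕ.* b) * (η * inv η)         ≡⟨ solve 3 (λ c e i → c :* (e :* i) := c :* i :* e) refl (ι (b ℕ.* b)) η (inv η) ⟩
    ι (b ℕ.* b) * inv η * η           ≤⟨ ℚ.*-monoʳ-≤-nonNeg η {{nonNegative (ℚ.<⇒≤ 0<η)}} (ℚ.≤-trans (≤ι∣↥∣ (ι (b ℕ.* b) * inv η)) (ι-mono {l} {suc l} (ℕ.n≤1+n l))) ⟩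
    ι (suc l) * η                     ≡⟨ ℚ.+-identityˡ (ι (suc l) * η) ⟨
    0ℚ + ι (suc l) * η                ≤⟨ ℚ.+-monoˡ-≤ (ι (suc l) * η) (0≤ι 1) ⟩
    1ℚ + ι (suc l) * η                ≤⟨ bernoulli (ℚ.<⇒≤ 0<η) (suc l) ⟩
    (1ℚ + η) ^ suc l                  ∎)
    where
    open ℚ.≤-Reasoning
    l = ℤ.∣ ↥ (ι (b ℕ.* b) * inv η) ∣

-- For reals the conclusion reads x ≤ bʳ, but single terms of the sequence may exceed bʳ, hence the
-- factor 1 + η. The tolerance passed to the hypothesis is 1/(l + 1), with l so large that (1 +
-- η)ˡ⁺¹ ≥ b².
log-≤⇒≤ : ∀ b .{{_ : NonTrivial b}} x (0<x : Positiveʳ x) r → log b x 0<x ≤ʳ fromℤ (ℤ.+ r) →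
  ∀ η → 0ℚ < η → ∃[ N ] ∀ k → N ℕ.≤ k → seq x k ≤ ι (b ℕ.^ r) * (1ℚ + η)
log-≤⇒≤ b x (δ , 0<δ , N₁ , pos) r h η 0<η =
  let 1<b = ℕ.nonTrivial⇒n>1 b
      l , b²≤ = bernoulli-large 1<b η 0<η
      N₂ , h₂ = h (recip (suc l)) (recip>0 (suc l))
  in N₁ ℕ.⊔ N₂ ℕ.⊔ suc l , λ k le →
    let le₁ = ⊔-left (N₁ ℕ.⊔ N₂) (suc l) le
    in logApprox-≤⇒≤ 1<b (seq x k) r k l η
         (ℚ.<-≤-trans 0<δ (subst (_≤ seq x k) (ℚ.+-identityˡ δ) (pos k (⊔-left N₁ N₂ le₁)))) 0<η b²≤
         (⊔-right (N₁ ℕ.⊔ N₂) (suc l) le) (h₂ k (⊔-right N₁ N₂ le₁))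

-- The exponential bound and the final estimate

1+x≤expSum : ∀ {x} → 0ℚ ≤ x → ∀ k → 1ℚ + x ≤ expSum x (2 ℕ.+ k)
1+x≤expSum {x} 0≤x zero    = ℚ.≤-reflexive (solve 1 (λ x → con 1ℚ :+ x := con 0ℚ :+ con 1ℚ :* con 1ℚ :+ x :* con 1ℚ :* con 1ℚ) refl x)
1+x≤expSum {x} 0≤x (suc k) = ℚ.≤-trans (1+x≤expSum 0≤x k) (linear
  (0≤-* (proj₁ (^-mono (2 ℕ.+ k) 0≤x ℚ.≤-refl)) (ℚ.<⇒≤ (recip>0 ((2 ℕ.+ k) !) {{(2 ℕ.+ k) ℕ.!≢0}})))
  (solve 2 (λ e t → e :+ t :- e := t :- con 0ℚ) refl (expSum x (2 ℕ.+ k)) (x ^ (2 ℕ.+ k) * 1/! (2 ℕ.+ k))))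

-- Here s, x and v stand for approximations to c, 1/(2c²) and exp(1/(2c²)) - 1, and A exceeds √v.
-- Then T ≤ n/(√2 B) ≤ (1 + η)/(√2 s) = (1 + η)√x ≤ (1 + η) A. Roots are avoided by assuming A (1 +
-- η) < T and squaring, which gives n² < n².
distance-≤ : ∀ {n B s x v A η T} → 0ℚ < s → 0ℚ < B → 0ℚ < η → 0ℚ ≤ A → 0ℚ ≤ T → 0ℚ ≤ n →
  ι 2 * (s * s) * x ≡ 1ℚ → x ≤ v → v < A * A → s * n ≤ B * (1ℚ + η) → ι 2 * ((B * T) * (B * T)) ≤ n * n →
  T ≤ A * (1ℚ + η)
distance-≤ {n} {B} {s} {x} {v} {A} {η} {T} 0<s 0<B 0<η 0≤A 0≤T 0≤n eq x≤v v<A² sn≤ 2B²T²≤n² = case T ℚ.≤? A * E of λ where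
    (yes le) → le
    (no ¬le) → contradiction (chain (ℚ.<⇒≤ (ℚ.≰⇒> ¬le))) (ℚ.<-irrefl refl)
  where
  E = 1ℚ + η
  0<E : 0ℚ < E
  0<E = ℚ.+-mono-< (ℚ.positive⁻¹ 1ℚ) 0<η
  c = ι 2 * ((B * E) * (B * E))
  0<BE : 0ℚ < B * E
  0<BE = 0<-* 0<B 0<E
  0<c : 0ℚ < c
  0<c = 0<-* (0<ι 1) (0<-* 0<BE 0<BE)
  0<2s² : 0ℚ < ι 2 * (s * s)
  0<2s² = 0<-* (0<ι 1) (0<-* 0<s 0<s)
  0≤x : 0ℚ ≤ x
  0≤x = ℚ.*-cancelˡ-≤-pos (ι 2 * (s * s)) {{positive 0<2s²}} (subst₂ _≤_ (sym (ℚ.*-zeroʳ (ι 2 * (s * s)))) (sym eq) (0≤ι 1))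
  open ℚ.≤-Reasoning
  chain : A * E ≤ T → n * n < n * n
  chain AE≤T = begin-strict
    n * n                                   ≡⟨ ℚ.*-identityʳ (n * n) ⟨
    n * n * 1ℚ                              ≡⟨ cong (n * n *_) eq ⟨
    n * n * (ι 2 * (s * s) * x)             ≡⟨ solve 4 (λ n t s x → n :* n :* (t :* (s :* s) :* x) := t :* ((s :* n) :* (s :* n)) :* x) refl n (ι 2) s x ⟩
    ι 2 * ((s * n) * (s * n)) * x           ≤⟨ ℚ.*-monoʳ-≤-nonNeg x {{nonNegative 0≤x}} (*-monoˡ (0≤ι 2) (*-mono (0≤-* (ℚ.<⇒≤ 0<s) 0≤n) (ℚ.<⇒≤ 0<BE) sn≤ sn≤)) ⟩
    c * x                                   ≤⟨ *-monoˡ (ℚ.<⇒≤ 0<c) x≤v ⟩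
    c * v                                   <⟨ ℚ.*-monoʳ-<-pos c {{positive 0<c}} v<A² ⟩
    c * (A * A)                             ≡⟨ solve 4 (λ t b e a → t :* ((b :* e) :* (b :* e)) :* (a :* a) := t :* ((b :* (a :* e)) :* (b :* (a :* e)))) refl (ι 2) B E A ⟩
    ι 2 * ((B * (A * E)) * (B * (A * E)))   ≤⟨ *-monoˡ (0≤ι 2) (*-mono (0≤-* (ℚ.<⇒≤ 0<B) (0≤-* 0≤A (ℚ.<⇒≤ 0<E))) (0≤-* (ℚ.<⇒≤ 0<B) 0≤T) BAE≤ BAE≤) ⟩
    ι 2 * ((B * T) * (B * T))               ≤⟨ 2B²T²≤n² ⟩
    n * n                                   ∎
    where
    BAE≤ : B * (A * E) ≤ B * T
    BAE≤ = *-monoˡ (ℚ.<⇒≤ 0<B) AE≤T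

-- If A < T then A ≤ 2, so the relative error ε/2 amounts to an additive error of at most ε.
≤-relax : ∀ {T A ε} → 0ℚ < ε → T ≤ ι 2 → T ≤ A * (1ℚ + ε * ½) → T ≤ A + ε
≤-relax {T} {A} {ε} 0<ε T≤2 T≤ = case T ℚ.≤? A of λ where
  (yes T≤A) → ℚ.≤-trans T≤A (linear (ℚ.<⇒≤ 0<ε) (solve 2 (λ a e → a :+ e :- a := e :- con 0ℚ) refl A ε))
  (no  T≰A) → ℚ.≤-trans T≤ (linear (*-monoˡ (ℚ.<⇒≤ (0<half 0<ε)) (ℚ.≤-trans (ℚ.<⇒≤ (ℚ.≰⇒> T≰A)) T≤2))
    (solve 2 (λ a e → a :+ e :- a :* (con 1ℚ :+ e :* con ½) := e :* con ½ :* con (ι 2) :- e :* con ½ :* a) refl A ε))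

open import Data.Integer.Base using (+_)

theorem3p1 : (n b : ℕ) → .{{_ : NonTrivial n}} → .{{_ : NonTrivial b}} →
    (c : ℝ) → (0<c : Positiveʳ c) → (r : ℕ) →
    IsCeiling (log b (c *ʳ fromℕ n) (*ʳ-pos c (fromℕ n) 0<c (fromℕ-pos n))) (+ r) →
    fromℚ (totalVariation (carriesLaw n b r) (stationary n))
    ≤ʳ fromℚ ½ *ʳ sqrt (exp (recipʳ (fromℕ 2 *ʳ (c *ʳ c))
    (*ʳ-pos (fromℕ 2) (c *ʳ c) (fromℕ-pos 2) (*ʳ-pos c c 0<c 0<c)))
    -ʳ fromℕ 1)
theorem3p1 n b c 0<c@(δ , 0<δ , N₁ , pos) r (_ , log≤r) ε 0<ε =
  let η = ε * ½
      0<η = 0<half 0<ε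
      N₂ , cn≤ = log-≤⇒≤ b (c *ʳ fromℕ n) (*ʳ-pos c (fromℕ n) 0<c (fromℕ-pos n)) r log≤r η 0<η
      N₃ , recip≤ = recip-small ε 0<ε
  -- The index must be at least 2 for `expSum x k` to contain the terms 1 + x.
  in N₁ ℕ.⊔ N₂ ℕ.⊔ (N₃ ℕ.⊔ 2) , λ k le →
    let le₁ = ⊔-left (N₁ ℕ.⊔ N₂) (N₃ ℕ.⊔ 2) le
        le₂ = ⊔-right (N₁ ℕ.⊔ N₂) (N₃ ℕ.⊔ 2) le
    in conclude k (⊔-left N₁ N₂ le₁) (cn≤ k (⊔-right N₁ N₂ le₁)) (recip≤ k (⊔-left N₃ 2 le₂)) (⊔-right N₃ 2 le₂)
  where
  B = b ℕ.^ r
  T = distance (carriesLaw n b r) (stationary n)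
  conclude : ∀ k → N₁ ℕ.≤ k → seq c k * ι n ≤ ι B * (1ℚ + ε * ½) → recip (suc k) ≤ ε → 2 ℕ.≤ k →
    ½ * T ≤ ½ * sqrtApprox (expSum (inv (ι 2 * (seq c k * seq c k))) k - ι 1) k + ε
  conclude k N₁≤k cn≤ recip≤ε 2≤k = begin
    ½ * T
      ≤⟨ *-monoˡ (ℚ.<⇒≤ (ℚ.positive⁻¹ ½)) (≤-relax {T} {a + recip (suc k)} 0<ε T≤2 T≤) ⟩
    ½ * (a + recip (suc k) + ε)
      ≤⟨ *-monoˡ (ℚ.<⇒≤ (ℚ.positive⁻¹ ½)) (ℚ.+-monoˡ-≤ ε (ℚ.+-monoʳ-≤ a recip≤ε)) ⟩
    -- One ε pays for the factor 1 + η, the other for the grid width 1/(k + 1) of `sqrtApprox`; the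
    -- ½ in front makes them add up to ε.
    ½ * (a + ε + ε)
      ≡⟨ solve 2 (λ a e → con ½ :* (a :+ e :+ e) := con ½ :* a :+ e) refl a ε ⟩
    ½ * a + ε ∎
    where
    open ℚ.≤-Reasoning
    s = seq c k
    x = inv (ι 2 * (s * s))
    v = expSum x k - ι 1
    a = sqrtApprox v k
    0<s : 0ℚ < s
    0<s = ℚ.<-≤-trans 0<δ (subst (_≤ s) (ℚ.+-identityˡ δ) (pos k N₁≤k))
    0<2s² : 0ℚ < ι 2 * (s * s)
    0<2s² = 0<-* (0<ι 1) (0<-* 0<s 0<s)
    x≤v : x ≤ v
    x≤v = linear (subst (λ m → 1ℚ + x ≤ expSum x m) (ℕ.m+[n∸m]≡n 2≤k) (1+x≤expSum (ℚ.<⇒≤ (inv>0 0<2s²)) (k ℕ.∸ 2)))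
      (solve 2 (λ x e → e :- con (ι 1) :- x := e :- (con 1ℚ :+ x)) refl x (expSum x k))
    0≤a : 0ℚ ≤ a
    0≤a = 0≤ratio (greatest (squareBelow? v k) (sqrtBound v k)) k
    T≤2 : T ≤ ι 2
    T≤2 = bound n
      where
      bound : ∀ n .{{_ : NonTrivial n}} → distance (carriesLaw n b r) (stationary n) ≤ ι 2
      bound (suc n-1) = distance≤2 n-1 b r
    T≤ : T ≤ (a + recip (suc k)) * (1ℚ + ε * ½)
    T≤ = distance-≤ 0<s (0<ι-nonZero B {{ℕ.m^n≢0 b r {{ℕ.nonTrivial⇒nonZero b}}}}) (0<half 0<ε) (ℚ.+-mono-≤ 0≤a (ℚ.<⇒≤ (recip>0 (suc k))))
      (0≤distance (carriesLaw n b r) (stationary n)) (0≤ι n) (*-inv 0<2s²) x≤v (sqrtApprox-upper v k) cn≤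
      (subst (ι 2 * ((ι B * T) * (ι B * T)) ≤_) (ι-* n n) (distance-square n b r))
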